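{- There is a $\left(\min\{d,m^{2/3}\}\log d\right)$-approximation algorithm for Coverage Approximate Extension. If $d$ is a constant then there is a $d$-approximation algorithm.
   Context: $[m]=\{1,\dots,m\}$. A set function $f:2^{[m]}\to\mathbb{R}_{\ge 0}$ is a coverage function if there exist a universe $U$ of elements with non-negative weights and sets $A_1,\dots,A_m\subseteq U$ such that for every $S\subseteq[m]$, $f(S)$ is the total weight of the elements of $\bigcup_{j\in S}A_j$. A partial function is $H=\{(T_1,f_1),\dots,(T_n,f_n)\}$ with $T_i\subseteq[m]$ and $f_i\ge 0$; $d=\max_{i\in[n]}|T_i|$. In Coverage Approximate Extension, the input is a partial function $H$ and the goal is to determine $\alpha^*$, the minimum value of $\alpha\ge 1$ such that there exists a coverage function $f:2^{[m]}\to\mathbb{R}_{\ge0}$ satisfying $f_i\le f(T_i)\le\alpha f_i$ for all $i\in[n]$. A $\rho$-approximation algorithm is a polynomial-time algorithm that returns a value approximating $\alpha^*$ within the multiplicative factor $\rho$, i.e. a value $\beta$ with $\alpha^*\le\beta\le\rho\,\alpha^*$.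
   Formalization: The first claim is stated for d ≥ 2 (at d = 1 the factor with log d is 0 and no value can satisfy it; at d = 0 it is undefined) and the second for d ≥ 1 (at d = 0 the factor is 0); log is base 2, and the input values f_i are rational so that an instance is a finite input. -}

module Defs where

open import Data.Bool.Base using (if_then_else_)
open import Data.Fin.Base using (Fin)
open import Data.Fin.Subset using (Subset; ⋃) renaming (∣_∣ to card)
open import Data.Fin.Subset.Properties using (_∈?_)
import Data.Integer.Base as ℤ
import Data.Integer.Properties as ℤ
import Data.Nat.ListAction as ListAction
open import Data.List.Base as List using (List; []; _∷_; _++_; concatMap)
open import Data.List.Relation.Unary.All using (All)
open import Data.Nat.Base as ℕ using (ℕ; zero; suc; NonZero)
open import Data.Nat.Logarithm using (⌊log₂_⌋)
import Data.Nat.Properties as ℕ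
open import Data.Product.Base using (∃-syntax; Σ-syntax; _×_; _,_)
open import Data.Rational.Base as ℚ using (ℚ; 0ℚ; 1ℚ; ½; ∣_∣)
import Data.Rational.Properties as ℚ
open import Data.Rational.Solver using (module +-*-Solver)
import Data.Rational.Unnormalised.Base as ℚᵘ
import Data.Rational.Unnormalised.Properties as ℚᵘ
open import Data.Sum.Base using (inj₁; inj₂)
open import Data.Vec.Base as Vec using (Vec)
open import Relation.Binary.PropositionalEquality
  using (_≡_; _≢_; refl; sym; trans; cong; cong₂; subst; subst₂)
open import Relation.Nullary using (¬_; Dec; yes; no; does; contradiction)

sub≤⇒≤add : ∀ {p q ε} → p ℚ.- q ℚ.≤ ε → p ℚ.≤ q ℚ.+ ε
sub≤⇒≤add {p} {q} {ε} h = subst (ℚ._≤ q ℚ.+ ε) eq (ℚ.+-monoʳ-≤ q h)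
  where
  open +-*-Solver
  eq : q ℚ.+ (p ℚ.- q) ≡ p
  eq = solve 2 (λ p q → q :+ (p :- q) := p) refl p q

≤add⇒sub≤ : ∀ {p q ε} → p ℚ.≤ q ℚ.+ ε → p ℚ.- q ℚ.≤ ε
≤add⇒sub≤ {p} {q} {ε} h = subst (p ℚ.- q ℚ.≤_) eq (ℚ.+-monoˡ-≤ (ℚ.- q) h)
  where
  open +-*-Solver
  eq : (q ℚ.+ ε) ℚ.- q ≡ ε
  eq = solve 2 (λ q ε → (q :+ ε) :- q := ε) refl q ε

neg-sub : ∀ p q → ℚ.- (p ℚ.- q) ≡ q ℚ.- p
neg-sub = solve 2 (λ p q → :- (p :- q) := q :- p) refl
  where open +-*-Solver

p≤∣p∣ : ∀ p → p ℚ.≤ ∣ p ∣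
p≤∣p∣ p with ℚ.≤-total 0ℚ p
... | inj₁ 0≤p = ℚ.≤-reflexive (sym (ℚ.0≤p⇒∣p∣≡p 0≤p))
... | inj₂ p≤0 = ℚ.≤-trans p≤0 (ℚ.0≤∣p∣ p)

near⇒≤ : ∀ {p q ε} → ∣ p ℚ.- q ∣ ℚ.≤ ε → p ℚ.≤ q ℚ.+ ε
near⇒≤ {p} {q} h = sub≤⇒≤add (ℚ.≤-trans (p≤∣p∣ (p ℚ.- q)) h)

≤⇒near : ∀ {p q ε} → p ℚ.≤ q ℚ.+ ε → q ℚ.≤ p ℚ.+ ε → ∣ p ℚ.- q ∣ ℚ.≤ ε
≤⇒near {p} {q} {ε} h₁ h₂ with ℚ.∣p∣≡p∨∣p∣≡-p (p ℚ.- q)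
... | inj₁ e = subst (ℚ._≤ ε) (sym e) (≤add⇒sub≤ h₁)
... | inj₂ e = subst (ℚ._≤ ε) (sym (trans e (neg-sub p q))) (≤add⇒sub≤ h₂)

½ε>0 : ∀ {ε} → 0ℚ ℚ.< ε → 0ℚ ℚ.< ½ ℚ.* ε
½ε>0 {ε} ε>0 = subst (ℚ._< ½ ℚ.* ε) (ℚ.*-zeroʳ ½) (ℚ.*-monoʳ-<-pos ½ ε>0)

½ε+½ε : ∀ ε → ½ ℚ.* ε ℚ.+ ½ ℚ.* ε ≡ ε
½ε+½ε ε = trans (sym (ℚ.*-distribʳ-+ ε ½ ½)) (ℚ.*-identityˡ ε)

near-+ : ∀ p p′ q q′ {ε} → ∣ p ℚ.- p′ ∣ ℚ.≤ ½ ℚ.* ε → ∣ q ℚ.- q′ ∣ ℚ.≤ ½ ℚ.* ε →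
         ∣ (p ℚ.+ q) ℚ.- (p′ ℚ.+ q′) ∣ ℚ.≤ ε
near-+ p p′ q q′ {ε} h₁ h₂ = begin
  ∣ (p ℚ.+ q) ℚ.- (p′ ℚ.+ q′) ∣   ≡⟨ cong ∣_∣ (eq p p′ q q′) ⟩
  ∣ (p ℚ.- p′) ℚ.+ (q ℚ.- q′) ∣   ≤⟨ ℚ.∣p+q∣≤∣p∣+∣q∣ (p ℚ.- p′) (q ℚ.- q′) ⟩
  ∣ p ℚ.- p′ ∣ ℚ.+ ∣ q ℚ.- q′ ∣   ≤⟨ ℚ.+-mono-≤ h₁ h₂ ⟩
  ½ ℚ.* ε ℚ.+ ½ ℚ.* ε             ≡⟨ ½ε+½ε ε ⟩
  ε                               ∎
  where
  open ℚ.≤-Reasoning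
  eq : ∀ p p′ q q′ → (p ℚ.+ q) ℚ.- (p′ ℚ.+ q′) ≡ (p ℚ.- p′) ℚ.+ (q ℚ.- q′)
  eq = solve 4 (λ p p′ q q′ → (p :+ q) :- (p′ :+ q′) := (p :- p′) :+ (q :- q′)) refl
    where open +-*-Solver

near-* : ∀ p p′ {q B δ} → ∣ p ℚ.- p′ ∣ ℚ.≤ δ → ∣ q ∣ ℚ.≤ B →
         ∣ p ℚ.* q ℚ.- p′ ℚ.* q ∣ ℚ.≤ B ℚ.* δ
near-* p p′ {q} {B} {δ} h₁ h₂ = begin
  ∣ p ℚ.* q ℚ.- p′ ℚ.* q ∣   ≡⟨ cong ∣_∣ (eq p p′ q) ⟩
  ∣ q ℚ.* (p ℚ.- p′) ∣       ≡⟨ ℚ.∣p*q∣≡∣p∣*∣q∣ q (p ℚ.- p′) ⟩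
  ∣ q ∣ ℚ.* ∣ p ℚ.- p′ ∣     ≤⟨ ℚ.*-monoʳ-≤-nonNeg ∣ p ℚ.- p′ ∣ {{ℚ.nonNegative (ℚ.0≤∣p∣ (p ℚ.- p′))}} h₂ ⟩
  B ℚ.* ∣ p ℚ.- p′ ∣         ≤⟨ ℚ.*-monoˡ-≤-nonNeg B {{ℚ.nonNegative (ℚ.≤-trans (ℚ.0≤∣p∣ q) h₂)}} h₁ ⟩
  B ℚ.* δ                    ∎
  where
  open ℚ.≤-Reasoning
  eq : ∀ p p′ q → p ℚ.* q ℚ.- p′ ℚ.* q ≡ q ℚ.* (p ℚ.- p′)
  eq = solve 3 (λ p p′ q → p :* q :- p′ :* q := q :* (p :- p′)) refl
    where open +-*-Solver

-- Equality of Cauchy reals is the setoid relation _≃_.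

Cauchy : (ℕ → ℚ) → Set
Cauchy x = ∀ ε → 0ℚ ℚ.< ε → ∃[ N ] ∀ i j → N ℕ.≤ i → N ℕ.≤ j → ∣ x i ℚ.- x j ∣ ℚ.≤ ε

record ℝ : Set where
  constructor mkℝ
  field
    approx : ℕ → ℚ
    cauchy : Cauchy approx

open ℝ public

infix  4 _≤_ _≃_
infixl 6 _+_
infixl 7 _*_ _⊓_

_≤_ : ℝ → ℝ → Set
x ≤ y = ∀ ε → 0ℚ ℚ.< ε → ∃[ N ] ∀ i → N ℕ.≤ i → approx x i ℚ.≤ approx y i ℚ.+ ε

_≃_ : ℝ → ℝ → Set
x ≃ y = x ≤ y × y ≤ x

fromℚ : ℚ → ℝ
fromℚ q = mkℝ (λ _ → q) λ ε ε>0 → 0 , λ i j _ _ →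
  subst (ℚ._≤ ε) (cong ∣_∣ (sym (ℚ.+-inverseʳ q))) (ℚ.<⇒≤ ε>0)

fromℕ : ℕ → ℝ
fromℕ n = fromℚ (ℤ.+ n ℚ./ 1)

0ℝ 1ℝ : ℝ
0ℝ = fromℚ 0ℚ
1ℝ = fromℚ 1ℚ

opaque
  +-cauchy : ∀ x y → Cauchy (λ i → approx x i ℚ.+ approx y i)
  +-cauchy x y = λ ε ε>0 →
    let (M , f) = cauchy x (½ ℚ.* ε) (½ε>0 ε>0)
        (N , g) = cauchy y (½ ℚ.* ε) (½ε>0 ε>0)
    in M ℕ.⊔ N , λ i j i≥ j≥ →
       near-+ (approx x i) (approx x j) (approx y i) (approx y j)
         (f i j (ℕ.≤-trans (ℕ.m≤m⊔n M N) i≥) (ℕ.≤-trans (ℕ.m≤m⊔n M N) j≥))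
         (g i j (ℕ.≤-trans (ℕ.m≤n⊔m M N) i≥) (ℕ.≤-trans (ℕ.m≤n⊔m M N) j≥))

_+_ : ℝ → ℝ → ℝ
x + y = mkℝ (λ i → approx x i ℚ.+ approx y i) (+-cauchy x y)

opaque
  ⊓-cauchy : ∀ x y → Cauchy (λ i → approx x i ℚ.⊓ approx y i)
  ⊓-cauchy x y = λ ε ε>0 →
    let (M , f) = cauchy x ε ε>0
        (N , g) = cauchy y ε ε>0
        half : ∀ i j → M ℕ.⊔ N ℕ.≤ i → M ℕ.⊔ N ℕ.≤ j →
               approx x i ℚ.⊓ approx y i ℚ.≤ approx x j ℚ.⊓ approx y j ℚ.+ ε
        half i j i≥ j≥ = ⊓-≤ {approx x i} {approx x j} {approx y i} {approx y j}
          (near⇒≤ {approx x i} {approx x j} (f i j (ℕ.≤-trans (ℕ.m≤m⊔n M N) i≥) (ℕ.≤-trans (ℕ.m≤m⊔n M N) j≥)))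
          (near⇒≤ {approx y i} {approx y j} (g i j (ℕ.≤-trans (ℕ.m≤n⊔m M N) i≥) (ℕ.≤-trans (ℕ.m≤n⊔m M N) j≥)))
    in M ℕ.⊔ N , λ i j i≥ j≥ →
       ≤⇒near {approx x i ℚ.⊓ approx y i} {approx x j ℚ.⊓ approx y j} (half i j i≥ j≥) (half j i j≥ i≥)
    where
    ⊓-≤ : ∀ {p p′ q q′ ε} → p ℚ.≤ p′ ℚ.+ ε → q ℚ.≤ q′ ℚ.+ ε → p ℚ.⊓ q ℚ.≤ p′ ℚ.⊓ q′ ℚ.+ ε
    ⊓-≤ {p} {p′} {q} {q′} {ε} h₁ h₂ with ℚ.⊓-sel p′ q′
    ... | inj₁ e = subst (λ r → p ℚ.⊓ q ℚ.≤ r ℚ.+ ε) (sym e) (ℚ.≤-trans (ℚ.p⊓q≤p p q) h₁)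
    ... | inj₂ e = subst (λ r → p ℚ.⊓ q ℚ.≤ r ℚ.+ ε) (sym e) (ℚ.≤-trans (ℚ.p⊓q≤q p q) h₂)

_⊓_ : ℝ → ℝ → ℝ
x ⊓ y = mkℝ (λ i → approx x i ℚ.⊓ approx y i) (⊓-cauchy x y)

bounded : ∀ x → ∃[ N ] ∃[ B ] 0ℚ ℚ.< B × (∀ i → N ℕ.≤ i → ∣ approx x i ∣ ℚ.≤ B)
bounded x with cauchy x 1ℚ (ℚ.positive⁻¹ 1ℚ)
... | N , f = N , ∣ a ∣ ℚ.+ 1ℚ , pos , bnd
  where
  a = approx x N
  pos : 0ℚ ℚ.< ∣ a ∣ ℚ.+ 1ℚ
  pos = ℚ.+-mono-≤-< (ℚ.0≤∣p∣ a) (ℚ.positive⁻¹ 1ℚ)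
  open ℚ.≤-Reasoning
  eq : ∀ p q → p ≡ q ℚ.+ (p ℚ.- q)
  eq = solve 2 (λ p q → p := q :+ (p :- q)) refl
    where open +-*-Solver
  bnd : ∀ i → N ℕ.≤ i → ∣ approx x i ∣ ℚ.≤ ∣ a ∣ ℚ.+ 1ℚ
  bnd i i≥ = begin
    ∣ approx x i ∣                    ≡⟨ cong ∣_∣ (eq (approx x i) a) ⟩
    ∣ a ℚ.+ (approx x i ℚ.- a) ∣      ≤⟨ ℚ.∣p+q∣≤∣p∣+∣q∣ a (approx x i ℚ.- a) ⟩
    ∣ a ∣ ℚ.+ ∣ approx x i ℚ.- a ∣    ≤⟨ ℚ.+-monoʳ-≤ ∣ a ∣ (f i N i≥ ℕ.≤-refl) ⟩
    ∣ a ∣ ℚ.+ 1ℚ                      ∎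

divide : ∀ {B ε} → 0ℚ ℚ.< B → 0ℚ ℚ.< ε → ∃[ δ ] 0ℚ ℚ.< δ × B ℚ.* δ ≡ ε
divide {B} {ε} B>0 ε>0 = B⁻¹ ℚ.* ε , δ>0 , eq
  where
  instance
    B-pos : ℚ.Positive B
    B-pos = ℚ.positive B>0
    B-nz : ℚ.NonZero B
    B-nz = ℚ.pos⇒nonZero B
  B⁻¹ = ℚ.1/ B
  δ>0 : 0ℚ ℚ.< B⁻¹ ℚ.* ε
  δ>0 = subst (ℚ._< B⁻¹ ℚ.* ε) (ℚ.*-zeroʳ B⁻¹) (ℚ.*-monoʳ-<-pos B⁻¹ {{ℚ.1/pos⇒pos B}} ε>0)
  eq : B ℚ.* (B⁻¹ ℚ.* ε) ≡ ε
  eq = trans (sym (ℚ.*-assoc B B⁻¹ ε))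
         (trans (cong (ℚ._* ε) (ℚ.*-inverseʳ B)) (ℚ.*-identityˡ ε))

telescope : ∀ a b c → a ℚ.- c ≡ (a ℚ.- b) ℚ.+ (b ℚ.- c)
telescope = solve 3 (λ a b c → a :- c := (a :- b) :+ (b :- c)) refl
  where open +-*-Solver

near-** : ∀ p p′ q q′ {B C δ η ε} → ∣ p ℚ.- p′ ∣ ℚ.≤ δ → ∣ q ∣ ℚ.≤ C →
          ∣ q ℚ.- q′ ∣ ℚ.≤ η → ∣ p′ ∣ ℚ.≤ B → C ℚ.* δ ≡ ½ ℚ.* ε → B ℚ.* η ≡ ½ ℚ.* ε →
          ∣ p ℚ.* q ℚ.- p′ ℚ.* q′ ∣ ℚ.≤ ε
near-** p p′ q q′ {B} {C} {δ} {η} {ε} hp hq hq′ hp′ Cδ≡ Bη≡ = begin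
  ∣ p ℚ.* q ℚ.- p′ ℚ.* q′ ∣
    ≡⟨ cong ∣_∣ (telescope (p ℚ.* q) (p′ ℚ.* q) (p′ ℚ.* q′)) ⟩
  ∣ (p ℚ.* q ℚ.- p′ ℚ.* q) ℚ.+ (p′ ℚ.* q ℚ.- p′ ℚ.* q′) ∣
    ≡⟨ cong₂ (λ a b → ∣ (p ℚ.* q ℚ.- p′ ℚ.* q) ℚ.+ (a ℚ.- b) ∣) (ℚ.*-comm p′ q) (ℚ.*-comm p′ q′) ⟩
  ∣ (p ℚ.* q ℚ.- p′ ℚ.* q) ℚ.+ (q ℚ.* p′ ℚ.- q′ ℚ.* p′) ∣
    ≤⟨ ℚ.∣p+q∣≤∣p∣+∣q∣ (p ℚ.* q ℚ.- p′ ℚ.* q) (q ℚ.* p′ ℚ.- q′ ℚ.* p′) ⟩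
  ∣ p ℚ.* q ℚ.- p′ ℚ.* q ∣ ℚ.+ ∣ q ℚ.* p′ ℚ.- q′ ℚ.* p′ ∣
    ≤⟨ ℚ.+-mono-≤ (near-* p p′ {q} hp hq) (near-* q q′ {p′} hq′ hp′) ⟩
  C ℚ.* δ ℚ.+ B ℚ.* η
    ≡⟨ cong₂ ℚ._+_ Cδ≡ Bη≡ ⟩
  ½ ℚ.* ε ℚ.+ ½ ℚ.* ε
    ≡⟨ ½ε+½ε ε ⟩
  ε ∎
  where open ℚ.≤-Reasoning

opaque
  *-cauchy : ∀ x y → Cauchy (λ i → approx x i ℚ.* approx y i)
  *-cauchy x y = λ ε ε>0 →
    let (K , B , B>0 , x≤B) = bounded x
        (L , C , C>0 , y≤C) = bounded y
        (δ , δ>0 , Cδ≡) = divide C>0 (½ε>0 ε>0)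
        (η , η>0 , Bη≡) = divide B>0 (½ε>0 ε>0)
        (M , f) = cauchy x δ δ>0
        (N , g) = cauchy y η η>0
        KL≤ = ℕ.m≤m⊔n (K ℕ.⊔ L) (M ℕ.⊔ N)
        MN≤ = ℕ.m≤n⊔m (K ℕ.⊔ L) (M ℕ.⊔ N)
        K≤ = ℕ.≤-trans (ℕ.m≤m⊔n K L) KL≤
        L≤ = ℕ.≤-trans (ℕ.m≤n⊔m K L) KL≤
        M≤ = ℕ.≤-trans (ℕ.m≤m⊔n M N) MN≤
        N≤ = ℕ.≤-trans (ℕ.m≤n⊔m M N) MN≤
    in (K ℕ.⊔ L) ℕ.⊔ (M ℕ.⊔ N) , λ i j i≥ j≥ →
       near-** (approx x i) (approx x j) (approx y i) (approx y j)
         (f i j (ℕ.≤-trans M≤ i≥) (ℕ.≤-trans M≤ j≥)) (y≤C i (ℕ.≤-trans L≤ i≥))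
         (g i j (ℕ.≤-trans N≤ i≥) (ℕ.≤-trans N≤ j≥)) (x≤B j (ℕ.≤-trans K≤ j≥))
         Cδ≡ Bη≡

_*_ : ℝ → ℝ → ℝ
x * y = mkℝ (λ i → approx x i ℚ.* approx y i) (*-cauchy x y)

-- A non-negative real x presented by the relation  p ⊑ q  ⇔  p / q ≤ x  (q ≥ 1)

record Cut : Set₁ where
  field
    _⊑_      : ℕ → ℕ → Set
    _⊑?_     : ∀ p q → Dec (p ⊑ q)
    0⊑       : ∀ q → 0 ⊑ q
    separate : ∀ p q p′ q′ .{{_ : NonZero q}} .{{_ : NonZero q′}} →
               p ⊑ q → ¬ (p′ ⊑ q′) → p ℕ.* q′ ℕ.< p′ ℕ.* q
    bound    : ℕ
    bounded⊑ : ∀ q → ¬ (suc (bound ℕ.* q) ⊑ q)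

module _ (c : Cut) where
  open Cut c

  -- the largest p ≤ b with p ⊑ q
  largest : ℕ → ℕ → ℕ
  largest q zero    = 0
  largest q (suc b) = if does (suc b ⊑? q) then suc b else largest q b

  largest-⊑ : ∀ q b → largest q b ⊑ q
  largest-⊑ q zero = 0⊑ q
  largest-⊑ q (suc b) with suc b ⊑? q
  ... | yes h = h
  ... | no  _ = largest-⊑ q b

  suc-largest-⋢ : ∀ q b → ¬ (suc b ⊑ q) → ¬ (suc (largest q b) ⊑ q)
  suc-largest-⋢ q zero h = h
  suc-largest-⋢ q (suc b) h with suc b ⊑? q
  ... | yes _  = h
  ... | no  h′ = suc-largest-⋢ q b h′

  -- ⌊ x (i + 1) ⌋
  floorAt : ℕ → ℕ
  floorAt i = largest (suc i) (bound ℕ.* suc i)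

  digits : ℕ → ℚ
  digits i = (ℤ.+ floorAt i) ℚ./ suc i

  floor-< : ∀ i j → floorAt i ℕ.* suc j ℕ.< suc (floorAt j) ℕ.* suc i
  floor-< i j = separate (floorAt i) (suc i) (suc (floorAt j)) (suc j)
    (largest-⊑ (suc i) (bound ℕ.* suc i))
    (suc-largest-⋢ (suc j) (bound ℕ.* suc j) (bounded⊑ (suc j)))

  frac-≤ : ∀ {a b} m n → a ℕ.* suc n ℕ.≤ b ℕ.* suc m → (ℤ.+ a) ℚ./ suc m ℚ.≤ (ℤ.+ b) ℚ./ suc n
  frac-≤ {a} {b} m n h = ℚ.toℚᵘ-cancel-≤
    (ℚᵘ.≤-respˡ-≃ (ℚᵘ.≃-sym (ℚ.toℚᵘ-fromℚᵘ (ℚᵘ.mkℚᵘ (ℤ.+ a) m)))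
    (ℚᵘ.≤-respʳ-≃ (ℚᵘ.≃-sym (ℚ.toℚᵘ-fromℚᵘ (ℚᵘ.mkℚᵘ (ℤ.+ b) n)))
      (ℚᵘ.*≤* (subst₂ ℤ._≤_ (ℤ.pos-* a (suc n)) (ℤ.pos-* b (suc m)) (ℤ.+≤+ h)))))

  frac-suc : ∀ a n → (ℤ.+ suc a) ℚ./ suc n ≡ (ℤ.+ a) ℚ./ suc n ℚ.+ (ℤ.+ 1) ℚ./ suc n
  frac-suc a n = ℚ.toℚᵘ-injective
    (ℚᵘ.≃-trans (ℚ.toℚᵘ-fromℚᵘ (ℚᵘ.mkℚᵘ (ℤ.+ suc a) n))
    (ℚᵘ.≃-trans (ℚᵘ.*≡* eq)
    (ℚᵘ.≃-sym (ℚᵘ.≃-trans (ℚ.toℚᵘ-homo-+ ((ℤ.+ a) ℚ./ suc n) ((ℤ.+ 1) ℚ./ suc n))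
      (ℚᵘ.+-cong (ℚ.toℚᵘ-fromℚᵘ (ℚᵘ.mkℚᵘ (ℤ.+ a) n)) (ℚ.toℚᵘ-fromℚᵘ (ℚᵘ.mkℚᵘ (ℤ.+ 1) n)))))))
    where
    open import Data.Integer.Solver renaming (module +-*-Solver to ℤ-Solver)
    N = ℤ.+ suc n
    eq : (ℤ.+ suc a) ℤ.* (N ℤ.* N) ≡ ((ℤ.+ a) ℤ.* N ℤ.+ (ℤ.+ 1) ℤ.* N) ℤ.* N
    eq = solve 2 (λ a N →
           (con (ℤ.+ 1) :+ a) :* (N :* N) := (a :* N :+ con (ℤ.+ 1) :* N) :* N)
           refl (ℤ.+ a) N
      where open ℤ-Solver

  digits-≤ : ∀ i j → digits i ℚ.≤ digits j ℚ.+ (ℤ.+ 1) ℚ./ suc j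
  digits-≤ i j = ℚ.≤-trans (frac-≤ {floorAt i} {suc (floorAt j)} i j (ℕ.<⇒≤ (floor-< i j)))
                   (ℚ.≤-reflexive (frac-suc (floorAt j) j))

  small : ∀ ε → 0ℚ ℚ.< ε → ∃[ N ] ∀ i → N ℕ.≤ i → (ℤ.+ 1) ℚ./ suc i ℚ.≤ ε
  small ε@(ℚ.mkℚ (ℤ.+ zero) d c) ε>0 = contradiction (ℚ.drop-*<* ε>0) λ { (ℤ.+<+ ()) }
  small ε@(ℚ.mkℚ (ℤ.-[1+ n ]) d c) ε>0 = contradiction (ℚ.drop-*<* ε>0) λ ()
  small ε@(ℚ.mkℚ (ℤ.+ suc n) d c) ε>0 = d , λ i d≤i →
    ℚ.≤-trans (frac-≤ {1} {suc n} i d (ℕ.≤-trans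
      (ℕ.≤-trans (ℕ.≤-reflexive (ℕ.*-identityˡ (suc d))) (ℕ.s≤s d≤i)) (ℕ.m≤n*m (suc i) (suc n))))
      (ℚ.≤-reflexive (ℚ.↥p/↧p≡p ε))

  opaque
    digits-cauchy : Cauchy digits
    digits-cauchy = λ ε ε>0 →
      let (N , f) = small ε ε>0
          half : ∀ i j → N ℕ.≤ j → digits i ℚ.≤ digits j ℚ.+ ε
          half i j j≥ = ℚ.≤-trans (digits-≤ i j) (ℚ.+-monoʳ-≤ (digits j) (f j j≥))
      in N , λ i j i≥ j≥ → ≤⇒near {digits i} {digits j} (half i j j≥) (half j i i≥)

  cutℝ : ℝ
  cutℝ = mkℝ digits digits-cauchy

^-cancelˡ-< : ∀ k a b → a ℕ.^ k ℕ.< b ℕ.^ k → a ℕ.< b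
^-cancelˡ-< k a b h = ℕ.≰⇒> λ b≤a → ℕ.<⇒≱ h (ℕ.^-monoˡ-≤ k b≤a)

^-cancelʳ-< : ∀ {a b} → 2 ℕ.^ a ℕ.< 2 ℕ.^ b → a ℕ.< b
^-cancelʳ-< h = ℕ.≰⇒> λ b≤a → ℕ.<⇒≱ h (ℕ.^-monoʳ-≤ 2 b≤a)

^3-* : ∀ a b → (a ℕ.* b) ℕ.^ 3 ≡ a ℕ.^ 3 ℕ.* b ℕ.^ 3
^3-* = solve 2 (λ a b → (a :* b) :^ 3 := a :^ 3 :* b :^ 3) refl
  where open import Data.Nat.Solver renaming (module +-*-Solver to ℕ-Solver)
        open ℕ-Solver

n≤2^n : ∀ n → n ℕ.≤ 2 ℕ.^ n
n≤2^n zero = ℕ.z≤n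
n≤2^n (suc n) = ℕ.≤-trans (ℕ.+-mono-≤ (ℕ.m^n>0 2 n) (n≤2^n n))
  (ℕ.≤-reflexive (cong (2 ℕ.^ n ℕ.+_) (sym (ℕ.+-identityʳ (2 ℕ.^ n)))))

-- p / q ≤ m^(2/3)  ⇔  p³ ≤ m² q³
⅔-cut : ℕ → Cut
⅔-cut m = record
  { _⊑_      = λ p q → p ℕ.^ 3 ℕ.≤ m ℕ.^ 2 ℕ.* q ℕ.^ 3
  ; _⊑?_     = λ p q → p ℕ.^ 3 ℕ.≤? m ℕ.^ 2 ℕ.* q ℕ.^ 3
  ; 0⊑       = λ _ → ℕ.z≤n
  ; separate = separate
  ; bound    = m
  ; bounded⊑ = bounded⊑
  }
  where
  open ℕ.≤-Reasoning
  separate : ∀ p q p′ q′ .{{_ : NonZero q}} .{{_ : NonZero q′}} →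
             p ℕ.^ 3 ℕ.≤ m ℕ.^ 2 ℕ.* q ℕ.^ 3 → ¬ (p′ ℕ.^ 3 ℕ.≤ m ℕ.^ 2 ℕ.* q′ ℕ.^ 3) →
             p ℕ.* q′ ℕ.< p′ ℕ.* q
  separate p q p′ q′ h h′ = ^-cancelˡ-< 3 (p ℕ.* q′) (p′ ℕ.* q) (begin-strict
    (p ℕ.* q′) ℕ.^ 3                     ≡⟨ ^3-* p q′ ⟩
    p ℕ.^ 3 ℕ.* q′ ℕ.^ 3                 ≤⟨ ℕ.*-monoˡ-≤ (q′ ℕ.^ 3) h ⟩
    m ℕ.^ 2 ℕ.* q ℕ.^ 3 ℕ.* q′ ℕ.^ 3     ≡⟨ swap (m ℕ.^ 2) (q ℕ.^ 3) (q′ ℕ.^ 3) ⟩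
    m ℕ.^ 2 ℕ.* q′ ℕ.^ 3 ℕ.* q ℕ.^ 3     <⟨ ℕ.*-monoˡ-< (q ℕ.^ 3) {{ℕ.m^n≢0 q 3}} (ℕ.≰⇒> h′) ⟩
    p′ ℕ.^ 3 ℕ.* q ℕ.^ 3                 ≡⟨ ^3-* p′ q ⟨
    (p′ ℕ.* q) ℕ.^ 3                     ∎)
    where
    swap : ∀ a b c → a ℕ.* b ℕ.* c ≡ a ℕ.* c ℕ.* b
    swap a b c = trans (ℕ.*-assoc a b c) (trans (cong (a ℕ.*_) (ℕ.*-comm b c)) (sym (ℕ.*-assoc a c b)))
  m²≤m³ : ∀ m → m ℕ.^ 2 ℕ.≤ m ℕ.^ 3
  m²≤m³ zero    = ℕ.z≤n
  m²≤m³ (suc m) = ℕ.^-monoʳ-≤ (suc m) (ℕ.n≤1+n 2)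
  bounded⊑ : ∀ q → ¬ (suc (m ℕ.* q) ℕ.^ 3 ℕ.≤ m ℕ.^ 2 ℕ.* q ℕ.^ 3)
  bounded⊑ q h = ℕ.<-irrefl refl (begin-strict
    (m ℕ.* q) ℕ.^ 3           <⟨ ℕ.^-monoˡ-< 3 (ℕ.n<1+n (m ℕ.* q)) ⟩
    suc (m ℕ.* q) ℕ.^ 3       ≤⟨ h ⟩
    m ℕ.^ 2 ℕ.* q ℕ.^ 3       ≤⟨ ℕ.*-monoˡ-≤ (q ℕ.^ 3) (m²≤m³ m) ⟩
    m ℕ.^ 3 ℕ.* q ℕ.^ 3       ≡⟨ ^3-* m q ⟨
    (m ℕ.* q) ℕ.^ 3           ∎)

_^⅔ : ℕ → ℝ
m ^⅔ = cutℝ (⅔-cut m)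

-- p / q ≤ log₂ d  ⇔  2^p ≤ d^q,  for d ≥ 1
log₂-cut : ∀ d .{{_ : NonZero d}} → Cut
log₂-cut d = record
  { _⊑_      = λ p q → 2 ℕ.^ p ℕ.≤ d ℕ.^ q
  ; _⊑?_     = λ p q → 2 ℕ.^ p ℕ.≤? d ℕ.^ q
  ; 0⊑       = λ q → ℕ.m^n>0 d q
  ; separate = separate
  ; bound    = d
  ; bounded⊑ = bounded⊑
  }
  where
  open ℕ.≤-Reasoning
  separate : ∀ p q p′ q′ .{{_ : NonZero q}} .{{_ : NonZero q′}} →
             2 ℕ.^ p ℕ.≤ d ℕ.^ q → ¬ (2 ℕ.^ p′ ℕ.≤ d ℕ.^ q′) → p ℕ.* q′ ℕ.< p′ ℕ.* q
  separate p q p′ q′ h h′ = ^-cancelʳ-< (begin-strict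
    2 ℕ.^ (p ℕ.* q′)     ≡⟨ ℕ.^-*-assoc 2 p q′ ⟨
    (2 ℕ.^ p) ℕ.^ q′     ≤⟨ ℕ.^-monoˡ-≤ q′ h ⟩
    (d ℕ.^ q) ℕ.^ q′     ≡⟨ ℕ.^-*-assoc d q q′ ⟩
    d ℕ.^ (q ℕ.* q′)     ≡⟨ cong (d ℕ.^_) (ℕ.*-comm q q′) ⟩
    d ℕ.^ (q′ ℕ.* q)     ≡⟨ ℕ.^-*-assoc d q′ q ⟨
    (d ℕ.^ q′) ℕ.^ q     <⟨ ℕ.^-monoˡ-< q (ℕ.≰⇒> h′) ⟩
    (2 ℕ.^ p′) ℕ.^ q     ≡⟨ ℕ.^-*-assoc 2 p′ q ⟩
    2 ℕ.^ (p′ ℕ.* q)     ∎)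
  bounded⊑ : ∀ q → ¬ (2 ℕ.^ suc (d ℕ.* q) ℕ.≤ d ℕ.^ q)
  bounded⊑ q h = ℕ.<-irrefl refl (begin-strict
    2 ℕ.^ (d ℕ.* q)         <⟨ ℕ.^-monoʳ-< 2 (ℕ.s≤s (ℕ.s≤s ℕ.z≤n)) (ℕ.n<1+n (d ℕ.* q)) ⟩
    2 ℕ.^ suc (d ℕ.* q)     ≤⟨ h ⟩
    d ℕ.^ q                 ≤⟨ ℕ.^-monoˡ-≤ q (n≤2^n d) ⟩
    (2 ℕ.^ d) ℕ.^ q         ≡⟨ ℕ.^-*-assoc 2 d q ⟩
    2 ℕ.^ (d ℕ.* q)         ∎)

-- log₂ 0 is a junk value
log₂ : ℕ → ℝ
log₂ zero      = 0ℝ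
log₂ d@(suc _) = cutℝ (log₂-cut d)

Σℝ : ∀ {n} → Vec ℝ n → ℝ
Σℝ = Vec.foldr′ _+_ 0ℝ

-- Only finite universes are needed: elements lying in exactly the same sets
-- A_j can be merged, so 2^m elements always suffice.
record Coverage (m : ℕ) : Set where
  field
    ∣U∣      : ℕ
    weight   : Fin ∣U∣ → ℝ
    weight≥0 : ∀ u → 0ℝ ≤ weight u
    A        : Fin m → Subset ∣U∣

  totalWeight : Subset ∣U∣ → ℝ
  totalWeight V = Σℝ (Vec.tabulate λ u → if Vec.lookup V u then weight u else 0ℝ)

  value : Subset m → ℝ
  value S = totalWeight (⋃ (List.map A (List.filter (_∈? S) (List.allFin m))))

IsCoverage : ∀ {m} → (Subset m → ℝ) → Set
IsCoverage {m} f = Σ[ C ∈ Coverage m ] ∀ S → f S ≃ Coverage.value C S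

-- Values are rational so that an instance is a finite input to an algorithm.
record Point (m : ℕ) : Set where
  constructor ⟨_,_,_⟩
  field
    T   : Subset m
    f   : ℚ
    f≥0 : 0ℚ ℚ.≤ f

record PartialFunction : Set where
  constructor mkPartial
  field
    m      : ℕ
    points : List (Point m)

open PartialFunction public

dim : PartialFunction → ℕ
dim H = List.foldr ℕ._⊔_ 0 (List.map (λ P → card (Point.T P)) (points H))

Extendable : PartialFunction → ℝ → Set
Extendable H α = Σ[ f ∈ (Subset (m H) → ℝ) ] IsCoverage f ×
  All (λ P → fromℚ (Point.f P) ≤ f (Point.T P) × f (Point.T P) ≤ α * fromℚ (Point.f P)) (points H)

-- α is the least factor ≥ 1 admitting an extension.  No such α exists when
-- some f_i = 0 (or T_i = ∅) rules out every finite factor.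
IsOptimal : PartialFunction → ℝ → Set
IsOptimal H α = 1ℝ ≤ α × Extendable H α × (∀ α′ → 1ℝ ≤ α′ → Extendable H α′ → α ≤ α′)

-- Random access machine with logarithmic cost: every access is charged the
-- bit lengths of the addresses and words involved.  Since operands and
-- results are charged in full, unbounded multiplication and division keep the
-- model polynomially equivalent to Turing machines.

Memory : Set
Memory = ℕ → ℕ

data Operand : Set where
  imm : ℕ → Operand       -- constant
  dir : ℕ → Operand       -- M[a]
  ind : ℕ → Operand       -- M[M[a]]

data Target : Set where
  dir : ℕ → Target
  ind : ℕ → Target

data BinOp : Set where
  add sub mul div : BinOp

infixr 5 _⨾_

data Program : Set where
  skip        : Program
  _≔_⟨_⟩_     : Target → Operand → BinOp → Operand → Program
  _⨾_         : Program → Program → Program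
  ifnz        : Operand → Program → Program → Program
  while       : Operand → Program → Program

bits : ℕ → ℕ
bits n = suc ⌊log₂ n ⌋

⟦_⟧ᵇ : BinOp → ℕ → ℕ → ℕ
⟦ add ⟧ᵇ a b       = a ℕ.+ b
⟦ sub ⟧ᵇ a b       = a ℕ.∸ b
⟦ mul ⟧ᵇ a b       = a ℕ.* b
⟦ div ⟧ᵇ a zero    = 0
⟦ div ⟧ᵇ a (suc b) = a ℕ./ suc b

⟦_⟧ᵒ : Operand → Memory → ℕ
⟦ imm n ⟧ᵒ M = n
⟦ dir a ⟧ᵒ M = M a
⟦ ind a ⟧ᵒ M = M (M a)

address : Target → Memory → ℕ
address (dir a) M = a
address (ind a) M = M a

readCost : Operand → Memory → ℕ
readCost (imm n) M = bits n
readCost (dir a) M = bits a ℕ.+ bits (M a)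
readCost (ind a) M = bits a ℕ.+ bits (M a) ℕ.+ bits (M (M a))

addressCost : Target → Memory → ℕ
addressCost (dir a) M = bits a
addressCost (ind a) M = bits a ℕ.+ bits (M a)

store : ℕ → ℕ → Memory → Memory
store a w M b = if does (a ℕ.≟ b) then w else M b

infix 4 ⟨_,_⟩⇓⟨_,_⟩

-- ⟨ c , M ⟩⇓⟨ M′ , t ⟩ : from memory M, program c halts in memory M′ at cost t
data ⟨_,_⟩⇓⟨_,_⟩ : Program → Memory → Memory → ℕ → Set where
  ⇓skip : ∀ {M} → ⟨ skip , M ⟩⇓⟨ M , 1 ⟩

  ⇓≔ : ∀ {M x a o b} → let w = ⟦ o ⟧ᵇ (⟦ a ⟧ᵒ M) (⟦ b ⟧ᵒ M) in
    ⟨ x ≔ a ⟨ o ⟩ b , M ⟩⇓⟨ store (address x M) w M ,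
      1 ℕ.+ readCost a M ℕ.+ readCost b M ℕ.+ addressCost x M ℕ.+ bits w ⟩

  ⇓⨾ : ∀ {c₁ c₂ M M′ M″ t₁ t₂} →
    ⟨ c₁ , M ⟩⇓⟨ M′ , t₁ ⟩ → ⟨ c₂ , M′ ⟩⇓⟨ M″ , t₂ ⟩ →
    ⟨ c₁ ⨾ c₂ , M ⟩⇓⟨ M″ , t₁ ℕ.+ t₂ ⟩

  ⇓if-nz : ∀ {a c₁ c₂ M M′ t} → ⟦ a ⟧ᵒ M ≢ 0 → ⟨ c₁ , M ⟩⇓⟨ M′ , t ⟩ →
    ⟨ ifnz a c₁ c₂ , M ⟩⇓⟨ M′ , 1 ℕ.+ readCost a M ℕ.+ t ⟩

  ⇓if-z : ∀ {a c₁ c₂ M M′ t} → ⟦ a ⟧ᵒ M ≡ 0 → ⟨ c₂ , M ⟩⇓⟨ M′ , t ⟩ →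
    ⟨ ifnz a c₁ c₂ , M ⟩⇓⟨ M′ , 1 ℕ.+ readCost a M ℕ.+ t ⟩

  ⇓while-nz : ∀ {a c M M′ M″ t₁ t₂} → ⟦ a ⟧ᵒ M ≢ 0 →
    ⟨ c , M ⟩⇓⟨ M′ , t₁ ⟩ → ⟨ while a c , M′ ⟩⇓⟨ M″ , t₂ ⟩ →
    ⟨ while a c , M ⟩⇓⟨ M″ , 1 ℕ.+ readCost a M ℕ.+ t₁ ℕ.+ t₂ ⟩

  ⇓while-z : ∀ {a c M} → ⟦ a ⟧ᵒ M ≡ 0 →
    ⟨ while a c , M ⟩⇓⟨ M , 1 ℕ.+ readCost a M ⟩

-- m, n, then for each i: the m-bit indicator of T_i and f_i as a fraction.
encode : PartialFunction → List ℕ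
encode H = m H ∷ List.length (points H) ∷ concatMap encodePoint (points H)
  where
  encodePoint : Point (m H) → List ℕ
  encodePoint P = List.map (λ b → if b then 1 else 0) (Vec.toList (Point.T P))
    ++ ℤ.∣ ℚ.↥ (Point.f P) ∣ ∷ ℚ.↧ₙ (Point.f P) ∷ []

size : PartialFunction → ℕ
size H = ListAction.sum (List.map bits (encode H))

load : List ℕ → Memory
load []       a       = 0
load (w ∷ ws) zero    = w
load (w ∷ ws) (suc a) = load ws a

-- The answer is the fraction M[0] / M[1], not necessarily reduced.
Outputs : Memory → ℚ → Set
Outputs M β = Σ[ nz ∈ NonZero (M 1) ] β ≡ ((ℤ.+ M 0) ℚ./ M 1) {{nz}}

Approximates : ℚ → ℝ → PartialFunction → Set
Approximates β ρ H = ∀ α* → IsOptimal H α* → (α* ≤ fromℚ β) × (fromℚ β ≤ ρ * α*)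

record Run (program : Program) (H : PartialFunction) : Set where
  field
    final  : Memory
    time   : ℕ
    run    : ⟨ program , load (encode H) ⟩⇓⟨ final , time ⟩
    answer : ℚ
    output : Outputs final answer

-- A polynomial-time algorithm on the instances satisfying Admissible with
-- approximation factor ρ.  The running time is bounded on all of them, the
-- answer is constrained whenever α* exists.
record ApproximationAlgorithm
    (Admissible : PartialFunction → Set) (ρ : PartialFunction → ℝ) : Set where
  field
    program  : Program
    coeff    : ℕ
    exponent : ℕ
    run      : ∀ H → Admissible H → Run program H
    polytime : ∀ H (h : Admissible H) → Run.time (run H h) ℕ.≤ coeff ℕ.* size H ℕ.^ exponent
    correct  : ∀ H (h : Admissible H) → Approximates (Run.answer (run H h)) (ρ H) H

{-# OPTIONS --safe #-}

-- Scale the values to integers F i, and let h j be the least F i over the sets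
-- T i containing j.  Coverage functions are monotone and subadditive, so every
-- extension f of factor α satisfies f T ≤ α Σ F k whenever T is covered by
-- sets T k, and in particular f {j} ≤ α h j.  Suppose a coverage function g
-- with g ≤ R F is, on every T i, the cost of such a cover.  Then
-- γ = max(1 , max F i / g i) is at most α*, and γ g is an extension of factor
-- R γ, so R γ lies between α* and R α*.
--
-- The additive g with g {j} = h j has R = d.  For large d, put q = ⌈m^⅓⌉ and
-- go through the sets once: when T i has more than q² unclaimed elements j with
-- F i ≤ q h j, claim them and make all such j one block of value F i; the other
-- elements stay single.  A block met by T i has value at most q F i and there
-- are at most m / q² of them, at most q² singles of T i satisfy F i ≤ q h j,
-- and the rest cost less than F i / q each, so R = 3 q².  This is used only for
-- d ≥ 2⁹, where log₂ d ≥ 9 absorbs the constants.  For smaller d the additive g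
-- is good enough, because d ≤ m^⅔ log₂ d unless m = d = 2; two elements are
-- solved exactly.
--
-- Everything is a closed expression in the input words.  In its loops only a
-- history of decisions, which grows by one bit per round, can see the
-- accumulator, and this alone makes the compiled programs run in polynomial
-- time.

module Submission where

-- The choice of `q` balances three losses, in units of `F i`: `q²` from the close singles,
-- `(m / q²) q` from the blocks and `m / q` from the other singles. At `q = m^⅓` all three equal
-- `q²`. The constant `2⁹` is where two estimates meet. For `2^l ≤ d < 2^(l+1)` the additive
-- function is good enough once `d / l ≤ m^⅔`, which follows from `d ≤ m` and `d ≤ l³`; the last `l`
-- with `2^(l+1) - 1 ≤ l³` is 8, by `511 ≤ 512`. From `2⁹` on, rounding the cube root up gives
-- `q² ≤ 3 m^⅔`, hence `R ≤ 9 m^⅔`, and `log₂ d ≥ 9` is just enough. The greedy pass is the only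
-- computation that has to look at its own past. The decision on a set is determined by the earlier
-- decisions, so one bit per set is a complete state. Every other quantity is recomputed wherever it
-- occurs; the nesting depth of the loops is fixed, so the time stays polynomial, and in return the
-- value of the program unfolds to the very functions that the proof reasons about.

-- A language of bounded loops, its compiler, and the correctness and cost of compiled code.

module Machine where

  open import Defs using (Memory; Operand; imm; dir; ind; Target; BinOp; add; sub; mul; div; Program; _≔_⟨_⟩_;
    _⨾_; while; bits; ⟦_⟧ᵇ; ⟦_⟧ᵒ; address; readCost; addressCost; store; ⟨_,_⟩⇓⟨_,_⟩; ⇓≔; ⇓⨾; ⇓while-nz; ⇓while-z;
    n≤2^n)
  open import Data.Bool.Base using (if_then_else_; true; false)
  open import Data.Nat.Base
  open import Data.Nat.Properties
  open import Data.Nat.DivMod using (m/n≤m)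
  open import Data.Nat.Logarithm using (⌊log₂⌋-mono-≤; ⌊log₂[2^n]⌋≡n)
  open import Data.Nat.Solver using (module +-*-Solver)
  open import Data.Product.Base using (∃-syntax; _×_; _,_; proj₁; proj₂)
  open import Relation.Binary.PropositionalEquality
  open import Relation.Nullary using (contradiction)

  data LoopKind : Set where
    sum prod max hist : LoopKind

  data Range : Set where
    #m #n : Range

  data Exp : Set where
    num  : ℕ → Exp
    var  : ℕ → Exp
    inp  : Exp → Exp
    bin  : BinOp → Exp → Exp → Exp
    loop : LoopKind → ℕ → ℕ → Range → Exp → Exp

  position : Range → ℕ
  position #m = 0
  position #n = 1

  iter : (ℕ → ℕ → ℕ) → ℕ → ℕ → ℕ
  iter f z zero    = z
  iter f z (suc k) = f k (iter f z k)

  init : LoopKind → ℕ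
  init prod = 1
  init _    = 0

  step : LoopKind → ℕ → ℕ → ℕ
  step sum  a v = a + v
  step prod a v = a * v
  step max  a v = a + (v ∸ a)
  step hist a v = (a + a) + (1 ∸ (1 ∸ v))

  infixl 9 _[_↦_]
  _[_↦_] : (ℕ → ℕ) → ℕ → ℕ → ℕ → ℕ
  (ρ [ x ↦ v ]) y = if x ≡ᵇ y then v else ρ y

  -- Only the body of a hist loop sees the accumulator (as y): a loop whose body
  -- could multiply its accumulator by itself would not run in polynomial time.
  bind : LoopKind → ℕ → ℕ → (ℕ → ℕ) → ℕ → ℕ → ℕ → ℕ
  bind hist x y ρ i a = ρ [ x ↦ i ] [ y ↦ a ]
  bind _    x y ρ i a = ρ [ x ↦ i ]

  eval : (ℕ → ℕ) → (ℕ → ℕ) → Exp → ℕ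
  eval w ρ (num k)          = k
  eval w ρ (var x)          = ρ x
  eval w ρ (inp e)          = w (eval w ρ e)
  eval w ρ (bin o a b)      = ⟦ o ⟧ᵇ (eval w ρ a) (eval w ρ b)
  eval w ρ (loop o x y c e) = iter (λ i a → step o a (eval w (bind o x y ρ i a) e)) (init o) (w (position c))

  -- The result goes to register t; registers above t are scratch.  Variable x
  -- lives in register ad x, and register 0 holds the base address of the input.

  update : LoopKind → ℕ → Program
  update sum  t = dir t ≔ dir t ⟨ add ⟩ dir (3 + t)
  update prod t = dir t ≔ dir t ⟨ mul ⟩ dir (3 + t)
  update max  t = dir (3 + t) ≔ dir (3 + t) ⟨ sub ⟩ dir t ⨾ dir t ≔ dir t ⟨ add ⟩ dir (3 + t)
  update hist t = dir (3 + t) ≔ imm 1 ⟨ sub ⟩ dir (3 + t) ⨾ dir (3 + t) ≔ imm 1 ⟨ sub ⟩ dir (3 + t) ⨾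
                  dir t ≔ dir t ⟨ add ⟩ dir t ⨾ dir t ≔ dir t ⟨ add ⟩ dir (3 + t)

  comp : (ℕ → ℕ) → ℕ → Exp → Program
  comp ad t (num k)     = dir t ≔ imm k ⟨ add ⟩ imm 0
  comp ad t (var x)     = dir t ≔ dir (ad x) ⟨ add ⟩ imm 0
  comp ad t (inp e)     = comp ad t e ⨾ dir t ≔ dir t ⟨ add ⟩ dir 0 ⨾ dir t ≔ ind t ⟨ add ⟩ imm 0
  comp ad t (bin o a b) = comp ad t a ⨾ comp ad (1 + t) b ⨾ dir t ≔ dir t ⟨ o ⟩ dir (1 + t)
  -- Register `t` is the accumulator, `1 + t` the index and `2 + t` the number of rounds left; the
  -- body is evaluated above them, in `3 + t`.
  comp ad t (loop o x y c e) =
    dir (2 + t) ≔ dir 0 ⟨ add ⟩ imm (position c) ⨾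
    dir (2 + t) ≔ ind (2 + t) ⟨ add ⟩ imm 0 ⨾
    dir t ≔ imm (init o) ⟨ add ⟩ imm 0 ⨾
    dir (1 + t) ≔ imm 0 ⟨ add ⟩ imm 0 ⨾
    while (dir (2 + t))
      ((comp (bind o x y ad (1 + t) t) (3 + t) e ⨾ update o t) ⨾
       dir (1 + t) ≔ dir (1 + t) ⟨ add ⟩ imm 1 ⨾
       dir (2 + t) ≔ dir (2 + t) ⟨ sub ⟩ imm 1)

  -- An upper bound for the number of registers, counted from `t`, that `comp` uses; a sum in place
  -- of a maximum keeps the inequalities simple.
  height : Exp → ℕ
  height (num k)          = 1
  height (var x)          = 1
  height (inp e)          = height e
  height (bin o a b)      = suc (height a + height b)
  height (loop o x y c e) = 4 + height e

  height>0 : ∀ e → 0 < height e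
  height>0 (num k)          = s≤s z≤n
  height>0 (var x)          = s≤s z≤n
  height>0 (inp e)          = height>0 e
  height>0 (bin o a b)      = s≤s z≤n
  height>0 (loop o x y c e) = s≤s z≤n

  -- One bound for all kinds of loop: at most `s` rounds with values up to `2 ^ b` need `s + b` bits
  -- for a sum, `s * b` for a product, `b` for a maximum and `s` for a history.
  loopBits : ℕ → ℕ → ℕ
  loopBits b s = suc b * suc s

  -- Variables are at most `2 ^ w` and input words at most `2 ^ s`. A loop body is charged `w + s`,
  -- since the index is at most `s` and a history of at most `s` rounds is below `2 ^ s` whatever
  -- its body returns. This breaks the circle of an accumulator that its own body can see.
  vbits : Exp → ℕ → ℕ → ℕ
  vbits (num k)          w s = k
  vbits (var x)          w s = w
  vbits (inp e)          w s = s
  vbits (bin o a b)      w s = suc (vbits a w s + vbits b w s)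
  vbits (loop o x y c e) w s = loopBits (vbits e (w + s) s) s

  -- Bounds one assignment on numbers up to `2 ^ b`, in multiples of `suc b`: three for each of the
  -- two reads, two for the target address, one for the result, and one that absorbs the constant 1.
  unit : ℕ → ℕ
  unit b = 10 * suc b

  tm : ℕ → Exp → ℕ → ℕ → ℕ
  tm K (num k)     w s = unit (k + K)
  tm K (var x)     w s = unit (w + K)
  tm K (inp e)     w s = tm K e w s + 2 * unit (suc (vbits e w s + (K + s)))
  tm K (bin o a b) w s = tm K a w s + (tm K b w s + unit (suc (vbits a w s + vbits b w s) + K))
  -- Four initial assignments and the final test make 5; each round adds up to four for the update
  -- and three for the test, the increment and the decrement.
  tm K (loop o x y c e) w s = 5 * unit B + s * (tm K e (w + s) s + 7 * unit B)
    where
    b = vbits e (w + s) s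
    B = suc (K + s) + (b + loopBits b s)

  ≤2^-mono : ∀ {v a b} → v ≤ 2 ^ a → a ≤ b → v ≤ 2 ^ b
  ≤2^-mono h a≤b = ≤-trans h (^-monoʳ-≤ 2 a≤b)

  +-≤2^ : ∀ {u v} a b → u ≤ 2 ^ a → v ≤ 2 ^ b → u + v ≤ 2 ^ suc (a + b)
  +-≤2^ {u} {v} a b hu hv = begin
    u + v                      ≤⟨ +-mono-≤ (≤2^-mono hu (m≤m+n a b)) (≤2^-mono hv (m≤n+m b a)) ⟩
    2 ^ (a + b) + 2 ^ (a + b)  ≡⟨ cong (2 ^ (a + b) +_) (+-identityʳ (2 ^ (a + b))) ⟨
    2 ^ suc (a + b)            ∎
    where open ≤-Reasoning

  *-≤2^ : ∀ {u v} a b → u ≤ 2 ^ a → v ≤ 2 ^ b → u * v ≤ 2 ^ (a + b)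
  *-≤2^ {u} {v} a b hu hv = ≤-trans (*-mono-≤ hu hv) (≤-reflexive (sym (^-distribˡ-+-* 2 a b)))

  div-≤ : ∀ u v → ⟦ div ⟧ᵇ u v ≤ u
  div-≤ u zero    = z≤n
  div-≤ u (suc v) = m/n≤m u (suc v)

  binOp-≤2^ : ∀ o {u v} a b → u ≤ 2 ^ a → v ≤ 2 ^ b → ⟦ o ⟧ᵇ u v ≤ 2 ^ suc (a + b)
  binOp-≤2^ add a b hu hv = +-≤2^ a b hu hv
  binOp-≤2^ sub {u} {v} a b hu hv = ≤2^-mono (≤-trans (m∸n≤m u v) hu) (≤-trans (m≤m+n a b) (n≤1+n (a + b)))
  binOp-≤2^ mul a b hu hv = ≤2^-mono (*-≤2^ a b hu hv) (n≤1+n (a + b))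
  binOp-≤2^ div {u} {v} a b hu hv = ≤2^-mono (≤-trans (div-≤ u v) hu) (≤-trans (m≤m+n a b) (n≤1+n (a + b)))

  bits-≤ : ∀ {v b} → v ≤ 2 ^ b → bits v ≤ suc b
  bits-≤ {v} {b} h = s≤s (≤-trans (⌊log₂⌋-mono-≤ h) (≤-reflexive (⌊log₂[2^n]⌋≡n b)))

  m+[n∸m]≡m⊔n : ∀ m n → m + (n ∸ m) ≡ m ⊔ n
  m+[n∸m]≡m⊔n zero    n       = refl
  m+[n∸m]≡m⊔n (suc m) zero    = cong suc (+-identityʳ m)
  m+[n∸m]≡m⊔n (suc m) (suc n) = cong suc (m+[n∸m]≡m⊔n m n)

  step-hist-< : ∀ {a k} v → suc a ≤ 2 ^ k → suc (step hist a v) ≤ 2 ^ suc k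
  step-hist-< {a} {k} v h = begin
    suc (a + a + (1 ∸ (1 ∸ v)))  ≤⟨ s≤s (+-monoʳ-≤ (a + a) (m∸n≤m 1 (1 ∸ v))) ⟩
    suc (a + a + 1)              ≡⟨ solve 1 (λ a → con 1 :+ (a :+ a :+ con 1) := (con 1 :+ a) :+ ((con 1 :+ a) :+ con 0)) refl a ⟩
    suc a + (suc a + 0)          ≤⟨ +-mono-≤ h (+-mono-≤ h z≤n) ⟩
    2 ^ suc k                    ∎
    where open ≤-Reasoning
          open +-*-Solver using (solve; con; _:+_; _:*_; _:=_)

  iter-hist-< : ∀ (v : ℕ → ℕ → ℕ) k → suc (iter (λ i a → step hist a (v i a)) 0 k) ≤ 2 ^ k
  iter-hist-< v zero    = ≤-refl
  iter-hist-< v (suc k) = step-hist-< {_} {k} (v k _) (iter-hist-< v k)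

  module _ (v : ℕ → ℕ → ℕ) (b : ℕ) where
    open ≤-Reasoning

    iter-sum-≤ : ∀ k → (∀ i a → i < k → v i a ≤ 2 ^ b) → iter (λ i a → step sum a (v i a)) 0 k ≤ k * 2 ^ b
    iter-sum-≤ zero    h = z≤n
    iter-sum-≤ (suc k) h = ≤-trans
      (+-mono-≤ (iter-sum-≤ k λ i a i<k → h i a (m<n⇒m<1+n i<k)) (h k _ ≤-refl))
      (≤-reflexive (+-comm (k * 2 ^ b) (2 ^ b)))

    iter-prod-≤ : ∀ k → (∀ i a → i < k → v i a ≤ 2 ^ b) → iter (λ i a → step prod a (v i a)) 1 k ≤ 2 ^ (k * b)
    iter-prod-≤ zero    h = ≤-refl
    iter-prod-≤ (suc k) h = ≤2^-mono
      (*-≤2^ (k * b) b (iter-prod-≤ k λ i a i<k → h i a (m<n⇒m<1+n i<k)) (h k _ ≤-refl))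
      (≤-reflexive (+-comm (k * b) b))

    iter-max-≤ : ∀ k → (∀ i a → i < k → v i a ≤ 2 ^ b) → iter (λ i a → step max a (v i a)) 0 k ≤ 2 ^ b
    iter-max-≤ zero    h = z≤n
    iter-max-≤ (suc k) h = ≤-trans (≤-reflexive (m+[n∸m]≡m⊔n _ (v k _)))
      (⊔-lub (iter-max-≤ k λ i a i<k → h i a (m<n⇒m<1+n i<k)) (h k _ ≤-refl))

    -- A history needs no bound on its body, which is essential because its accumulator is not yet
    -- known to be bounded. The bodies of the other kinds ignore the accumulator, so there a bound
    -- for every `a` is available.
    iter-≤ : ∀ o k {s} → k ≤ s → (∀ i a → i < k → o ≢ hist → v i a ≤ 2 ^ b) →
             iter (λ i a → step o a (v i a)) (init o) k ≤ 2 ^ loopBits b s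
    iter-≤ sum k {s} k≤s h = ≤2^-mono
      (≤-trans (iter-sum-≤ k λ i a i<k → h i a i<k λ ()) (*-≤2^ k b (n≤2^n k) ≤-refl)) (begin
        k + b                ≤⟨ +-monoˡ-≤ b k≤s ⟩
        s + b                ≤⟨ m≤m+n (s + b) (suc (b * s)) ⟩
        s + b + suc (b * s)  ≡⟨ solve 2 (λ b s → s :+ b :+ (con 1 :+ b :* s) := (con 1 :+ b) :* (con 1 :+ s)) refl b s ⟩
        loopBits b s         ∎)
      where open +-*-Solver using (solve; con; _:+_; _:*_; _:=_)
    iter-≤ prod k {s} k≤s h = ≤2^-mono (iter-prod-≤ k λ i a i<k → h i a i<k λ ()) (begin
        k * b                ≡⟨ *-comm k b ⟩
        b * k                ≤⟨ *-mono-≤ (n≤1+n b) (m≤n⇒m≤1+n k≤s) ⟩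
        loopBits b s         ∎)
    iter-≤ max k {s} k≤s h = ≤2^-mono (iter-max-≤ k λ i a i<k → h i a i<k λ ())
      (≤-trans (n≤1+n b) (m≤m*n (suc b) (suc s)))
    iter-≤ hist k {s} k≤s h = ≤2^-mono (≤-trans (n≤1+n _) (iter-hist-< v k))
      (≤-trans (m≤n⇒m≤1+n k≤s) (m≤n*m (suc s) (suc b)))

  store-≡ : ∀ a v (M : Memory) → store a v M a ≡ v
  store-≡ a v M with a ≡ᵇ a | ≡⇒≡ᵇ a a refl
  ... | true | _ = refl

  store-≢ : ∀ {a b} v (M : Memory) → b ≢ a → store a v M b ≡ M b
  store-≢ {a} {b} v M b≢a with a ≡ᵇ b | ≡ᵇ⇒≡ a b
  ... | true  | h = contradiction (sym (h _)) b≢a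
  ... | false | _ = refl

  3*-≤-10* : ∀ x → 1 ≤ x → 1 + 3 * x ≤ 10 * x
  3*-≤-10* x 1≤x = ≤-trans (+-monoˡ-≤ (3 * x) 1≤x) (*-monoˡ-≤ x {4} {10} (s≤s (s≤s (s≤s (s≤s z≤n)))))

  unit-≤ : ∀ {B p q r w} → p ≤ 3 * suc B → q ≤ 3 * suc B → r ≤ 2 * suc B → w ≤ suc B →
           1 + p + q + r + w ≤ unit B
  unit-≤ {B} hp hq hr hw = ≤-trans (+-mono-≤ (+-mono-≤ (+-mono-≤ (+-mono-≤ (s≤s (z≤n {B})) hp) hq) hr) hw)
    (≤-reflexive (solve 1 (λ x → x :+ con 3 :* x :+ con 3 :* x :+ con 2 :* x :+ x := con 10 :* x) refl (suc B)))
    where open +-*-Solver using (solve; con; _:+_; _:*_; _:=_)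

  record Reads (M : Memory) (B : ℕ) (a : Operand) (u : ℕ) : Set where
    field
      value≡ : ⟦ a ⟧ᵒ M ≡ u
      value≤ : u ≤ 2 ^ B
      cost≤  : readCost a M ≤ 3 * suc B
  open Reads

  record Writes (M : Memory) (B : ℕ) (tgt : Target) (x : ℕ) : Set where
    field
      address≡ : address tgt M ≡ x
      cost≤    : addressCost tgt M ≤ 2 * suc B

  private
    bits-≡-≤ : ∀ u {v b} → u ≡ v → v ≤ 2 ^ b → bits u ≤ suc b
    bits-≡-≤ u refl h = bits-≤ h

  immR : ∀ {M B} k → k ≤ 2 ^ B → Reads M B (imm k) k
  immR {B = B} k h = record { value≡ = refl ; value≤ = h ; cost≤ = ≤-trans (bits-≤ h) (m≤m+n (suc B) _) }

  dirR : ∀ {M B} a {u} → a ≤ 2 ^ B → M a ≡ u → u ≤ 2 ^ B → Reads M B (dir a) u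
  dirR {M} {B} a h e h′ = record { value≡ = e ; value≤ = h′ ; cost≤ = +-mono-≤ (bits-≤ h) (≤-trans (bits-≡-≤ (M a) e h′) (m≤m+n (suc B) _)) }

  indR : ∀ {M B} a {p u} → a ≤ 2 ^ B → M a ≡ p → p ≤ 2 ^ B → M p ≡ u → u ≤ 2 ^ B → Reads M B (ind a) u
  indR {M} {B} a {u = u} h e h′ e′ h″ = record
    { value≡ = Me≡
    ; value≤ = h″
    ; cost≤  = ≤-trans (+-mono-≤ (+-mono-≤ (bits-≤ h) (bits-≡-≤ (M a) e h′)) (bits-≡-≤ (M (M a)) Me≡ h″))
        (≤-reflexive (solve 1 (λ x → x :+ x :+ x := x :+ (x :+ (x :+ con 0))) refl (suc B)))
    }
    where
    open +-*-Solver using (solve; con; _:+_; _:=_)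
    Me≡ : M (M a) ≡ u
    Me≡ = trans (cong M e) e′

  dirW : ∀ {M B} x → x ≤ 2 ^ B → Writes M B (dir x) x
  dirW {B = B} x h = record { address≡ = refl ; cost≤ = ≤-trans (bits-≤ h) (m≤m+n (suc B) _) }

  indW : ∀ {M B} a {x} → a ≤ 2 ^ B → M a ≡ x → x ≤ 2 ^ B → Writes M B (ind a) x
  indW {M} {B} a h e h′ = record { address≡ = e ; cost≤ = +-mono-≤ (bits-≤ h) (≤-trans (bits-≡-≤ (M a) e h′) (m≤m+n (suc B) _)) }

  test-≤ : ∀ M B {a u} → Reads M B a u → 1 + readCost a M ≤ unit B
  test-≤ M B R = ≤-trans (s≤s (cost≤ R)) (3*-≤-10* (suc B) (s≤s z≤n))

  record Step (c : Program) (M : Memory) (x r bound : ℕ) : Set where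
    field
      M′    : Memory
      time  : ℕ
      run   : ⟨ c , M ⟩⇓⟨ M′ , time ⟩
      here  : M′ x ≡ r
      other : ∀ a → a ≢ x → M′ a ≡ M a
      time≤ : time ≤ bound

  opaque
    assign : ∀ M B o {tgt a b x u v r} → Writes M B tgt x → Reads M B a u → Reads M B b v → ⟦ o ⟧ᵇ u v ≡ r → r ≤ 2 ^ B →
             Step (tgt ≔ a ⟨ o ⟩ b) M x r (unit B)
    assign M B o {tgt} {a} {b} {r = r} W A A′ e hr = record
      { M′    = store (address tgt M) w M
      ; run   = ⇓≔
      ; here  = trans (cong (λ y → store (address tgt M) w M y) (sym (Writes.address≡ W))) (trans (store-≡ (address tgt M) w M) w≡)
      ; other = λ y y≢x → store-≢ w M λ p → y≢x (trans p (Writes.address≡ W))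
      ; time≤ = unit-≤ {B} {readCost a M} {readCost b M} (cost≤ A) (cost≤ A′) (Writes.cost≤ W) (bits-≡-≤ w w≡ hr)
      }
      where
      w : ℕ
      w = ⟦ o ⟧ᵇ (⟦ a ⟧ᵒ M) (⟦ b ⟧ᵒ M)
      w≡ : w ≡ r
      w≡ = trans (cong₂ ⟦ o ⟧ᵇ (value≡ A) (value≡ A′)) e

  copy : ∀ M B {tgt a x u} → Writes M B tgt x → Reads M B a u → Step (tgt ≔ a ⟨ add ⟩ imm 0) M x u (unit B)
  copy M B {u = u} W A = assign M B add W A (immR 0 z≤n) (+-identityʳ u) (value≤ A)

  record Update (c : Program) (M : Memory) (t r bound : ℕ) : Set where
    field
      M′    : Memory
      time  : ℕ
      run   : ⟨ c , M ⟩⇓⟨ M′ , time ⟩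
      here  : M′ t ≡ r
      other : ∀ a → a ≢ t → a ≢ 3 + t → M′ a ≡ M a
      time≤ : time ≤ bound

  3+n≢n : ∀ n → 3 + n ≢ n
  3+n≢n n e = 1+n≰n (≤-trans (m≤n+m (suc n) 2) (≤-reflexive e))

  module _ (M : Memory) (t a v B : ℕ) (Mt≡ : M t ≡ a) (M3t≡ : M (3 + t) ≡ v)
           (t≤ : 3 + t ≤ 2 ^ B) (a≤ : a ≤ 2 ^ B) (v≤ : v ≤ 2 ^ B) where

    private
      t≤′ : t ≤ 2 ^ B
      t≤′ = ≤-trans (m≤n+m t 3) t≤

      t≢3+t : t ≢ 3 + t
      t≢3+t e = 3+n≢n t (sym e)

      1≤ : 1 ≤ 2 ^ B
      1≤ = m^n>0 2 B

      units : ∀ {n} k → k ≤ 4 → n ≤ k * unit B → n ≤ 4 * unit B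
      units k k≤4 h = ≤-trans h (*-monoˡ-≤ (unit B) k≤4)

    update-correct : ∀ o → step o a v ≤ 2 ^ B → Update (update o t) M t (step o a v) (4 * unit B)
    update-correct sum h = record { Step S ; other = λ x p _ → Step.other S x p ; time≤ = units 1 (s≤s z≤n) (≤-trans (Step.time≤ S) (m≤m+n _ 0)) }
      where S = assign M B add (dirW t t≤′) (dirR t t≤′ Mt≡ a≤) (dirR (3 + t) t≤ M3t≡ v≤) refl h
    update-correct prod h = record { Step S ; other = λ x p _ → Step.other S x p ; time≤ = units 1 (s≤s z≤n) (≤-trans (Step.time≤ S) (m≤m+n _ 0)) }
      where S = assign M B mul (dirW t t≤′) (dirR t t≤′ Mt≡ a≤) (dirR (3 + t) t≤ M3t≡ v≤) refl h
    update-correct max h = record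
      { run   = ⇓⨾ (Step.run S) (Step.run S′)
      ; here  = Step.here S′
      ; other = λ x p q → trans (Step.other S′ x p) (Step.other S x q)
      ; time≤ = units 2 (s≤s (s≤s z≤n)) (≤-trans (+-mono-≤ (Step.time≤ S) (Step.time≤ S′)) (≤-reflexive (cong (unit B +_) (sym (+-identityʳ _)))))
      }
      where
      v∸a≤ : v ∸ a ≤ 2 ^ B
      v∸a≤ = ≤-trans (m∸n≤m v a) v≤
      S = assign M B sub (dirW (3 + t) t≤) (dirR (3 + t) t≤ M3t≡ v≤) (dirR t t≤′ Mt≡ a≤) refl v∸a≤
      S′ = assign (Step.M′ S) B add (dirW t t≤′) (dirR t t≤′ (trans (Step.other S t t≢3+t) Mt≡) a≤) (dirR (3 + t) t≤ (Step.here S) v∸a≤) refl h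
    update-correct hist h = record
      { run   = ⇓⨾ (Step.run S₁) (⇓⨾ (Step.run S₂) (⇓⨾ (Step.run S₃) (Step.run S₄)))
      ; here  = Step.here S₄
      ; other = λ x p q → trans (Step.other S₄ x p) (trans (Step.other S₃ x p) (trans (Step.other S₂ x q) (Step.other S₁ x q)))
      ; time≤ = ≤-trans (+-mono-≤ (Step.time≤ S₁) (+-mono-≤ (Step.time≤ S₂) (+-mono-≤ (Step.time≤ S₃) (Step.time≤ S₄))))
                  (≤-reflexive (cong (λ z → unit B + (unit B + (unit B + z))) (sym (+-identityʳ _))))
      }
      where
      v₁ = 1 ∸ v
      v₂ = 1 ∸ v₁
      v₁≤ : v₁ ≤ 2 ^ B
      v₁≤ = ≤-trans (m∸n≤m 1 v) 1≤
      v₂≤ : v₂ ≤ 2 ^ B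
      v₂≤ = ≤-trans (m∸n≤m 1 v₁) 1≤
      a+a≤ : a + a ≤ 2 ^ B
      a+a≤ = ≤-trans (m≤m+n (a + a) v₂) h
      S₁ = assign M B sub (dirW (3 + t) t≤) (immR 1 1≤) (dirR (3 + t) t≤ M3t≡ v≤) refl v₁≤
      S₂ = assign (Step.M′ S₁) B sub (dirW (3 + t) t≤) (immR 1 1≤) (dirR (3 + t) t≤ (Step.here S₁) v₁≤) refl v₂≤
      M₂t≡ : Step.M′ S₂ t ≡ a
      M₂t≡ = trans (Step.other S₂ t t≢3+t) (trans (Step.other S₁ t t≢3+t) Mt≡)
      S₃ = assign (Step.M′ S₂) B add (dirW t t≤′) (dirR t t≤′ M₂t≡ a≤) (dirR t t≤′ M₂t≡ a≤) refl a+a≤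
      S₄ = assign (Step.M′ S₃) B add (dirW t t≤′) (dirR t t≤′ (Step.here S₃) a+a≤)
             (dirR (3 + t) t≤ (trans (Step.other S₃ (3 + t) (3+n≢n t)) (Step.here S₂)) v₂≤) refl h

  ↦-≤ : ∀ x {ρ v b} → (∀ y → ρ y ≤ b) → v ≤ b → ∀ y → (ρ [ x ↦ v ]) y ≤ b
  ↦-≤ x hρ hv y with x ≡ᵇ y
  ... | true  = hv
  ... | false = hρ y

  bind-≤ : ∀ o x y {ρ i a b} → (∀ z → ρ z ≤ b) → i ≤ b → (o ≡ hist → a ≤ b) → ∀ z → bind o x y ρ i a z ≤ b
  bind-≤ sum  x y hρ hi ha = ↦-≤ x hρ hi
  bind-≤ prod x y hρ hi ha = ↦-≤ x hρ hi
  bind-≤ max  x y hρ hi ha = ↦-≤ x hρ hi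
  bind-≤ hist x y hρ hi ha = ↦-≤ y (↦-≤ x hρ hi) (ha refl)

  ↦-related : ∀ (R : ℕ → ℕ → Set) x {f g u v} → (∀ y → R (f y) (g y)) → R u v → ∀ y → R ((f [ x ↦ u ]) y) ((g [ x ↦ v ]) y)
  ↦-related R x h r y with x ≡ᵇ y
  ... | true  = r
  ... | false = h y

  bind-related : ∀ (R : ℕ → ℕ → Set) o x y {f g i i′ a a′} → (∀ z → R (f z) (g z)) → R i i′ → R a a′ →
                 ∀ z → R (bind o x y f i a z) (bind o x y g i′ a′ z)
  bind-related R sum  x y h r r′ = ↦-related R x h r
  bind-related R prod x y h r r′ = ↦-related R x h r
  bind-related R max  x y h r r′ = ↦-related R x h r
  bind-related R hist x y h r r′ = ↦-related R y (↦-related R x h r) r′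

  module Correctness
    (w : ℕ → ℕ) (s K D : ℕ)
    (w≤ : ∀ a → w a ≤ 2 ^ s) (range≤ : ∀ c → w (position c) ≤ s)
    (D≤ : D ≤ 2 ^ (K + s)) (K≤D : K ≤ D)
    where

    value : LoopKind → ℕ → ℕ → (ℕ → ℕ) → Exp → ℕ → ℕ → ℕ
    value o x y ρ e i a = eval w (bind o x y ρ i a) e

    partial : LoopKind → ℕ → ℕ → (ℕ → ℕ) → Exp → ℕ → ℕ
    partial o x y ρ e k = iter (λ i a → step o a (value o x y ρ e i a)) (init o) k

    bind-≤2^ : ∀ o x y {ρ v i a} → (∀ z → ρ z ≤ 2 ^ v) → i ≤ s → (o ≡ hist → a ≤ 2 ^ s) →
               ∀ z → bind o x y ρ i a z ≤ 2 ^ (v + s)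
    bind-≤2^ o x y {v = v} hρ i≤s ha = bind-≤ o x y (λ z → ≤2^-mono (hρ z) (m≤m+n v s))
      (≤2^-mono (≤-trans i≤s (n≤2^n s)) (m≤n+m s v)) (λ e → ≤2^-mono (ha e) (m≤n+m s v))

    eval-≤ : ∀ e {ρ v} → (∀ x → ρ x ≤ 2 ^ v) → eval w ρ e ≤ 2 ^ vbits e v s
    eval-≤ (num k) hρ = n≤2^n k
    eval-≤ (var x) hρ = hρ x
    eval-≤ (inp e) hρ = w≤ _
    eval-≤ (bin o a b) {v = v} hρ = binOp-≤2^ o (vbits a v s) (vbits b v s) (eval-≤ a hρ) (eval-≤ b hρ)
    eval-≤ (loop o x y c e) {ρ} {v} hρ = iter-≤ (value o x y ρ e) (vbits e (v + s) s) o (w (position c)) (range≤ c)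
      λ i a i<k o≢hist → eval-≤ e (bind-≤2^ o x y {v = v} hρ (≤-trans (<⇒≤ i<k) (range≤ c)) λ h → contradiction h o≢hist)

    hist-≤ : ∀ o x y ρ e k → k ≤ s → o ≡ hist → partial o x y ρ e k ≤ 2 ^ s
    hist-≤ hist x y ρ e k k≤s refl = ≤2^-mono (≤-trans (n≤1+n _) (iter-hist-< (value hist x y ρ e) k)) k≤s

    value-≤ : ∀ o x y e {ρ v} → (∀ x → ρ x ≤ 2 ^ v) → ∀ i → i ≤ s →
              value o x y ρ e i (partial o x y ρ e i) ≤ 2 ^ vbits e (v + s) s
    value-≤ o x y e {ρ} {v} hρ i i≤s = eval-≤ e (bind-≤2^ o x y {v = v} hρ i≤s (hist-≤ o x y ρ e i i≤s))

    partial-≤ : ∀ o x y e {ρ v} → (∀ x → ρ x ≤ 2 ^ v) → ∀ k → k ≤ s →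
                partial o x y ρ e k ≤ 2 ^ loopBits (vbits e (v + s) s) s
    partial-≤ o x y e {ρ} {v} hρ k k≤s = iter-≤ (value o x y ρ e) (vbits e (v + s) s) o k k≤s
      λ i a i<k o≢hist → eval-≤ e (bind-≤2^ o x y {v = v} hρ (≤-trans (<⇒≤ i<k) k≤s) λ h → contradiction h o≢hist)

    -- Registers stay below `K ≤ D` and the input occupies the cells from `D` on, so compiled code
    -- cannot overwrite its input. The memory is described at every `D + a`, also past the encoded
    -- words, so that reads need no range check.
    record Ready (M : Memory) (ad ρ : ℕ → ℕ) (t : ℕ) : Set where
      field
        base  : M 0 ≡ D
        input : ∀ a → M (D + a) ≡ w a
        0<t   : 0 < t
        env   : ∀ x → M (ad x) ≡ ρ x × ad x < t
    open Ready

    record Exec (c : Program) (M : Memory) (t r bound : ℕ) : Set where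
      field
        M′    : Memory
        time  : ℕ
        run   : ⟨ c , M ⟩⇓⟨ M′ , time ⟩
        here  : M′ t ≡ r
        low   : ∀ a → a < t → M′ a ≡ M a
        high  : ∀ a → D ≤ a → M′ a ≡ M a
        time≤ : time ≤ bound
    open Exec

    ready-keep : ∀ {M M′ ad ρ t u} → Ready M ad ρ t → t ≤ u → (∀ a → a < t → M′ a ≡ M a) → (∀ a → D ≤ a → M′ a ≡ M a) →
                 Ready M′ ad ρ u
    ready-keep R t≤u low high = record
      { base  = trans (low 0 (0<t R)) (base R)
      ; input = λ a → trans (high (D + a) (m≤m+n D a)) (input R a)
      ; 0<t   = <-≤-trans (0<t R) t≤u
      ; env   = λ x → let (e , l) = env R x in trans (low _ l) e , <-≤-trans l t≤u
      }

    step⇒exec : ∀ {c M t r bound} → t < K → Step c M t r bound → Exec c M t r bound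
    step⇒exec t<K S = record
      { Step S
      ; low  = λ a a<t → Step.other S a (<⇒≢ a<t)
      ; high = λ a D≤a → Step.other S a (<⇒≢′ (<-≤-trans t<K (≤-trans K≤D D≤a)))
      }
      where
      <⇒≢′ : ∀ {m n} → m < n → n ≢ m
      <⇒≢′ m<n e = <⇒≢ m<n (sym e)

    -- the second program may also overwrite registers from u on, where u ≥ t
    exec-⨾ : ∀ {c c′ M t u r r′ b b′} (E : Exec c M u r b) → t ≤ u → Exec c′ (M′ E) t r′ b′ → Exec (c ⨾ c′) M t r′ (b + b′)
    exec-⨾ E t≤u E′ = record
      { run   = ⇓⨾ (run E) (run E′)
      ; here  = here E′
      ; low   = λ a a<t → trans (low E′ a a<t) (low E a (<-≤-trans a<t t≤u))
      ; high  = λ a D≤a → trans (high E′ a D≤a) (high E a D≤a)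
      ; time≤ = +-mono-≤ (time≤ E) (time≤ E′)
      }

    weaken : ∀ {c M t r b b′} → Exec c M t r b → b ≤ b′ → Exec c M t r b′
    weaken E h = record { Exec E ; time≤ = ≤-trans (time≤ E) h }

    ≤2^ : ∀ {v b} → v ≤ b → v ≤ 2 ^ b
    ≤2^ {b = b} h = ≤-trans h (n≤2^n b)

    address-≤ : ∀ {v t B} → v ≤ t → t ≤ K → K ≤ B → v ≤ 2 ^ B
    address-≤ h h′ h″ = ≤2^ (≤-trans h (≤-trans h′ h″))

    module _ (t n C B : ℕ) (f : ℕ → ℕ → ℕ) (z : ℕ) (c : Program) (M₀ : Memory)
             (t≤ : 2 + t < K) (K≤B : K ≤ B) (n≤ : n ≤ 2 ^ B) where

      record LoopState (i r : ℕ) (M : Memory) : Set where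
        field
          acc   : M t ≡ iter f z i
          index : M (1 + t) ≡ i
          count : M (2 + t) ≡ r
          keep< : ∀ a → a < t → M a ≡ M₀ a
          keep≥ : ∀ a → D ≤ a → M a ≡ M₀ a
      open LoopState

      record Body (i : ℕ) (M : Memory) : Set where
        field
          M₁     : Memory
          time₁  : ℕ
          run₁   : ⟨ c , M ⟩⇓⟨ M₁ , time₁ ⟩
          acc₁   : M₁ t ≡ iter f z (suc i)
          other₁ : ∀ a → a ≢ t → a < 3 + t → M₁ a ≡ M a
          high₁  : ∀ a → D ≤ a → M₁ a ≡ M a
          time₁≤ : time₁ ≤ C
      open Body

      private
        2+t≤ : 2 + t ≤ 2 ^ B
        2+t≤ = address-≤ ≤-refl (<⇒≤ t≤) K≤B

        1+t≤ : 1 + t ≤ 2 ^ B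
        1+t≤ = address-≤ (n≤1+n _) (<⇒≤ t≤) K≤B

        1≤ : 1 ≤ 2 ^ B
        1≤ = m^n>0 2 B

        high≢ : ∀ {a u} → u ≤ 2 + t → D ≤ a → a ≢ u
        high≢ u≤ D≤a e = <⇒≢ (<-≤-trans (≤-<-trans u≤ t≤) (≤-trans K≤D D≤a)) (sym e)

      whileProgram : Program
      whileProgram = while (dir (2 + t))
        (c ⨾ dir (1 + t) ≔ dir (1 + t) ⟨ add ⟩ imm 1 ⨾ dir (2 + t) ≔ dir (2 + t) ⟨ sub ⟩ imm 1)

      while-correct : (∀ i M r → i < n → LoopState i r M → Body i M) →
                      ∀ i r M → i + r ≡ n → LoopState i r M →
                      ∃[ M′ ] ∃[ τ ] ⟨ whileProgram , M ⟩⇓⟨ M′ , τ ⟩ × LoopState n 0 M′ × τ ≤ r * (C + 3 * unit B) + unit B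
      while-correct body i zero M i+r≡n L =
        M , _ , ⇓while-z (count L) , subst (λ i → LoopState i 0 M) (trans (sym (+-identityʳ i)) i+r≡n) L ,
        test-≤ M B (dirR (2 + t) 2+t≤ (count L) z≤n)
      while-correct body i (suc r) M i+r≡n L =
        let (M′ , τ , run′ , L′ , τ≤) = while-correct body (suc i) r (Step.M′ S₂) (trans (sym (+-suc i r)) i+r≡n) L₂
        in M′ , _ , ⇓while-nz (λ e → 0≢1+n (trans (sym e) (count L))) (⇓⨾ (run₁ X) (⇓⨾ (Step.run S₁) (Step.run S₂))) run′ , L′ ,
           total τ≤
        where
        i<n : i < n
        i<n = ≤-trans (m≤m+n (suc i) r) (≤-reflexive (trans (sym (+-suc i r)) i+r≡n))
        X = body i M (suc r) i<n L
        r<n : suc r ≤ n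
        r<n = ≤-trans (m≤n+m (suc r) i) (≤-reflexive i+r≡n)
        2+n≢n : ∀ n → 2 + n ≢ n
        2+n≢n n e = 1+n≰n (≤-trans (n≤1+n (suc n)) (≤-reflexive e))
        S₁ = assign (M₁ X) B add (dirW (1 + t) 1+t≤)
               (dirR (1 + t) 1+t≤ (trans (other₁ X (1 + t) 1+n≢n (m<n⇒m<1+n (n<1+n _))) (index L)) (≤-trans (<⇒≤ i<n) n≤))
               (immR 1 1≤) (+-comm i 1) (≤-trans i<n n≤)
        S₂ = assign (Step.M′ S₁) B sub (dirW (2 + t) 2+t≤)
               (dirR (2 + t) 2+t≤ (trans (Step.other S₁ (2 + t) 1+n≢n) (trans (other₁ X (2 + t) (2+n≢n t) (n<1+n _)) (count L))) (≤-trans r<n n≤))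
               (immR 1 1≤) refl (≤-trans (n≤1+n r) (≤-trans r<n n≤))
        n<2+n : ∀ {a n} → a < n → a ≢ 2 + n
        n<2+n {a} {n} h = <⇒≢ (<-≤-trans h (m≤n+m n 2))
        n<1+n′ : ∀ {a n} → a < n → a ≢ 1 + n
        n<1+n′ {a} {n} h = <⇒≢ (<-≤-trans h (m≤n+m n 1))
        L₂ : LoopState (suc i) r (Step.M′ S₂)
        L₂ = record
          { acc   = trans (Step.other S₂ t (λ e → m≢1+n+m t e)) (trans (Step.other S₁ t (λ e → m≢1+n+m t e)) (acc₁ X))
          ; index = trans (Step.other S₂ (1 + t) (λ e → m≢1+n+m (1 + t) {0} e)) (Step.here S₁)
          ; count = Step.here S₂
          ; keep< = λ a a<t → trans (Step.other S₂ a (n<2+n a<t)) (trans (Step.other S₁ a (n<1+n′ a<t))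
                      (trans (other₁ X a (<⇒≢ a<t) (<-≤-trans a<t (m≤n+m t 3))) (keep< L a a<t)))
          ; keep≥ = λ a D≤a → trans (Step.other S₂ a (high≢ ≤-refl D≤a)) (trans (Step.other S₁ a (high≢ (n≤1+n _) D≤a))
                      (trans (high₁ X a D≤a) (keep≥ L a D≤a)))
          }
        test≤ : 1 + readCost (dir (2 + t)) M ≤ unit B
        test≤ = test-≤ M B (dirR (2 + t) 2+t≤ (count L) (≤-trans r<n n≤))
        total : ∀ {τ} → τ ≤ r * (C + 3 * unit B) + unit B →
                1 + readCost (dir (2 + t)) M + (time₁ X + (Step.time S₁ + Step.time S₂)) + τ ≤ suc r * (C + 3 * unit B) + unit B
        total {τ} h = ≤-trans (+-mono-≤ (+-mono-≤ test≤ (+-mono-≤ (time₁≤ X) (+-mono-≤ (Step.time≤ S₁) (Step.time≤ S₂)))) h)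
          (≤-reflexive (solve 3 (λ u C T → u :+ (C :+ (u :+ u)) :+ (T :+ u) := (C :+ con 3 :* u) :+ T :+ u) refl (unit B) C (r * (C + 3 * unit B))))
          where open +-*-Solver using (solve; con; _:+_; _:*_; _:=_)

    -- Variables live below `t`, scratch between `t` and `K`, the input from `D` on. Evaluating a
    -- subexpression at a higher `t` therefore disturbs neither variables nor input nor the partial
    -- results already computed.
    correct : ∀ e {ad ρ t M v} → Ready M ad ρ t → (∀ x → ρ x ≤ 2 ^ v) → t + height e ≤ K →
              Exec (comp ad t e) M t (eval w ρ e) (tm K e v s)
    correct (num k) {t = t} {M} R hρ h = step⇒exec (≤-trans (≤-reflexive (+-comm 1 t)) h)
      (copy M (k + K) (dirW t (address-≤ (m≤m+n t 1) h (m≤n+m K k))) (immR k (≤2^ (m≤m+n k K))))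
    correct (var x) {ad} {ρ} {t} {M} {v} R hρ h = step⇒exec (≤-trans (≤-reflexive (+-comm 1 t)) h)
      (copy M (v + K) (dirW t (address-≤ (m≤m+n t 1) h (m≤n+m K v)))
        (dirR (ad x) (address-≤ (≤-trans (<⇒≤ (proj₂ (env R x))) (m≤m+n t 1)) h (m≤n+m K v)) (proj₁ (env R x)) (≤2^-mono (hρ x) (m≤m+n v K))))
    correct (inp e) {ad} {ρ} {t} {M} {v} R hρ h = weaken (exec-⨾ E ≤-refl (exec-⨾ (step⇒exec t<K S₁) ≤-refl (step⇒exec t<K S₂)))
      (+-monoʳ-≤ (tm K e v s) (≤-reflexive (cong (unit B +_) (sym (+-identityʳ (unit B))))))
      where
      open ≤-Reasoning
      E = correct e R hρ h
      t<K : t < K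
      t<K = ≤-trans (≤-trans (≤-reflexive (+-comm 1 t)) (+-monoʳ-≤ t (height>0 e))) h
      b = vbits e v s
      B = suc (b + (K + s))
      a = eval w ρ e
      a≤ : a ≤ 2 ^ b
      a≤ = eval-≤ e hρ
      D≤B : D ≤ 2 ^ B
      D≤B = ≤2^-mono D≤ (m≤n⇒m≤1+n (m≤n+m (K + s) b))
      a≤B : a ≤ 2 ^ B
      a≤B = ≤2^-mono a≤ (m≤n⇒m≤1+n (m≤m+n b (K + s)))
      K≤B : K ≤ B
      K≤B = m≤n⇒m≤1+n (≤-trans (m≤m+n K s) (m≤n+m (K + s) b))
      t≤B : t ≤ 2 ^ B
      t≤B = address-≤ ≤-refl (<⇒≤ t<K) K≤B
      S₁ = assign (M′ E) B add (dirW t t≤B) (dirR t t≤B (here E) a≤B) (dirR 0 z≤n (trans (low E 0 (0<t R)) (base R)) D≤B)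
             refl (+-≤2^ b (K + s) a≤ D≤)
      M₁ = Step.M′ S₁
      read : M₁ (a + D) ≡ w a
      read = begin-equality
        M₁ (a + D)     ≡⟨ cong M₁ (+-comm a D) ⟩
        M₁ (D + a)     ≡⟨ Step.other S₁ (D + a) (λ e → <⇒≢ (<-≤-trans t<K (≤-trans K≤D (m≤m+n D a))) (sym e)) ⟩
        M′ E (D + a)   ≡⟨ high E (D + a) (m≤m+n D a) ⟩
        M (D + a)      ≡⟨ input R a ⟩
        w a            ∎
      S₂ = copy M₁ B (dirW t t≤B) (indR t t≤B (Step.here S₁) (+-≤2^ b (K + s) a≤ D≤) read
             (≤2^-mono (w≤ a) (m≤n⇒m≤1+n (≤-trans (m≤n+m s K) (m≤n+m (K + s) b)))))
    correct (bin o a b) {ad} {ρ} {t} {M} {v} R hρ h = exec-⨾ Ea ≤-refl (exec-⨾ Eb (n≤1+n t) (step⇒exec (<⇒≤ 1+t<K) S))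
      where
      h′ : suc (t + (height a + height b)) ≤ K
      h′ = ≤-trans (≤-reflexive (sym (+-suc t _))) h
      Ea = correct a R hρ (≤-trans (+-monoʳ-≤ t (≤-trans (m≤m+n (height a) (height b)) (n≤1+n _))) h)
      Eb = correct b {M = M′ Ea} (ready-keep R (n≤1+n t) (low Ea) (high Ea)) hρ
             (≤-trans (s≤s (+-monoʳ-≤ t (m≤n+m (height b) (height a)))) h′)
      1+t<K : 1 + t < K
      1+t<K = ≤-trans (≤-reflexive (+-comm 2 t)) (≤-trans (+-monoʳ-≤ t (s≤s (≤-trans (height>0 a) (m≤m+n (height a) (height b))))) h)
      va = vbits a v s
      vb = vbits b v s
      B = suc (va + vb) + K
      K≤B : K ≤ B
      K≤B = m≤n+m K (suc (va + vb))
      a≤ = eval-≤ a hρ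
      b≤ = eval-≤ b hρ
      S = assign (M′ Eb) B o (dirW t (address-≤ (n≤1+n t) (<⇒≤ 1+t<K) K≤B))
            (dirR t (address-≤ (n≤1+n t) (<⇒≤ 1+t<K) K≤B) (trans (low Eb t (n<1+n t)) (here Ea))
              (≤2^-mono a≤ (≤-trans (≤-trans (m≤m+n va vb) (n≤1+n _)) (m≤m+n (suc (va + vb)) K))))
            (dirR (1 + t) (address-≤ ≤-refl (<⇒≤ 1+t<K) K≤B) (here Eb)
              (≤2^-mono b≤ (≤-trans (≤-trans (m≤n+m vb va) (n≤1+n _)) (m≤m+n (suc (va + vb)) K))))
            refl (≤2^-mono (binOp-≤2^ o va vb a≤ b≤) (m≤m+n (suc (va + vb)) K))
    correct (loop o x y c e) {ad} {ρ} {t} {M} {v} R hρ h = record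
      { run   = ⇓⨾ (Step.run S₁) (⇓⨾ (Step.run S₂) (⇓⨾ (Step.run S₃) (⇓⨾ (Step.run S₄) (proj₁ (proj₂ (proj₂ W))))))
      ; here  = LoopState.acc (proj₁ (proj₂ (proj₂ (proj₂ W))))
      ; low   = LoopState.keep< (proj₁ (proj₂ (proj₂ (proj₂ W))))
      ; high  = LoopState.keep≥ (proj₁ (proj₂ (proj₂ (proj₂ W))))
      ; time≤ = ≤-trans (+-mono-≤ (Step.time≤ S₁) (+-mono-≤ (Step.time≤ S₂) (+-mono-≤ (Step.time≤ S₃) (+-mono-≤ (Step.time≤ S₄)
                  (proj₂ (proj₂ (proj₂ (proj₂ W))))))))
                  (≤-trans (≤-reflexive (solve 3 (λ u n T → u :+ (u :+ (u :+ (u :+ (n :* (T :+ con 4 :* u :+ con 3 :* u) :+ u)))) := con 5 :* u :+ n :* (T :+ con 7 :* u)) refl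
                    (unit B) n (tm K e (v + s) s)))
                    (+-monoʳ-≤ (5 * unit B) (*-monoˡ-≤ _ n≤s)))
      }
      where
      open +-*-Solver using (solve; con; _:+_; _:*_; _:=_)
      b = vbits e (v + s) s
      B = suc (K + s) + (b + loopBits b s)
      n = w (position c)
      n≤s : n ≤ s
      n≤s = range≤ c
      Ks≤B : suc (K + s) ≤ B
      Ks≤B = m≤m+n (suc (K + s)) _
      K≤B : K ≤ B
      K≤B = ≤-trans (m≤n⇒m≤1+n (m≤m+n K s)) Ks≤B
      s≤B : s ≤ B
      s≤B = ≤-trans (m≤n⇒m≤1+n (m≤n+m s K)) Ks≤B
      b≤B : b ≤ B
      b≤B = ≤-trans (m≤m+n b (loopBits b s)) (m≤n+m _ (suc (K + s)))
      loop≤B : loopBits b s ≤ B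
      loop≤B = ≤-trans (m≤n+m (loopBits b s) b) (m≤n+m _ (suc (K + s)))
      n≤ : n ≤ 2 ^ B
      n≤ = ≤2^ (≤-trans n≤s s≤B)
      1≤ : 1 ≤ 2 ^ B
      1≤ = m^n>0 2 B
      4+t≤ : 4 + t ≤ K
      4+t≤ = ≤-trans (≤-trans (≤-reflexive (+-comm 4 t)) (+-monoʳ-≤ t (m≤m+n 4 (height e)))) h
      body≤ : 3 + t + height e ≤ K
      body≤ = ≤-trans (≤-trans (n≤1+n _) (≤-reflexive (solve 2 (λ t h → con 1 :+ (con 3 :+ t :+ h) := t :+ (con 4 :+ h)) refl t (height e)))) h
      reg≤ : ∀ {r} → r ≤ 3 + t → r ≤ 2 ^ B
      reg≤ r≤ = address-≤ r≤ (≤-trans (n≤1+n _) 4+t≤) K≤B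
      high≢ : ∀ {a r} → r ≤ 3 + t → D ≤ a → a ≢ r
      high≢ r≤ D≤a e = <⇒≢ (≤-trans (s≤s r≤) (≤-trans 4+t≤ (≤-trans K≤D D≤a))) (sym e)
      position≤1 : ∀ c → position c ≤ 1
      position≤1 #m = z≤n
      position≤1 #n = s≤s z≤n
      D+≤ : D + position c ≤ 2 ^ B
      D+≤ = ≤2^-mono (+-≤2^ (K + s) 0 D≤ (position≤1 c)) (≤-trans (≤-reflexive (cong suc (+-identityʳ (K + s)))) Ks≤B)
      S₁ = assign M B add (dirW (2 + t) (reg≤ (n≤1+n _))) (dirR 0 z≤n (base R) (≤2^-mono D≤ (≤-trans (n≤1+n _) Ks≤B)))
             (immR (position c) (≤-trans (position≤1 c) 1≤)) refl D+≤
      M₁ = Step.M′ S₁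
      S₂ = copy M₁ B (dirW (2 + t) (reg≤ (n≤1+n _))) (indR (2 + t) (reg≤ (n≤1+n _)) (Step.here S₁) D+≤
             (trans (Step.other S₁ _ (high≢ (n≤1+n _) (m≤m+n D _))) (input R (position c))) n≤)
      M₂ = Step.M′ S₂
      init≤1 : ∀ o → init o ≤ 1
      init≤1 sum  = z≤n
      init≤1 prod = s≤s z≤n
      init≤1 max  = z≤n
      init≤1 hist = z≤n
      S₃ = copy M₂ B (dirW t (reg≤ (m≤n+m t 3))) (immR (init o) (≤-trans (init≤1 o) 1≤))
      S₄ = copy (Step.M′ S₃) B (dirW (1 + t) (reg≤ (m≤n+m (1 + t) 2))) (immR 0 z≤n)
      M₄ = Step.M′ S₄
      f : ℕ → ℕ → ℕ
      f i a = step o a (value o x y ρ e i a)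
      body = comp (bind o x y ad (1 + t) t) (3 + t) e ⨾ update o t
      C = tm K e (v + s) s + 4 * unit B
      2+t<K : 2 + t < K
      2+t<K = ≤-trans (n≤1+n _) 4+t≤
      other₄ : ∀ a → a ≢ t → a ≢ 1 + t → a ≢ 2 + t → M₄ a ≡ M a
      other₄ a p q r = trans (Step.other S₄ a q) (trans (Step.other S₃ a p) (trans (Step.other S₂ a r) (Step.other S₁ a r)))
      L₀ : LoopState t n C B f (init o) body M 2+t<K K≤B n≤ 0 n M₄
      L₀ = record
        { acc   = trans (Step.other S₄ t (λ e → m≢1+n+m t {0} e)) (Step.here S₃)
        ; index = Step.here S₄
        ; count = trans (Step.other S₄ (2 + t) 1+n≢n) (trans (Step.other S₃ (2 + t) (λ e → m≢1+n+m t {1} (sym e))) (Step.here S₂))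
        ; keep< = λ a a<t → other₄ a (<⇒≢ a<t) (<⇒≢ (<-≤-trans a<t (m≤n+m t 1))) (<⇒≢ (<-≤-trans a<t (m≤n+m t 2)))
        ; keep≥ = λ a D≤a → other₄ a (high≢ (m≤n+m t 3) D≤a) (high≢ (m≤n+m (1 + t) 2) D≤a) (high≢ (n≤1+n _) D≤a)
        }
      bodyCorrect : ∀ i M′ r → i < n → LoopState t n C B f (init o) body M 2+t<K K≤B n≤ i r M′ →
                    Body t n C B f (init o) body M 2+t<K K≤B n≤ i M′
      bodyCorrect i M″ r i<n L = record
        { run₁   = ⇓⨾ (run E) (Update.run U)
        ; acc₁   = Update.here U
        ; other₁ = λ a a≢t a< → trans (Update.other U a a≢t (<⇒≢ a<)) (low E a a<)
        ; high₁  = λ a D≤a → trans (Update.other U a (high≢ (m≤n+m t 3) D≤a) (high≢ ≤-refl D≤a)) (high E a D≤a)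
        ; time₁≤ = +-mono-≤ (time≤ E) (Update.time≤ U)
        }
        where
        a = iter f (init o) i
        R′ = ready-keep {M′ = M″} R ≤-refl (LoopState.keep< L) (LoopState.keep≥ L)
        R″ : Ready M″ (bind o x y ad (1 + t) t) (bind o x y ρ i a) (3 + t)
        R″ = record
          { base  = base R′
          ; input = input R′
          ; 0<t   = s≤s z≤n
          ; env   = bind-related (λ p q → M″ p ≡ q × p < 3 + t) o x y
                      (λ z → proj₁ (env R′ z) , <-≤-trans (proj₂ (env R′ z)) (m≤n+m t 3))
                      (LoopState.index L , s≤s (s≤s (n≤1+n t))) (LoopState.acc L , s≤s (m≤n+m t 2))
          }
        i≤s = ≤-trans (<⇒≤ i<n) n≤s
        E = correct e R″ (bind-≤2^ o x y {v = v} hρ i≤s (hist-≤ o x y ρ e i i≤s)) body≤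
        U = update-correct (M′ E) t a _ B (trans (low E t (m≤n+m (1 + t) 2)) (LoopState.acc L)) (here E)
              (reg≤ ≤-refl) (≤2^-mono (partial-≤ o x y e hρ i i≤s) loop≤B) (≤2^-mono (value-≤ o x y e hρ i i≤s) b≤B)
              o (≤2^-mono (partial-≤ o x y e hρ (suc i) (≤-trans i<n n≤s)) loop≤B)
      W = while-correct t n C B f (init o) body M 2+t<K K≤B n≤ bodyCorrect 0 n M₄ refl L₀

-- Polynomial bounds for the cost of compiled expressions.

module Polynomial where

  open Machine
  open import Data.Nat.Base
  open import Data.Nat.Properties
  open import Relation.Binary.PropositionalEquality

  -- A single monomial suffices as bound because only `1 ≤ s` is considered: powers are then
  -- monotone in the exponent, and adding exponents serves for sums as well as for products.
  record Poly (f : ℕ → ℕ) : Set where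
    field
      coeff    : ℕ
      exponent : ℕ
      bound    : ∀ s → 1 ≤ s → f s ≤ coeff * s ^ exponent
  open Poly

  ^-mono-exponent : ∀ {s a b} → 1 ≤ s → a ≤ b → s ^ a ≤ s ^ b
  ^-mono-exponent {suc s} _ a≤b = ^-monoʳ-≤ (suc s) a≤b

  poly-const : ∀ c → Poly (λ _ → c)
  poly-const c = record { coeff = c ; exponent = 0 ; bound = λ s _ → ≤-reflexive (sym (*-identityʳ c)) }

  poly-id : Poly (λ s → s)
  poly-id = record { coeff = 1 ; exponent = 1 ; bound = λ s _ → ≤-reflexive (sym (trans (*-identityˡ (s * 1)) (*-identityʳ s))) }

  poly-+ : ∀ {f g} → Poly f → Poly g → Poly (λ s → f s + g s)
  poly-+ {f} {g} P Q = record
    { coeff    = coeff P + coeff Q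
    ; exponent = exponent P + exponent Q
    ; bound    = λ s 1≤s → begin
        f s + g s
          ≤⟨ +-mono-≤ (≤-trans (bound P s 1≤s) (*-monoʳ-≤ (coeff P) (^-mono-exponent 1≤s (m≤m+n (exponent P) (exponent Q)))))
                      (≤-trans (bound Q s 1≤s) (*-monoʳ-≤ (coeff Q) (^-mono-exponent 1≤s (m≤n+m (exponent Q) (exponent P))))) ⟩
        coeff P * s ^ (exponent P + exponent Q) + coeff Q * s ^ (exponent P + exponent Q)
          ≡⟨ *-distribʳ-+ (s ^ (exponent P + exponent Q)) (coeff P) (coeff Q) ⟨
        (coeff P + coeff Q) * s ^ (exponent P + exponent Q) ∎
    }
    where open ≤-Reasoning

  poly-* : ∀ {f g} → Poly f → Poly g → Poly (λ s → f s * g s)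
  poly-* {f} {g} P Q = record
    { coeff    = coeff P * coeff Q
    ; exponent = exponent P + exponent Q
    ; bound    = λ s 1≤s → begin
        f s * g s
          ≤⟨ *-mono-≤ (bound P s 1≤s) (bound Q s 1≤s) ⟩
        coeff P * s ^ exponent P * (coeff Q * s ^ exponent Q)
          ≡⟨ [m*n]*[o*p]≡[m*o]*[n*p] (coeff P) _ (coeff Q) _ ⟩
        coeff P * coeff Q * (s ^ exponent P * s ^ exponent Q)
          ≡⟨ cong (coeff P * coeff Q *_) (^-distribˡ-+-* s (exponent P) (exponent Q)) ⟨
        coeff P * coeff Q * s ^ (exponent P + exponent Q) ∎
    }
    where open ≤-Reasoning

  poly-suc : ∀ {f} → Poly f → Poly (λ s → suc (f s))
  poly-suc = poly-+ (poly-const 1)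

  poly-unit : ∀ {f} → Poly f → Poly (λ s → unit (f s))
  poly-unit P = poly-* (poly-const 10) (poly-suc P)

  poly-loopBits : ∀ {f} → Poly f → Poly (λ s → loopBits (f s) s)
  poly-loopBits P = poly-* (poly-suc P) (poly-suc poly-id)

  -- The width `w` is itself a function of `s`, since each enclosing loop adds `s` to it. The degree
  -- depends on `e` alone.
  vbits-poly : ∀ e {w} → Poly w → Poly (λ s → vbits e (w s) s)
  vbits-poly (num k)          P = poly-const k
  vbits-poly (var x)          P = P
  vbits-poly (inp e)          P = poly-id
  vbits-poly (bin o a b)      P = poly-suc (poly-+ (vbits-poly a P) (vbits-poly b P))
  vbits-poly (loop o x y c e) P = poly-loopBits (vbits-poly e (poly-+ P poly-id))

  tm-poly : ∀ K e {w} → Poly w → Poly (λ s → tm K e (w s) s)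
  tm-poly K (num k)     P = poly-unit (poly-const (k + K))
  tm-poly K (var x)     P = poly-unit (poly-+ P (poly-const K))
  tm-poly K (inp e)     P = poly-+ (tm-poly K e P)
    (poly-* (poly-const 2) (poly-unit (poly-suc (poly-+ (vbits-poly e P) (poly-+ (poly-const K) poly-id)))))
  tm-poly K (bin o a b) P = poly-+ (tm-poly K a P) (poly-+ (tm-poly K b P)
    (poly-unit (poly-+ (poly-suc (poly-+ (vbits-poly a P) (vbits-poly b P))) (poly-const K))))
  tm-poly K (loop o x y c e) P = poly-+ (poly-* (poly-const 5) u)
    (poly-* poly-id (poly-+ (tm-poly K e (poly-+ P poly-id)) (poly-* (poly-const 7) u)))
    where
    b = vbits-poly e (poly-+ P poly-id)
    u = poly-unit (poly-+ (poly-suc (poly-+ (poly-const K) poly-id)) (poly-+ b (poly-loopBits b)))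

-- Moving the input out of the way of the registers.

module Loader where

  open import Defs using (Memory; imm; dir; ind; add; sub; mul; div; Program; _≔_⟨_⟩_; _⨾_; while; ⟦_⟧ᵇ;
    readCost; ⟨_,_⟩⇓⟨_,_⟩; ⇓⨾; ⇓while-nz; ⇓while-z; n≤2^n)
  open Machine using (Step; assign; copy; immR; dirR; indR; dirW; indW; test-≤; unit; ≤2^-mono)
  open import Data.Nat.Base
  open import Data.Nat.Properties
  open import Data.Nat.DivMod using (m*n/n≡m)
  open import Data.Nat.Solver using (module +-*-Solver)
  open import Data.Product.Base using (∃-syntax; _×_; _,_; proj₁; proj₂)
  open import Data.Sum.Base using ([_,_]′)
  open import Relation.Binary.PropositionalEquality
  open Step

  -- Cell 2 counts the `r` words still to be moved, words 3 to `r + 2`. Within a round it is turned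
  -- into the index `r + 2` of the last of them; subtracting 3 leaves the counter `r - 1`.
  copyBody : Program
  copyBody = dir 2 ≔ dir 2 ⟨ add ⟩ imm 2 ⨾
             dir 1 ≔ dir 0 ⟨ add ⟩ dir 2 ⨾
             ind 1 ≔ ind 2 ⟨ add ⟩ imm 0 ⨾
             dir 2 ≔ dir 2 ⟨ sub ⟩ imm 3

  -- Moves input word a from cell a to cell D + a, and D itself to cell 0, where
  -- D is K plus the number of input words.
  loader : ℕ → Program
  loader K =
    dir 0 ≔ dir 0 ⟨ add ⟩ imm 2 ⨾
    dir 0 ≔ dir 0 ⟨ mul ⟩ dir 1 ⨾
    dir 0 ≔ dir 0 ⟨ add ⟩ imm (3 + K) ⨾
    ind 0 ≔ dir 1 ⟨ add ⟩ imm 0 ⨾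
    dir 1 ≔ dir 0 ⟨ add ⟩ imm 1 ⨾
    ind 1 ≔ dir 2 ⟨ add ⟩ imm 0 ⨾
    dir 0 ≔ dir 0 ⟨ sub ⟩ imm 1 ⨾
    dir 2 ≔ dir 0 ⟨ sub ⟩ imm (3 + K) ⨾
    while (dir 2) copyBody ⨾
    dir 1 ≔ dir 0 ⟨ add ⟩ imm 1 ⨾
    dir 1 ≔ ind 1 ⟨ add ⟩ imm 0 ⨾
    dir 2 ≔ dir 0 ⟨ sub ⟩ imm (2 + K) ⨾
    dir 2 ≔ dir 2 ⟨ div ⟩ dir 1 ⨾
    dir 2 ≔ dir 2 ⟨ sub ⟩ imm 2 ⨾
    ind 0 ≔ dir 2 ⟨ add ⟩ imm 0

  module _ (w : Memory) (s K : ℕ) (1≤n : 1 ≤ w 1) (1≤K : 1 ≤ K) (w≤ : ∀ a → w a ≤ 2 ^ s)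
           (w≡0 : ∀ a → 2 + (w 0 + 2) * w 1 ≤ a → w a ≡ 0)
           (B : ℕ) (s≤B : s ≤ B) (size≤B : 2 + (K + (w 0 + 2) * w 1) + (2 + (w 0 + 2) * w 1) ≤ B) where

    private
      m = w 0
      n = w 1
      P = (m + 2) * n

    start : ℕ
    start = 2 + (K + P)

    private
      D = start

      1≤P : 1 ≤ P
      1≤P = *-mono-≤ (≤-trans (n≤1+n 1) (m≤n+m 2 m)) 1≤n

      r₀ = pred P

      P≡ : P ≡ suc r₀
      P≡ = sym (suc-pred P {{>-nonZero 1≤P}})

      ≤2^B : ∀ {v} → v ≤ D + (2 + P) → v ≤ 2 ^ B
      ≤2^B h = ≤-trans (≤-trans h size≤B) (n≤2^n B)

      D+≤ : ∀ a → a ≤ 2 → D + a ≤ 2 ^ B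
      D+≤ a a≤2 = ≤2^B (+-monoʳ-≤ D (≤-trans a≤2 (m≤m+n 2 P)))

      D≤ : D ≤ 2 ^ B
      D≤ = ≤2^B (m≤m+n D _)

      small : ∀ {v} → v ≤ 3 + K → v ≤ 2 ^ B
      small h = ≤2^B (≤-trans h (≤-trans (+-monoʳ-≤ 2 (≤-trans (≤-reflexive (+-comm 1 K)) (+-monoʳ-≤ K 1≤P))) (m≤m+n D _)))

      tiny : ∀ {v} → v ≤ 3 → v ≤ 2 ^ B
      tiny h = small (≤-trans h (m≤m+n 3 K))

      r1 : 1 ≤ 2 ^ B
      r1 = tiny (s≤s z≤n)

      r2 : 2 ≤ 2 ^ B
      r2 = tiny (s≤s (s≤s z≤n))

      w≤B : ∀ a → w a ≤ 2 ^ B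
      w≤B a = ≤2^-mono (w≤ a) s≤B

      D+a≢i : ∀ {a i} → i ≤ 2 → D + a ≢ i
      D+a≢i {a} {i} i≤2 e = <⇒≢ (≤-trans (s≤s i≤2) (≤-trans (+-monoʳ-≤ 2 (≤-trans 1≤P (m≤n+m P K))) (m≤m+n D a))) (sym e)

      D+a≢D+b : ∀ {a b} → a ≢ b → D + a ≢ D + b
      D+a≢D+b a≢b e = a≢b (+-cancelˡ-≡ D _ _ e)

      i≢D+a : ∀ {a i} → i ≤ 2 → i ≢ D + a
      i≢D+a i≤2 e = D+a≢i i≤2 (sym e)

      n≤ : n ≤ 2 ^ B
      n≤ = w≤B 1

      -- Cells 0, 1 and 2 become working registers, so words 1 and 2 must be in their new places
      -- before the loop starts. Word 0 is lost meanwhile.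
      record Copied (r : ℕ) (M : Memory) : Set where
        field
          c0   : M 0 ≡ D
          c2   : M 2 ≡ r
          in1  : M (D + 1) ≡ n
          in2  : M (D + 2) ≡ w 2
          done : ∀ a → 3 + r ≤ a → M (D + a) ≡ w a
          todo : ∀ a → 3 ≤ a → a < D → M a ≡ w a
          r≤   : r ≤ r₀
      open Copied

      copyLoop : ∀ r M → Copied r M → ∃[ M′ ] ∃[ τ ] ⟨ while (dir 2) copyBody , M ⟩⇓⟨ M′ , τ ⟩ × Copied 0 M′ × τ ≤ r * (5 * unit B) + unit B
      copyLoop zero M C = M , _ , ⇓while-z (c2 C) , C , test-≤ M B (dirR 2 r2 (c2 C) z≤n)
      copyLoop (suc r) M C =
        let (M′ , τ , run′ , C′ , τ≤) = copyLoop r M₄ C₄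
        in M′ , _ , ⇓while-nz (λ e → 0≢1+n (trans (sym e) (c2 C))) (⇓⨾ (run S₁) (⇓⨾ (run S₂) (⇓⨾ (run S₃) (run S₄)))) run′ , C′ , total τ≤
        where
        r≤P : 3 + r ≤ 2 + P
        r≤P = s≤s (s≤s (≤-trans (≤-trans (n≤1+n _) (s≤s (r≤ C))) (≤-reflexive (sym P≡))))
        r≤B : 3 + r ≤ 2 ^ B
        r≤B = ≤2^B (≤-trans r≤P (m≤n+m (2 + P) D))
        sr≤B : suc r ≤ 2 ^ B
        sr≤B = ≤-trans (m≤n+m (suc r) 2) r≤B
        r<D : 3 + r < D
        r<D = ≤-trans (s≤s r≤P) (+-monoʳ-≤ 2 (+-monoˡ-≤ P 1≤K))
        S₁ = assign M B add (dirW 2 r2) (dirR 2 r2 (c2 C) sr≤B) (immR 2 r2) (+-comm (suc r) 2) r≤B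
        M₁ = M′ S₁
        p0 : M₁ 0 ≡ D
        p0 = trans (other S₁ 0 λ ()) (c0 C)
        Dr≤ : D + (3 + r) ≤ 2 ^ B
        Dr≤ = ≤2^B (+-monoʳ-≤ D r≤P)
        S₂ = assign M₁ B add (dirW 1 r1) (dirR 0 z≤n p0 D≤) (dirR 2 r2 (here S₁) r≤B) refl Dr≤
        M₂ = M′ S₂
        q2 : M₂ 2 ≡ 3 + r
        q2 = trans (other S₂ 2 λ ()) (here S₁)
        S₃ = copy M₂ B (indW 1 r1 (here S₂) Dr≤) (indR 2 r2 q2 r≤B
               (trans (other S₂ (3 + r) λ ()) (trans (other S₁ (3 + r) λ ()) (todo C (3 + r) (m≤m+n 3 r) r<D))) (w≤B (3 + r)))
        M₃ = M′ S₃
        S₄ = assign M₃ B sub (dirW 2 r2) (dirR 2 r2 (trans (other S₃ 2 (i≢D+a ≤-refl)) q2) r≤B) (immR 3 (tiny ≤-refl)) refl (≤-trans (n≤1+n r) sr≤B)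
        M₄ = M′ S₄
        input₄ : ∀ a → a ≢ 3 + r → M₄ (D + a) ≡ M (D + a)
        input₄ a a≢ = trans (other S₄ (D + a) (D+a≢i ≤-refl)) (trans (other S₃ (D + a) (D+a≢D+b a≢))
          (trans (other S₂ (D + a) (D+a≢i (s≤s z≤n))) (other S₁ (D + a) (D+a≢i ≤-refl))))
        C₄ : Copied r M₄
        C₄ = record
          { c0   = trans (other S₄ 0 λ ()) (trans (other S₃ 0 (i≢D+a z≤n)) (trans (other S₂ 0 λ ()) p0))
          ; c2   = here S₄
          ; in1  = trans (input₄ 1 λ ()) (in1 C)
          ; in2  = trans (input₄ 2 λ ()) (in2 C)
          ; done = done₄
          ; todo = λ a 3≤a a<D → trans (other S₄ a (far 3≤a ≤-refl)) (trans (other S₃ a (below a<D))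
                     (trans (other S₂ a (far 3≤a (s≤s z≤n))) (trans (other S₁ a (far 3≤a ≤-refl)) (todo C a 3≤a a<D))))
          ; r≤   = ≤-trans (n≤1+n r) (r≤ C)
          }
          where
          far : ∀ {a i} → 3 ≤ a → i ≤ 2 → a ≢ i
          far 3≤a i≤2 e = <⇒≢ (≤-trans (s≤s i≤2) 3≤a) (sym e)
          below : ∀ {a b} → a < D → a ≢ D + b
          below {b = b} a<D = <⇒≢ (<-≤-trans a<D (m≤m+n D b))
          done₄ : ∀ a → 3 + r ≤ a → M₄ (D + a) ≡ w a
          done₄ a h = [ (λ 3+r<a → trans (input₄ a (λ e → <⇒≢ 3+r<a (sym e))) (done C a 3+r<a))
                      , (λ { refl → trans (other S₄ (D + a) (D+a≢i ≤-refl)) (here S₃) })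
                      ]′ (m≤n⇒m<n∨m≡n h)
        test≤ : 1 + readCost (dir 2) M ≤ unit B
        test≤ = test-≤ M B (dirR 2 r2 (c2 C) sr≤B)
        total : ∀ {τ} → τ ≤ r * (5 * unit B) + unit B →
                1 + readCost (dir 2) M + (time S₁ + (time S₂ + (time S₃ + time S₄))) + τ ≤ suc r * (5 * unit B) + unit B
        total {τ} h = ≤-trans (+-mono-≤ (+-mono-≤ test≤ (+-mono-≤ (time≤ S₁) (+-mono-≤ (time≤ S₂) (+-mono-≤ (time≤ S₃) (time≤ S₄))))) h)
          (≤-reflexive (solve 2 (λ u T → u :+ (u :+ (u :+ (u :+ u))) :+ (T :+ u) := con 5 :* u :+ T :+ u) refl (unit B) (r * (5 * unit B))))
          where open +-*-Solver using (solve; con; _:+_; _:*_; _:=_)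

    record Loaded : Set where
      field
        memory  : Memory
        loading : ℕ
        loads   : ⟨ loader K , w ⟩⇓⟨ memory , loading ⟩
        base    : memory 0 ≡ start
        input   : ∀ a → memory (start + a) ≡ w a
        loading≤ : loading ≤ 15 * unit B + r₀ * (5 * unit B)

    load-correct : Loaded
    load-correct = record
      { loads    = ⇓⨾ (run S₁) (⇓⨾ (run S₂) (⇓⨾ (run S₃) (⇓⨾ (run S₄) (⇓⨾ (run S₅) (⇓⨾ (run S₆) (⇓⨾ (run S₇) (⇓⨾ (run S₈)
                   (⇓⨾ runW (⇓⨾ (run T₁) (⇓⨾ (run T₂) (⇓⨾ (run T₃) (⇓⨾ (run T₄) (⇓⨾ (run T₅) (run T₆))))))))))))))
      ; base     = trans (other T₆ 0 (i≢D+a z≤n)) n0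
      ; input    = input′
      ; loading≤ = ≤-trans
          (+-mono-≤ (time≤ S₁) (+-mono-≤ (time≤ S₂) (+-mono-≤ (time≤ S₃) (+-mono-≤ (time≤ S₄) (+-mono-≤ (time≤ S₅)
            (+-mono-≤ (time≤ S₆) (+-mono-≤ (time≤ S₇) (+-mono-≤ (time≤ S₈) (+-mono-≤ τW≤ (+-mono-≤ (time≤ T₁)
            (+-mono-≤ (time≤ T₂) (+-mono-≤ (time≤ T₃) (+-mono-≤ (time≤ T₄) (+-mono-≤ (time≤ T₅) (time≤ T₆)))))))))))))))
          (≤-reflexive (solve 2 (λ u W →
            u :+ (u :+ (u :+ (u :+ (u :+ (u :+ (u :+ (u :+ ((W :+ u) :+ (u :+ (u :+ (u :+ (u :+ (u :+ u)))))))))))))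
            := con 15 :* u :+ W) refl (unit B) (r₀ * (5 * unit B))))
      }
      where
      open +-*-Solver using (solve; con; _:+_; _:*_; _:=_)
      1≤2 : 1 ≤ 2
      1≤2 = s≤s z≤n
      0⁺ : ∀ a → D + a ≢ 0
      0⁺ a = D+a≢i z≤n
      1⁺ : ∀ a → D + a ≢ 1
      1⁺ a = D+a≢i 1≤2
      2⁺ : ∀ a → D + a ≢ 2
      2⁺ a = D+a≢i ≤-refl
      P≤ : P ≤ 2 ^ B
      P≤ = ≤2^B (≤-trans (m≤n+m P 2) (m≤n+m (2 + P) D))
      m+2≤ : m + 2 ≤ 2 ^ B
      m+2≤ = ≤-trans (m≤m*n (m + 2) n {{>-nonZero 1≤n}}) P≤
      sD≤ : suc D ≤ 2 ^ B
      sD≤ = ≤-trans (≤-reflexive (+-comm 1 D)) (D+≤ 1 1≤2)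
      S₁ = assign w B add (dirW 0 z≤n) (dirR 0 z≤n refl (w≤B 0)) (immR 2 r2) refl m+2≤
      a1 : M′ S₁ 1 ≡ n
      a1 = other S₁ 1 λ ()
      S₂ = assign (M′ S₁) B mul (dirW 0 z≤n) (dirR 0 z≤n (here S₁) m+2≤) (dirR 1 r1 a1 n≤) refl P≤
      S₃ = assign (M′ S₂) B add (dirW 0 z≤n) (dirR 0 z≤n (here S₂) P≤) (immR (3 + K) (small ≤-refl)) (+-comm P (3 + K)) sD≤
      S₄ = copy (M′ S₃) B (indW 0 z≤n (trans (here S₃) (+-comm 1 D)) (D+≤ 1 1≤2))
             (dirR 1 r1 (trans (other S₃ 1 λ ()) (trans (other S₂ 1 λ ()) a1)) n≤)
      d0 : M′ S₄ 0 ≡ suc D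
      d0 = trans (other S₄ 0 (i≢D+a z≤n)) (here S₃)
      S₅ = assign (M′ S₄) B add (dirW 1 r1) (dirR 0 z≤n d0 sD≤) (immR 1 r1) (trans (cong suc (+-comm D 1)) (+-comm 2 D)) (D+≤ 2 ≤-refl)
      S₆ = copy (M′ S₅) B (indW 1 r1 (here S₅) (D+≤ 2 ≤-refl)) (dirR 2 r2 (trans (other S₅ 2 λ ()) (trans (other S₄ 2 (i≢D+a ≤-refl))
             (trans (other S₃ 2 λ ()) (trans (other S₂ 2 λ ()) (other S₁ 2 λ ()))))) (w≤B 2))
      S₇ = assign (M′ S₆) B sub (dirW 0 z≤n) (dirR 0 z≤n (trans (other S₆ 0 (i≢D+a z≤n)) (trans (other S₅ 0 λ ()) d0)) sD≤) (immR 1 r1) refl D≤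
      D∸≡ : D ∸ (3 + K) ≡ r₀
      D∸≡ = trans (cong (λ p → (K + p) ∸ (1 + K)) P≡) (trans (cong (_∸ (1 + K)) (+-suc K r₀)) (m+n∸m≡n K r₀))
      S₈ = assign (M′ S₇) B sub (dirW 2 r2) (dirR 0 z≤n (here S₇) D≤) (immR (3 + K) (small ≤-refl)) D∸≡
             (≤-trans (≤-trans (n≤1+n r₀) (≤-reflexive (sym P≡))) P≤)
      M₈ = M′ S₈
      fresh : ∀ a → a ≢ 0 → a ≢ 1 → a ≢ 2 → a ≢ D + 1 → a ≢ D + 2 → M₈ a ≡ w a
      fresh a p q r p′ q′ = trans (other S₈ a r) (trans (other S₇ a p) (trans (other S₆ a q′) (trans (other S₅ a q)
        (trans (other S₄ a p′) (trans (other S₃ a p) (trans (other S₂ a p) (other S₁ a p)))))))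
      beyond : ∀ a → 3 ≤ a → ∀ i → i ≤ 2 → a ≢ i
      beyond a 3≤a i i≤2 e = <⇒≢ (≤-trans (s≤s i≤2) 3≤a) (sym e)
      C : Copied r₀ M₈
      C = record
        { c0   = trans (other S₈ 0 λ ()) (here S₇)
        ; c2   = here S₈
        ; in1  = trans (other S₈ _ (2⁺ 1)) (trans (other S₇ _ (0⁺ 1)) (trans (other S₆ _ (D+a≢D+b λ ())) (trans (other S₅ _ (1⁺ 1)) (here S₄))))
        ; in2  = trans (other S₈ _ (2⁺ 2)) (trans (other S₇ _ (0⁺ 2)) (here S₆))
        -- Nothing has been copied yet beyond words 1 and 2, but from `a = 2 + P` on both sides are
        -- blank memory, hence 0.
        ; done = λ a h → trans (fresh (D + a) (0⁺ a) (1⁺ a) (2⁺ a)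
                   (D+a≢D+b (beyond a (≤-trans (m≤m+n 3 r₀) h) 1 1≤2)) (D+a≢D+b (beyond a (≤-trans (m≤m+n 3 r₀) h) 2 ≤-refl)))
                   (trans (w≡0 (D + a) (≤-trans (+-monoʳ-≤ 2 (m≤n+m P K)) (m≤m+n D a)))
                   (sym (w≡0 a (≤-trans (≤-reflexive (cong (2 +_) P≡)) h))))
        ; todo = λ a 3≤a a<D → fresh a (beyond a 3≤a 0 z≤n) (beyond a 3≤a 1 1≤2) (beyond a 3≤a 2 ≤-refl)
                   (<⇒≢ (<-≤-trans a<D (m≤m+n D 1))) (<⇒≢ (<-≤-trans a<D (m≤m+n D 2)))
        ; r≤   = ≤-refl
        }
      W = copyLoop r₀ M₈ C
      M₉ = proj₁ W
      runW = proj₁ (proj₂ (proj₂ W))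
      C₉ = proj₁ (proj₂ (proj₂ (proj₂ W)))
      τW≤ = proj₂ (proj₂ (proj₂ (proj₂ W)))
      T₁ = assign M₉ B add (dirW 1 r1) (dirR 0 z≤n (c0 C₉) D≤) (immR 1 r1) refl (D+≤ 1 1≤2)
      T₂ = copy (M′ T₁) B (dirW 1 r1) (indR 1 r1 (here T₁) (D+≤ 1 1≤2) (trans (other T₁ (D + 1) (1⁺ 1)) (in1 C₉)) n≤)
      i0 : M′ T₂ 0 ≡ D
      i0 = trans (other T₂ 0 λ ()) (trans (other T₁ 0 λ ()) (c0 C₉))
      T₃ = assign (M′ T₂) B sub (dirW 2 r2) (dirR 0 z≤n i0 D≤) (immR (2 + K) (small (n≤1+n _))) (m+n∸m≡n K P) P≤
      -- The first assignment destroyed `m`. It is recovered from `P = (m + 2) * n`, obtained from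
      -- `D` by subtraction, and from the saved word `n`; this division is where `1 ≤ n` is
      -- essential.
      P/n : ∀ k → 1 ≤ k → ⟦ div ⟧ᵇ ((m + 2) * k) k ≡ m + 2
      P/n (suc k) _ = m*n/n≡m (m + 2) (suc k)
      T₄ = assign (M′ T₃) B div (dirW 2 r2) (dirR 2 r2 (here T₃) P≤) (dirR 1 r1 (trans (other T₃ 1 λ ()) (here T₂)) n≤) (P/n n 1≤n) m+2≤
      T₅ = assign (M′ T₄) B sub (dirW 2 r2) (dirR 2 r2 (here T₄) m+2≤) (immR 2 r2) (m+n∸n≡m m 2) (w≤B 0)
      n0 : M′ T₅ 0 ≡ D
      n0 = trans (other T₅ 0 λ ()) (trans (other T₄ 0 λ ()) (trans (other T₃ 0 λ ()) i0))
      T₆ = copy (M′ T₅) B (indW 0 z≤n (trans n0 (sym (+-identityʳ D))) (D+≤ 0 z≤n)) (dirR 2 r2 (here T₅) (w≤B 0))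
      back : ∀ a → a ≢ 0 → M′ T₆ (D + a) ≡ M₉ (D + a)
      back a a≢0 = trans (other T₆ _ (D+a≢D+b a≢0)) (trans (other T₅ _ (2⁺ a)) (trans (other T₄ _ (2⁺ a)) (trans (other T₃ _ (2⁺ a))
        (trans (other T₂ _ (1⁺ a)) (other T₁ _ (1⁺ a))))))
      input′ : ∀ a → M′ T₆ (D + a) ≡ w a
      input′ 0 = here T₆
      input′ 1 = trans (back 1 λ ()) (in1 C₉)
      input′ 2 = trans (back 2 λ ()) (in2 C₉)
      input′ (suc (suc (suc a))) = trans (back (3 + a) λ ()) (done C₉ (3 + a) (m≤m+n 3 a))

-- Where the data of an instance stand in its encoding.

module Encoding where

  open import Defs using (PartialFunction; Point; m; points; encode; size; load; bits)
  open import Data.Bool.Base using (Bool; if_then_else_)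
  open import Data.Fin.Base using (Fin; zero; suc; toℕ)
  open import Data.Integer.Base as ℤ using ()
  open import Data.List.Base using (List; []; _∷_; _++_; concatMap; length; lookup; map)
  open import Data.List.Properties using (length-++; length-map)
  open import Data.Nat.Base
  open import Data.Nat.ListAction using (sum)
  open import Data.Nat.Properties
  open import Data.Nat.Logarithm using (⌊log₂_⌋; ⌊log₂⌋-mono-≤; ⌊log₂[2^n]⌋≡n)
  import Data.Rational.Base as ℚ
  open import Data.Vec.Base as Vec using (Vec; []; _∷_; toList)
  open import Data.Vec.Properties using (length-toList)
  open import Relation.Binary.PropositionalEquality

  load-++ˡ : ∀ xs ys {r} → r < length xs → load (xs ++ ys) r ≡ load xs r
  load-++ˡ (x ∷ xs) ys {zero}  _       = refl
  load-++ˡ (x ∷ xs) ys {suc r} (s≤s h) = load-++ˡ xs ys h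

  load-++ʳ : ∀ xs ys r → load (xs ++ ys) (length xs + r) ≡ load ys r
  load-++ʳ []       ys r = refl
  load-++ʳ (x ∷ xs) ys r = load-++ʳ xs ys r

  load-beyond : ∀ xs {r} → length xs ≤ r → load xs r ≡ 0
  load-beyond []       _       = refl
  load-beyond (x ∷ xs) (s≤s h) = load-beyond xs h

  module _ {A : Set} (f : A → List ℕ) (ℓ : ℕ) (length-f : ∀ a → length (f a) ≡ ℓ) where

    load-concatMap : ∀ xs (i : Fin (length xs)) r → r < ℓ → load (concatMap f xs) (toℕ i * ℓ + r) ≡ load (f (lookup xs i)) r
    load-concatMap (x ∷ xs) zero    r r<ℓ = load-++ˡ (f x) (concatMap f xs) (≤-trans r<ℓ (≤-reflexive (sym (length-f x))))
    load-concatMap (x ∷ xs) (suc i) r r<ℓ = begin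
      load (f x ++ concatMap f xs) (ℓ + toℕ i * ℓ + r)
        ≡⟨ cong (load (f x ++ concatMap f xs)) (trans (+-assoc ℓ (toℕ i * ℓ) r) (cong (_+ (toℕ i * ℓ + r)) (sym (length-f x)))) ⟩
      load (f x ++ concatMap f xs) (length (f x) + (toℕ i * ℓ + r))
        ≡⟨ load-++ʳ (f x) (concatMap f xs) (toℕ i * ℓ + r) ⟩
      load (concatMap f xs) (toℕ i * ℓ + r)
        ≡⟨ load-concatMap xs i r r<ℓ ⟩
      load (f (lookup xs i)) r ∎
      where open ≡-Reasoning

    length-concatMap : ∀ xs → length (concatMap f xs) ≡ length xs * ℓ
    length-concatMap []       = refl
    length-concatMap (x ∷ xs) = trans (length-++ (f x)) (cong₂ _+_ (length-f x) (length-concatMap xs))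

  v≤2^bits : ∀ v → v ≤ 2 ^ bits v
  v≤2^bits v = ≮⇒≥ λ h → 1+n≰n (≤-trans (≤-reflexive (sym (⌊log₂[2^n]⌋≡n (bits v)))) (⌊log₂⌋-mono-≤ (<⇒≤ h)))

  load-≤ : ∀ xs a → load xs a ≤ 2 ^ sum (map bits xs)
  load-≤ []       a       = z≤n
  load-≤ (x ∷ xs) zero    = ≤-trans (v≤2^bits x) (^-monoʳ-≤ 2 (m≤m+n (bits x) _))
  load-≤ (x ∷ xs) (suc a) = ≤-trans (load-≤ xs a) (^-monoʳ-≤ 2 (m≤n+m _ (bits x)))

  length≤bits : ∀ xs → length xs ≤ sum (map bits xs)
  length≤bits []       = z≤n
  length≤bits (x ∷ xs) = +-mono-≤ (s≤s (z≤n {⌊log₂ x ⌋})) (length≤bits xs)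

  bit : Bool → ℕ
  bit b = if b then 1 else 0

  load-bits : ∀ {k} (T : Vec Bool k) ys (j : Fin k) → load (map bit (toList T) ++ ys) (toℕ j) ≡ bit (Vec.lookup T j)
  load-bits (b ∷ T) ys zero    = refl
  load-bits (b ∷ T) ys (suc j) = load-bits T ys j

  tableIndex : (ℕ → ℕ) → ℕ → ℕ → ℕ
  tableIndex w i j = (2 + i * (w 0 + 2)) + j

  module Words (H : PartialFunction) where

    input : ℕ → ℕ
    input = load (encode H)

    n : ℕ
    n = length (points H)

    encodePoint : Point (m H) → List ℕ
    encodePoint P = map bit (toList (Point.T P)) ++ ℤ.∣ ℚ.↥ (Point.f P) ∣ ∷ ℚ.↧ₙ (Point.f P) ∷ []

    length-bits : ∀ P → length (map bit (toList (Point.T P))) ≡ m H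
    length-bits P = trans (length-map bit (toList (Point.T P))) (length-toList (Point.T P))

    length-encodePoint : ∀ P → length (encodePoint P) ≡ m H + 2
    length-encodePoint P = trans (length-++ (map bit (toList (Point.T P)))) (cong (_+ 2) (length-bits P))

    input-entry : ∀ i r → r < m H + 2 → input (tableIndex input (toℕ i) r) ≡ load (encodePoint (lookup (points H) i)) r
    input-entry i r r< = load-concatMap encodePoint (m H + 2) length-encodePoint (points H) i r r<

    indicator : ∀ i (j : Fin (m H)) → input (tableIndex input (toℕ i) (toℕ j)) ≡ bit (Vec.lookup (Point.T (lookup (points H) i)) j)
    indicator i j = trans (input-entry i (toℕ j) (≤-trans (toℕ<n j) (m≤m+n (m H) 2))) (load-bits (Point.T (lookup (points H) i)) _ j)
      where open import Data.Fin.Properties using (toℕ<n)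

    tail-entry : ∀ P r → load (encodePoint P) (m H + r) ≡ load (ℤ.∣ ℚ.↥ (Point.f P) ∣ ∷ ℚ.↧ₙ (Point.f P) ∷ []) r
    tail-entry P r = trans (cong (λ l → load (encodePoint P) (l + r)) (sym (length-bits P))) (load-++ʳ (map bit (toList (Point.T P))) _ r)

    numerator : ∀ i → input (tableIndex input (toℕ i) (m H + 0)) ≡ ℤ.∣ ℚ.↥ (Point.f (lookup (points H) i)) ∣
    numerator i = trans (input-entry i (m H + 0) (+-monoʳ-< (m H) (s≤s z≤n))) (tail-entry (lookup (points H) i) 0)

    denominator : ∀ i → input (tableIndex input (toℕ i) (m H + 1)) ≡ ℚ.↧ₙ (Point.f (lookup (points H) i))
    denominator i = trans (input-entry i (m H + 1) (+-monoʳ-< (m H) (s≤s (s≤s z≤n)))) (tail-entry (lookup (points H) i) 1)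

    length-encode : length (encode H) ≡ 2 + (m H + 2) * n
    length-encode = cong (2 +_) (trans (length-concatMap encodePoint (m H + 2) length-encodePoint (points H)) (*-comm n (m H + 2)))

    input-beyond : ∀ a → 2 + (m H + 2) * n ≤ a → input a ≡ 0
    input-beyond a h = load-beyond (encode H) (≤-trans (≤-reflexive length-encode) h)

    input-≤ : ∀ a → input a ≤ 2 ^ size H
    input-≤ = load-≤ (encode H)

    length≤size : 2 + (m H + 2) * n ≤ size H
    length≤size = ≤-trans (≤-reflexive (sym length-encode)) (length≤bits (encode H))

-- A whole program: load, evaluate numerator and denominator, output.

module Execution where

  open import Defs using (PartialFunction; Program; m; points; size; imm; dir; add; _≔_⟨_⟩_; _⨾_; ⟨_,_⟩⇓⟨_,_⟩; ⇓⨾; n≤2^n)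
  open Machine
  open Polynomial
  open Loader using (loader; load-correct; module Loaded)
  open Encoding using (module Words)
  open import Data.List.Base using (length)
  open import Data.Nat.Base
  open import Data.Nat.Properties
  open import Data.Nat.Solver using (module +-*-Solver)
  open import Data.Product.Base using (_,_)
  open import Relation.Binary.PropositionalEquality

  module Quotient (e₁ e₂ : Exp) where

    K : ℕ
    K = 2 + (height e₁ + height e₂)

    program : Program
    program = loader K ⨾ comp (λ _ → 0) 1 e₁ ⨾ comp (λ _ → 0) 2 e₂ ⨾ dir 0 ≔ dir 1 ⟨ add ⟩ imm 0 ⨾ dir 1 ≔ dir 2 ⟨ add ⟩ imm 0

    loadTime : ℕ → ℕ
    loadTime s = 15 * unit (K + s + s) + s * (5 * unit (K + s + s))

    outBits : ℕ → ℕ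
    outBits s = K + (vbits e₁ (K + s) s + vbits e₂ (K + s) s)

    totalTime : ℕ → ℕ
    totalTime s = loadTime s + (tm K e₁ (K + s) s + (tm K e₂ (K + s) s + (unit (outBits s) + unit (outBits s))))

    totalTime-poly : Poly totalTime
    totalTime-poly = poly-+ (poly-+ (poly-* (poly-const 15) u) (poly-* poly-id (poly-* (poly-const 5) u)))
      (poly-+ (tm-poly K e₁ v) (poly-+ (tm-poly K e₂ v) (poly-+ o o)))
      where
      v : Poly (λ s → K + s)
      v = poly-+ (poly-const K) poly-id
      u = poly-unit (poly-+ v poly-id)
      o = poly-unit (poly-+ (poly-const K) (poly-+ (vbits-poly e₁ v) (vbits-poly e₂ v)))

    module _ (H : PartialFunction) (1≤n : 1 ≤ length (points H)) where
      open Words H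

      private
        s = size H
        N≤s = length≤size
        P = (m H + 2) * n

        1≤s : 1 ≤ s
        1≤s = ≤-trans (s≤s z≤n) N≤s

        P≤s : P ≤ s
        P≤s = ≤-trans (m≤n+m P 2) N≤s

        -- Loop lengths must be bounded by the size, not by a power of it in base 2. For `m` this
        -- uses that a set is present: its indicator takes `m` words, whereas the number `m` alone
        -- is encoded in logarithmically many bits.
        range≤ : ∀ c → input (position c) ≤ s
        range≤ #m = ≤-trans (≤-trans (m≤m+n (m H) 2) (m≤m*n (m H + 2) n {{>-nonZero 1≤n}})) P≤s
        range≤ #n = ≤-trans (m≤n*m n (m H + 2) {{>-nonZero (m≤n⇒m≤o+n (m H) (s≤s z≤n))}}) P≤s

        D≤K+s : 2 + (K + P) ≤ K + s
        D≤K+s = ≤-trans (≤-reflexive (solve 2 (λ K P → con 2 :+ (K :+ P) := K :+ (con 2 :+ P)) refl K P)) (+-monoʳ-≤ K N≤s)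
          where open +-*-Solver using (solve; con; _:+_; _:=_)

      base : ℕ
      base = 2 + (K + P)

      v₁ v₂ : ℕ
      v₁ = eval input (λ _ → base) e₁
      v₂ = eval input (λ _ → base) e₂

      record Outcome : Set where
        field
          memory  : ℕ → ℕ
          time    : ℕ
          run     : ⟨ program , input ⟩⇓⟨ memory , time ⟩
          output₁ : memory 0 ≡ v₁
          output₂ : memory 1 ≡ v₂
          time≤   : time ≤ totalTime s

      outcome : Outcome
      outcome = record
        { run     = ⇓⨾ loads (⇓⨾ (run E₁) (⇓⨾ (run E₂) (⇓⨾ (Step.run S₁) (Step.run S₂))))
        ; output₁ = trans (Step.other S₂ 0 λ ()) (Step.here S₁)
        ; output₂ = Step.here S₂
        ; time≤   = +-mono-≤ (≤-trans loading≤ (+-monoʳ-≤ (15 * unit (K + s + s)) (*-monoˡ-≤ _ (≤-trans pred[n]≤n P≤s))))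
                      (+-mono-≤ (time≤ E₁) (+-mono-≤ (time≤ E₂) (+-mono-≤ (Step.time≤ S₁) (Step.time≤ S₂))))
        }
        where
        open Loaded (load-correct input s K 1≤n (s≤s z≤n) input-≤ input-beyond (K + s + s) (m≤n+m s (K + s)) (+-mono-≤ D≤K+s N≤s))
          renaming (base to base≡; input to input≡)
        open Correctness input s K base input-≤ range≤ (≤-trans D≤K+s (n≤2^n (K + s))) (≤-trans (m≤m+n K P) (m≤n+m (K + P) 2))
        open Exec
        ρ≤ : ∀ x → base ≤ 2 ^ (K + s)
        ρ≤ _ = ≤-trans D≤K+s (n≤2^n (K + s))
        -- The expressions are closed, so any environment will do; every variable is sent to
        -- register 0, whose content is `base`.
        R₁ : Ready memory (λ _ → 0) (λ _ → base) 1
        R₁ = record { base = base≡ ; input = input≡ ; 0<t = s≤s z≤n ; env = λ _ → base≡ , s≤s z≤n }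
        E₁ = correct e₁ {v = K + s} R₁ ρ≤ (≤-trans (s≤s (m≤m+n (height e₁) (height e₂))) (n≤1+n _))
        E₂ = correct e₂ {v = K + s} (ready-keep {M′ = M′ E₁} R₁ (n≤1+n 1) (low E₁) (high E₁)) ρ≤ (+-monoʳ-≤ 2 (m≤n+m (height e₂) (height e₁)))
        M₂ = M′ E₂
        B = outBits s
        v₁≤ : v₁ ≤ 2 ^ B
        v₁≤ = ≤2^-mono (eval-≤ e₁ {v = K + s} ρ≤) (≤-trans (m≤m+n _ (vbits e₂ (K + s) s)) (m≤n+m _ K))
        v₂≤ : v₂ ≤ 2 ^ B
        v₂≤ = ≤2^-mono (eval-≤ e₂ {v = K + s} ρ≤) (≤-trans (m≤n+m _ (vbits e₁ (K + s) s)) (m≤n+m _ K))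
        tiny : ∀ {i} → i ≤ 2 → i ≤ 2 ^ B
        tiny h = ≤2^ (≤-trans h (≤-trans (m≤m+n 2 _) (m≤m+n K _)))
        M₂1≡ : M₂ 1 ≡ v₁
        M₂1≡ = trans (low E₂ 1 (s≤s (s≤s z≤n))) (here E₁)
        S₁ = copy M₂ B (dirW 0 z≤n) (dirR 1 (tiny (s≤s z≤n)) M₂1≡ v₁≤)
        S₂ = copy (Step.M′ S₁) B (dirW 1 (tiny (s≤s z≤n))) (dirR 2 (tiny ≤-refl) (trans (Step.other S₁ 2 λ ()) (here E₂)) v₂≤)

-- Bounded sums, products, maxima and histories over natural numbers.

module Ranges where

  open import Defs using (div; ⟦_⟧ᵇ)
  open Machine using (iter; init; step; sum; prod; max; hist; m+[n∸m]≡m⊔n)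
  open import Data.Nat.Base
  open import Data.Nat.Properties
  open import Algebra.Properties.CommutativeSemigroup +-commutativeSemigroup using (interchange)
  open import Data.Nat.DivMod using (m*n/n≡m; m<n⇒m/n≡0; m/n*n≡m; m/n/o≡m/[n*o]; +-distrib-/-∣ˡ)
  open import Data.Nat.Divisibility using (_∣_; ∣-refl; ∣n⇒∣m*n; ∣m⇒∣m*n; divides)
  open import Data.Product.Base using (∃-syntax; _×_; _,_)
  open import Data.Sum.Base using (_⊎_; inj₁; inj₂)
  open import Relation.Binary.PropositionalEquality
  open import Relation.Nullary using (contradiction)

  -- Built from the same `iter` and `step` as `eval`, so that they are definitionally the values of
  -- the corresponding loops.
  ∑ ∏ Max : ℕ → (ℕ → ℕ) → ℕ
  ∑ k f   = iter (λ i a → step sum a (f i)) (init sum) k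
  ∏ k f   = iter (λ i a → step prod a (f i)) (init prod) k
  Max k f = iter (λ i a → step max a (f i)) (init max) k

  Hist : ℕ → (ℕ → ℕ → ℕ) → ℕ
  Hist k f = iter (λ i a → step hist a (f i a)) (init hist) k

  nz : ℕ → ℕ
  nz a = 1 ∸ (1 ∸ a)

  lt le : ℕ → ℕ → ℕ
  lt a b = nz (b ∸ a)
  le a b = 1 ∸ (a ∸ b)

  nz-≤1 : ∀ a → nz a ≤ 1
  nz-≤1 a = m∸n≤m 1 (1 ∸ a)

  nz-pos : ∀ {a} → 0 < a → nz a ≡ 1
  nz-pos {suc a} _ = cong (1 ∸_) (0∸n≡0 a)

  nz-pos⁻¹ : ∀ {a} → nz a ≡ 1 → 0 < a
  nz-pos⁻¹ {suc a} _ = s≤s z≤n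

  nz-bit : ∀ {a} → a ≤ 1 → nz a ≡ a
  nz-bit z≤n       = refl
  nz-bit (s≤s z≤n) = refl

  bit-cases : ∀ {a} → a ≤ 1 → a ≡ 0 ⊎ a ≡ 1
  bit-cases z≤n       = inj₁ refl
  bit-cases (s≤s z≤n) = inj₂ refl

  *-bit : ∀ {a b} → a ≤ 1 → b ≤ 1 → a * b ≤ 1
  *-bit ha hb = *-mono-≤ ha hb

  *-bit≡1 : ∀ {a b} → a ≤ 1 → b ≤ 1 → a * b ≡ 1 → a ≡ 1 × b ≡ 1
  *-bit≡1 (s≤s z≤n) (s≤s z≤n) e = refl , refl

  1∸bit : ∀ {a} → 1 ∸ a ≡ 1 → a ≡ 0
  1∸bit {zero} _ = refl
  1∸bit {suc a} e = contradiction (trans (sym (0∸n≡0 a)) e) λ ()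

  lt-≤1 : ∀ a b → lt a b ≤ 1
  lt-≤1 a b = nz-≤1 (b ∸ a)

  lt-true : ∀ {a b} → a < b → lt a b ≡ 1
  lt-true a<b = nz-pos (m<n⇒0<n∸m a<b)

  lt-false : ∀ {a b} → b ≤ a → lt a b ≡ 0
  lt-false b≤a = cong nz (m≤n⇒m∸n≡0 b≤a)

  lt⇒< : ∀ {a b} → lt a b ≡ 1 → a < b
  lt⇒< {a} {b} e = ≰⇒> λ b≤a → contradiction (trans (sym (lt-false b≤a)) e) λ ()

  lt≡0⇒≥ : ∀ {a b} → lt a b ≡ 0 → b ≤ a
  lt≡0⇒≥ {a} {b} e = ≮⇒≥ λ a<b → contradiction (trans (sym (lt-true a<b)) e) λ ()

  le-true : ∀ {a b} → a ≤ b → le a b ≡ 1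
  le-true a≤b = cong (1 ∸_) (m≤n⇒m∸n≡0 a≤b)

  le-≤1 : ∀ a b → le a b ≤ 1
  le-≤1 a b = m∸n≤m 1 (a ∸ b)

  le⇒≤ : ∀ {a b} → le a b ≡ 1 → a ≤ b
  le⇒≤ e = m∸n≡0⇒m≤n (1∸bit e)

  le≡0⇒> : ∀ {a b} → le a b ≡ 0 → b < a
  le≡0⇒> e = ≰⇒> λ a≤b → contradiction (trans (sym (le-true a≤b)) e) λ ()

  ∑-cong : ∀ k {f g} → (∀ i → i < k → f i ≡ g i) → ∑ k f ≡ ∑ k g
  ∑-cong zero    h = refl
  ∑-cong (suc k) h = cong₂ _+_ (∑-cong k λ i i<k → h i (m<n⇒m<1+n i<k)) (h k ≤-refl)

  ∑-mono : ∀ k {f g} → (∀ i → i < k → f i ≤ g i) → ∑ k f ≤ ∑ k g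
  ∑-mono zero    h = z≤n
  ∑-mono (suc k) h = +-mono-≤ (∑-mono k λ i i<k → h i (m<n⇒m<1+n i<k)) (h k ≤-refl)

  ∑-≤ : ∀ k {f} c → (∀ i → i < k → f i ≤ c) → ∑ k f ≤ k * c
  ∑-≤ zero    c h = z≤n
  ∑-≤ (suc k) c h = ≤-trans (+-mono-≤ (∑-≤ k c λ i i<k → h i (m<n⇒m<1+n i<k)) (h k ≤-refl)) (≤-reflexive (+-comm (k * c) c))

  ∑-0 : ∀ k {f} → (∀ i → i < k → f i ≡ 0) → ∑ k f ≡ 0
  ∑-0 zero    h = refl
  ∑-0 (suc k) h = cong₂ _+_ (∑-0 k λ i i<k → h i (m<n⇒m<1+n i<k)) (h k ≤-refl)

  ∑-+ : ∀ k f g → ∑ k (λ i → f i + g i) ≡ ∑ k f + ∑ k g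
  ∑-+ zero    f g = refl
  ∑-+ (suc k) f g = trans (cong (_+ (f k + g k)) (∑-+ k f g)) (interchange (∑ k f) (∑ k g) (f k) (g k))

  ∑-*ˡ : ∀ k c f → ∑ k (λ i → c * f i) ≡ c * ∑ k f
  ∑-*ˡ zero    c f = sym (*-zeroʳ c)
  ∑-*ˡ (suc k) c f = trans (cong (_+ c * f k) (∑-*ˡ k c f)) (sym (*-distribˡ-+ c (∑ k f) (f k)))

  ∑-*ʳ : ∀ k c f → ∑ k (λ i → f i * c) ≡ ∑ k f * c
  ∑-*ʳ k c f = trans (∑-cong k λ i _ → *-comm (f i) c) (trans (∑-*ˡ k c f) (*-comm c (∑ k f)))

  ∑-≥ : ∀ k f {i} → i < k → f i ≤ ∑ k f
  ∑-≥ (suc k) f i<1+k with m<1+n⇒m<n∨m≡n i<1+k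
  ... | inj₁ i<k  = ≤-trans (∑-≥ k f i<k) (m≤m+n (∑ k f) (f k))
  ... | inj₂ refl = m≤n+m (f k) (∑ k f)

  ∑-pos : ∀ k f → 0 < ∑ k f → ∃[ i ] i < k × 0 < f i
  ∑-pos (suc k) f h with f k in eq
  ... | suc v = k , ≤-refl , ≤-trans (s≤s z≤n) (≤-reflexive (sym eq))
  ... | zero with ∑-pos k f (≤-trans h (≤-reflexive (+-identityʳ (∑ k f))))
  ...   | i , i<k , p = i , m<n⇒m<1+n i<k , p

  ∑-at : ∀ k f {i} → i < k → (∀ j → j < k → j ≢ i → f j ≡ 0) → ∑ k f ≡ f i
  ∑-at (suc k) f {i} i<1+k h with m<1+n⇒m<n∨m≡n i<1+k
  ... | inj₁ i<k  = trans (cong₂ _+_ (∑-at k f i<k λ j j<k → h j (m<n⇒m<1+n j<k)) (h k ≤-refl λ e → <⇒≢ i<k (sym e))) (+-identityʳ (f i))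
  ... | inj₂ refl = cong (_+ f k) (∑-0 k λ j j<k → h j (m<n⇒m<1+n j<k) (<⇒≢ j<k))

  ∏-pos : ∀ k {f} → (∀ i → 0 < f i) → 0 < ∏ k f
  ∏-pos zero    h = s≤s z≤n
  ∏-pos (suc k) h = *-mono-≤ (∏-pos k h) (h k)

  ∏-pos′ : ∀ k {f} → (∀ i → i < k → 0 < f i) → 0 < ∏ k f
  ∏-pos′ zero    h = s≤s z≤n
  ∏-pos′ (suc k) h = *-mono-≤ (∏-pos′ k λ i i<k → h i (m<n⇒m<1+n i<k)) (h k ≤-refl)

  ∏-∣ : ∀ k f {i} → i < k → f i ∣ ∏ k f
  ∏-∣ (suc k) f i<1+k with m<1+n⇒m<n∨m≡n i<1+k
  ... | inj₁ i<k  = ∣m⇒∣m*n (f k) (∏-∣ k f i<k)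
  ... | inj₂ refl = ∣n⇒∣m*n (∏ k f) ∣-refl

  div-exact : ∀ {a b} → 0 < b → b ∣ a → ⟦ div ⟧ᵇ a b * b ≡ a
  div-exact {a} {suc b} _ b∣a = m/n*n≡m b∣a

  step-max : ∀ a v → step max a v ≡ a ⊔ v
  step-max = m+[n∸m]≡m⊔n

  Max-≥ : ∀ k f {i} → i < k → f i ≤ Max k f
  Max-≥ (suc k) f i<1+k with m<1+n⇒m<n∨m≡n i<1+k
  ... | inj₁ i<k  = ≤-trans (Max-≥ k f i<k) (≤-trans (m≤m⊔n (Max k f) (f k)) (≤-reflexive (sym (step-max (Max k f) (f k)))))
  ... | inj₂ refl = ≤-trans (m≤n⊔m (Max k f) (f k)) (≤-reflexive (sym (step-max (Max k f) (f k))))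

  Max-attained : ∀ k f → Max k f ≡ 0 ⊎ ∃[ i ] i < k × Max k f ≡ f i
  Max-attained zero    f = inj₁ refl
  Max-attained (suc k) f with ⊔-sel (Max k f) (f k)
  ... | inj₂ e = inj₂ (k , ≤-refl , trans (step-max (Max k f) (f k)) e)
  ... | inj₁ e with Max-attained k f
  ...   | inj₁ z = inj₁ (trans (step-max (Max k f) (f k)) (trans e z))
  ...   | inj₂ (i , i<k , p) = inj₂ (i , m<n⇒m<1+n i<k , trans (step-max (Max k f) (f k)) (trans e p))

  -- The language has no powers and no loops of length `k`, so `2 ^ k` is formed from `n` factors of
  -- which the first `k` are 2. It is correct for `k ≤ n`.
  pow2 : ℕ → ℕ → ℕ
  pow2 n k = ∏ n (λ l → 1 + lt l k)

  ∏-ones : ∀ n {f} → (∀ l → l < n → f l ≡ 1) → ∏ n f ≡ 1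
  ∏-ones zero    h = refl
  ∏-ones (suc n) h = cong₂ _*_ (∏-ones n λ l l<n → h l (m<n⇒m<1+n l<n)) (h n ≤-refl)

  pow2≡2^ : ∀ n {k} → k ≤ n → pow2 n k ≡ 2 ^ k
  pow2≡2^ zero    z≤n = refl
  pow2≡2^ (suc n) {k} k≤1+n with m≤n⇒m<n∨m≡n k≤1+n
  ... | inj₁ (s≤s k≤n) = trans (cong₂ _*_ (pow2≡2^ n k≤n) (cong suc (lt-false k≤n))) (*-identityʳ (2 ^ k))
  ... | inj₂ refl      = trans (cong₂ _*_ (full n (n≤1+n n)) (cong suc (lt-true (n<1+n n)))) (*-comm (2 ^ n) 2)
    where
    full : ∀ j → j ≤ suc n → ∏ j (λ l → 1 + lt l (suc n)) ≡ 2 ^ j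
    full zero    _ = refl
    full (suc j) h = trans (cong₂ _*_ (full j (<⇒≤ h)) (cong suc (lt-true h))) (*-comm (2 ^ j) 2)

  -- A history is the binary number whose digits are the decisions so far, the
  -- latest one last.
  digit : ℕ → ℕ → ℕ → ℕ
  digit n H k = ⟦ div ⟧ᵇ H (pow2 n k) ∸ 2 * ⟦ div ⟧ᵇ (⟦ div ⟧ᵇ H (pow2 n k)) 2

  Hist-step-/2 : ∀ a v → (step hist a v) / 2 ≡ a
  Hist-step-/2 a v = begin
    (a + a + nz v) / 2   ≡⟨ cong (λ z → (z + nz v) / 2) (trans (cong (a +_) (sym (+-identityʳ a))) (*-comm 2 a)) ⟩
    (a * 2 + nz v) / 2   ≡⟨ +-distrib-/-∣ˡ (nz v) (divides a refl) ⟩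
    a * 2 / 2 + nz v / 2 ≡⟨ cong₂ _+_ (m*n/n≡m a 2) (m<n⇒m/n≡0 (s≤s (nz-≤1 v))) ⟩
    a + 0                ≡⟨ +-identityʳ a ⟩
    a                    ∎
    where open ≡-Reasoning

  div-2^ : ∀ a k → ⟦ div ⟧ᵇ a (2 ^ suc k) ≡ ⟦ div ⟧ᵇ (a / 2) (2 ^ k)
  div-2^ a k with 2 ^ k | m^n>0 2 k
  ... | suc p | _ = sym (m/n/o≡m/[n*o] a 2 (suc p))

  -- Each round appends one binary digit, so dropping the last `k` digits restores the history of
  -- `k` rounds earlier.
  Hist-shift : ∀ f i k → ⟦ div ⟧ᵇ (Hist (k + i) f) (2 ^ k) ≡ Hist i f
  Hist-shift f i zero    = trans (cong (_/ 1) (sym (*-identityʳ (Hist i f)))) (m*n/n≡m (Hist i f) 1)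
  Hist-shift f i (suc k) = trans (div-2^ (Hist (suc k + i) f) k)
    (trans (cong (λ z → ⟦ div ⟧ᵇ z (2 ^ k)) (Hist-step-/2 (Hist (k + i) f) (f (k + i) (Hist (k + i) f)))) (Hist-shift f i k))

  -- The right side does not mention `i`: a decision once taken can be read from every later
  -- history, with the same result.
  Hist-digit : ∀ f n {i} → i ≤ n → ∀ {k} → k < i → digit n (Hist i f) (i ∸ suc k) ≡ nz (f k (Hist k f))
  Hist-digit f n {i} i≤n {k} k<i = trans (cong (λ x → x ∸ 2 * ⟦ div ⟧ᵇ x 2) shifted) last
    where
    r = i ∸ suc k
    shifted : ⟦ div ⟧ᵇ (Hist i f) (pow2 n r) ≡ Hist (suc k) f
    shifted = trans (cong (⟦ div ⟧ᵇ (Hist i f)) (pow2≡2^ n (≤-trans (m∸n≤m i (suc k)) i≤n)))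
      (trans (cong (λ z → ⟦ div ⟧ᵇ (Hist z f) (2 ^ r)) (sym (m∸n+n≡m k<i))) (Hist-shift f (suc k) r))
    a = Hist k f
    v = f k a
    last : step hist a v ∸ 2 * (step hist a v / 2) ≡ nz v
    last = trans (cong (λ z → step hist a v ∸ 2 * z) (Hist-step-/2 a v))
      (trans (cong (λ z → a + a + nz v ∸ (a + z)) (+-identityʳ a)) (m+n∸m≡n (a + a) (nz v)))

-- Integer approximants of the partial function and their ratios.

module Greedy where

  open Ranges
  open import Data.List.Base using (List; []; _∷_; _++_; map)
  open import Data.List.Membership.Propositional using (_∈_)
  open import Data.List.Membership.Propositional.Properties using (∈-++⁺ˡ; ∈-++⁺ʳ)
  open import Data.List.Properties using (map-++)
  open import Data.List.Relation.Unary.All as All using (All; []; _∷_)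
  import Data.List.Relation.Unary.All.Properties as All
  open import Data.List.Relation.Unary.Any using (here)
  open import Data.Nat.Base
  open import Data.Nat.ListAction using (sum)
  open import Data.Nat.ListAction.Properties using (sum-++)
  open import Data.Nat.Properties
  open import Data.Nat.Solver using (module +-*-Solver)
  open import Data.Product.Base using (∃-syntax; _×_; _,_; proj₁; proj₂)
  open import Data.Sum.Base using (_⊎_; inj₁; inj₂)
  open import Relation.Binary.PropositionalEquality
  open import Relation.Nullary using (contradiction)

  -- m elements, n sets given by their 0/1 rows t i, and a value F i for set i

  module Minima (m n : ℕ) (t : ℕ → ℕ → ℕ) (F : ℕ → ℕ) where

    W : ℕ
    W = ∑ n F

    -- h j is the least F i over the sets i containing j; the maximum makes the
    -- empty minimum W
    h : ℕ → ℕ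
    h j = W ∸ Max n (λ i → t i j * (W ∸ F i))

    minOver : (ℕ → ℕ) → ℕ
    minOver χ = W ∸ Max n (λ i → χ i * (W ∸ F i))

    minOver-≤ : ∀ χ {i} → i < n → χ i ≡ 1 → minOver χ ≤ F i
    minOver-≤ χ {i} i<n χi≡1 = begin
      W ∸ Max n (λ i → χ i * (W ∸ F i))  ≤⟨ ∸-monoʳ-≤ W (≤-trans (≤-reflexive (sym (trans (cong (_* (W ∸ F i)) χi≡1) (*-identityˡ _)))) (Max-≥ n (λ i → χ i * (W ∸ F i)) i<n)) ⟩
      W ∸ (W ∸ F i)                      ≡⟨ m∸[m∸n]≡n (∑-≥ n F i<n) ⟩
      F i                                ∎
      where open ≤-Reasoning

    -- The maximum may be 0 or be taken at a set outside `χ`. In both cases `minOver χ = W`, and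
    -- then `minOver χ ≤ F i ≤ W` makes the given `i` a minimizer.
    minOver-attained : ∀ χ → (∀ i → i < n → χ i ≤ 1) → ∀ {i} → i < n → χ i ≡ 1 → ∃[ k ] k < n × χ k ≡ 1 × minOver χ ≡ F k
    minOver-attained χ χ≤1 {i} i<n χi≡1 with Max-attained n (λ i → χ i * (W ∸ F i))
    ... | inj₁ z = i , i<n , χi≡1 , ≤-antisym (minOver-≤ χ i<n χi≡1)
                     (≤-trans (∑-≥ n F i<n) (≤-reflexive (sym (cong (W ∸_) z))))
    ... | inj₂ (k , k<n , e) with bit-cases (χ≤1 k k<n)
    ...   | inj₂ χk≡1 = k , k<n , χk≡1 , trans (cong (W ∸_) (trans e (trans (cong (_* (W ∸ F k)) χk≡1) (*-identityˡ _)))) (m∸[m∸n]≡n (∑-≥ n F k<n))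
    ...   | inj₁ χk≡0 = i , i<n , χi≡1 , ≤-antisym (minOver-≤ χ i<n χi≡1)
                     (≤-trans (∑-≥ n F i<n) (≤-reflexive (sym (cong (W ∸_) (trans e (cong (_* (W ∸ F k)) χk≡0))))))

    h-≤ : ∀ {i j} → i < n → t i j ≡ 1 → h j ≤ F i
    h-≤ {j = j} = minOver-≤ (λ i → t i j)

    record Covers (P : ℕ → Set) (a : ℕ) : Set where
      field
        sets   : List ℕ
        sets<n : All (_< n) sets
        cost   : sum (map F sets) ≤ a
        covers : ∀ j → j < m → P j → ∃[ i ] i ∈ sets × t i j ≡ 1
    open Covers

    covers-none : ∀ {P a} → (∀ j → j < m → P j → 0 ≡ 1) → Covers P a
    covers-none ¬P = record { sets = [] ; sets<n = [] ; cost = z≤n ; covers = λ j j<m p → contradiction (¬P j j<m p) λ () }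

    covers-set : ∀ {P a} i → i < n → F i ≤ a → (∀ j → j < m → P j → t i j ≡ 1) → Covers P a
    covers-set i i<n Fi≤a P⊆ = record
      { sets = i ∷ [] ; sets<n = i<n ∷ [] ; cost = ≤-trans (≤-reflexive (+-identityʳ (F i))) Fi≤a
      ; covers = λ j j<m p → i , here refl , P⊆ j j<m p }

    covers-∪ : ∀ {P Q a b} → Covers P a → Covers Q b → Covers (λ j → P j ⊎ Q j) (a + b)
    covers-∪ C D = record
      { sets   = sets C ++ sets D
      ; sets<n = All.++⁺ (sets<n C) (sets<n D)
      ; cost   = ≤-trans (≤-reflexive (trans (cong sum (map-++ F (sets C) (sets D))) (sum-++ (map F (sets C)) (map F (sets D)))))
                   (+-mono-≤ (cost C) (cost D))
      ; covers = λ { j j<m (inj₁ p) → let (i , i∈ , e) = covers C j j<m p in i , ∈-++⁺ˡ i∈ , e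
                   ; j j<m (inj₂ q) → let (i , i∈ , e) = covers D j j<m q in i , ∈-++⁺ʳ (sets C) i∈ , e }
      }

    covers-⊆ : ∀ {P Q a b} → Covers Q a → a ≤ b → (∀ j → j < m → P j → Q j) → Covers P b
    covers-⊆ C a≤b P⊆Q = record
      { sets = sets C ; sets<n = sets<n C ; cost = ≤-trans (cost C) a≤b ; covers = λ j j<m p → covers C j j<m (P⊆Q j j<m p) }

    covers-∑ : ∀ {P : ℕ → ℕ → Set} {f} k → (∀ l → l < k → Covers (P l) (f l)) → Covers (λ j → ∃[ l ] l < k × P l j) (∑ k f)
    covers-∑ zero    C = covers-none λ { j j<m (l , () , p) }
    covers-∑ {P} (suc k) C = covers-⊆ (covers-∪ (covers-∑ k λ l l<k → C l (m<n⇒m<1+n l<k)) (C k ≤-refl)) ≤-refl split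
      where
      split : ∀ j → j < m → (∃[ l ] l < suc k × P l j) → (∃[ l ] l < k × P l j) ⊎ P k j
      split j j<m (l , l<1+k , p) with m<1+n⇒m<n∨m≡n l<1+k
      ... | inj₁ l<k  = inj₁ (l , l<k , p)
      ... | inj₂ refl = inj₂ p

    -- The coverage function of a finite universe, evaluated at the set with indicator `row`. An
    -- element is a weight together with the function that is positive at those `j` for which `A j`
    -- contains it.
    weightHit : List (ℕ × (ℕ → ℕ)) → (ℕ → ℕ) → ℕ
    weightHit []             row = 0
    weightHit ((w , χ) ∷ us) row = w * nz (∑ m λ j → row j * χ j) + weightHit us row

    weightHit-++ : ∀ us vs row → weightHit (us ++ vs) row ≡ weightHit us row + weightHit vs row
    weightHit-++ []             vs row = refl
    weightHit-++ ((w , χ) ∷ us) vs row = trans (cong (w * nz (∑ m λ j → row j * χ j) +_) (weightHit-++ us vs row))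
      (sym (+-assoc (w * nz (∑ m λ j → row j * χ j)) (weightHit us row) (weightHit vs row)))

    family : ℕ → (ℕ → ℕ) → (ℕ → ℕ → ℕ) → List (ℕ × (ℕ → ℕ))
    family zero    w χ = []
    family (suc k) w χ = (w k , χ k) ∷ family k w χ

    weightHit-family : ∀ k w χ row → weightHit (family k w χ) row ≡ ∑ k (λ u → w u * nz (∑ m λ j → row j * χ u j))
    weightHit-family zero    w χ row = refl
    weightHit-family (suc k) w χ row = trans (+-comm _ (weightHit (family k w χ) row)) (cong (_+ _) (weightHit-family k w χ row))

    record Approximant (g : ℕ → ℕ) (R : ℕ) : Set where
      field
        universe : List (ℕ × (ℕ → ℕ))
        realizes : ∀ i → i < n → g i ≡ weightHit universe (t i)
        lower    : ∀ i → i < n → Covers (λ j → t i j ≡ 1) (g i)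
        upper    : ∀ i → i < n → g i ≤ R * F i

  -- The greedy pass, with the additive function as the case without blocks.

  module Blocks (m n : ℕ) (t : ℕ → ℕ → ℕ) (F : ℕ → ℕ) (τ X : ℕ) where
    open Minima m n t F

    -- j belongs to set i, and its minimum is at least F i / X
    close : ℕ → ℕ → ℕ
    close i j = t i j * le (F i) (X * h j)

    -- whether set i becomes a block, given as H the decisions on the sets before it
    fire : ℕ → ℕ → ℕ
    fire i H = lt τ (∑ m λ j → close i j * (1 ∸ ∑ n λ k → lt k i * digit n H (i ∸ suc k) * close k j))

    fired : ℕ → ℕ
    fired i = digit n (Hist n fire) (n ∸ suc i)

    single : ℕ → ℕ
    single j = 1 ∸ ∑ n λ k → fired k * close k j

    value : ℕ → ℕ
    value i = ∑ m (λ j → t i j * single j * h j) + ∑ n (λ k → fired k * nz (∑ m λ j → t i j * close k j) * F k)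

    module _ (t≤1 : ∀ i j → i < n → j < m → t i j ≤ 1) where

      fired-≤1 : ∀ k → k < n → fired k ≤ 1
      fired-≤1 k k<n = ≤-trans (≤-reflexive (Hist-digit fire n ≤-refl k<n)) (nz-≤1 (fire k (Hist k fire)))

      new : ℕ → ℕ → ℕ
      new i j = close i j * (1 ∸ ∑ n λ k → lt k i * fired k * close k j)

      -- Eliminates the histories. The decisions that round `i` reads from its own history are those
      -- read from the final one, so from here on `fired` is an ordinary 0/1 function obeying the
      -- greedy rule.
      fired≡ : ∀ i → i < n → fired i ≡ lt τ (∑ m (new i))
      fired≡ i i<n = begin
        fired i
          ≡⟨ Hist-digit fire n ≤-refl i<n ⟩
        nz (fire i (Hist i fire))
          ≡⟨ nz-bit (lt-≤1 τ (∑ m λ j → close i j * (1 ∸ ∑ n λ k → lt k i * digit n (Hist i fire) (i ∸ suc k) * close k j))) ⟩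
        fire i (Hist i fire)
          ≡⟨ cong (lt τ) (∑-cong m λ j _ → cong (λ z → close i j * (1 ∸ z)) (∑-cong n λ k k<n → cong (_* close k j) (same k k<n))) ⟩
        lt τ (∑ m (new i)) ∎
        where
        open ≡-Reasoning
        same : ∀ k → k < n → lt k i * digit n (Hist i fire) (i ∸ suc k) ≡ lt k i * fired k
        same k k<n with bit-cases (nz-≤1 (i ∸ k))
        ... | inj₁ e = trans (cong (_* digit n (Hist i fire) (i ∸ suc k)) e) (sym (cong (_* fired k) e))
        ... | inj₂ e = cong (lt k i *_) (trans (Hist-digit fire n (<⇒≤ i<n) (lt⇒< e)) (sym (Hist-digit fire n ≤-refl k<n)))

      close-≤1 : ∀ i j → i < n → j < m → close i j ≤ 1
      close-≤1 i j i<n j<m = *-bit (t≤1 i j i<n j<m) (le-≤1 (F i) (X * h j))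

      close⇒ : ∀ i j → i < n → j < m → close i j ≡ 1 → t i j ≡ 1 × F i ≤ X * h j
      close⇒ i j i<n j<m e = let (p , q) = *-bit≡1 (t≤1 i j i<n j<m) (le-≤1 (F i) (X * h j)) e in p , le⇒≤ q

      single-≤1 : ∀ j → single j ≤ 1
      single-≤1 j = m∸n≤m 1 (∑ n λ k → fired k * close k j)

      -- Every element of set `i` is single or lies in a fired block. A single `l` is covered by a
      -- cheapest set containing it, at cost `h l`; block `k` lies inside set `k`, whose value is
      -- its weight.
      cover-lower : ∀ i → i < n → Covers (λ j → t i j ≡ 1) (value i)
      cover-lower i i<n = covers-⊆ (covers-∪ (covers-∑ m one) (covers-∑ n blk)) ≤-refl split
        where
        One : ℕ → ℕ → Set
        One l j = j ≡ l × t i l * single l ≡ 1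
        Blk : ℕ → ℕ → Set
        Blk k j = t i j ≡ 1 × fired k ≡ 1 × close k j ≡ 1
        one : ∀ l → l < m → Covers (One l) (t i l * single l * h l)
        one l l<m with bit-cases (*-bit (t≤1 i l i<n l<m) (single-≤1 l))
        ... | inj₁ e = covers-none λ j _ (_ , e′) → trans (sym e) e′
        ... | inj₂ e =
          let (k , k<n , tkl , h≡) = minOver-attained (λ i → t i l) (λ i i<n → t≤1 i l i<n l<m) i<n (proj₁ (*-bit≡1 (t≤1 i l i<n l<m) (single-≤1 l) e))
          in covers-set k k<n (≤-reflexive (sym (trans (cong (_* h l) e) (trans (*-identityˡ (h l)) h≡)))) λ { j _ (refl , _) → tkl }
        blk : ∀ k → k < n → Covers (Blk k) (fired k * nz (∑ m λ j → t i j * close k j) * F k)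
        blk k k<n with bit-cases (*-bit (fired-≤1 k k<n) (nz-≤1 (∑ m λ j → t i j * close k j)))
        ... | inj₂ e = covers-set k k<n (≤-reflexive (sym (trans (cong (_* F k) e) (*-identityˡ (F k)))))
                         λ j j<m (_ , _ , c) → proj₁ (close⇒ k j k<n j<m c)
        ... | inj₁ e = covers-none λ j j<m (p , f , c) → trans (sym e)
            (cong₂ _*_ f (nz-pos (≤-trans (≤-reflexive (sym (cong₂ _*_ p c))) (∑-≥ m (λ j → t i j * close k j) j<m))))
        split : ∀ j → j < m → t i j ≡ 1 → (∃[ l ] l < m × One l j) ⊎ (∃[ k ] k < n × Blk k j)
        split j j<m p with ∑ n (λ k → fired k * close k j) in eq
        ... | zero  = inj₁ (j , j<m , refl , cong₂ _*_ p (cong (1 ∸_) eq))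
        ... | suc _ with ∑-pos n (λ k → fired k * close k j) (≤-trans (s≤s z≤n) (≤-reflexive (sym eq)))
        ...   | k , k<n , pos with bit-cases (*-bit (fired-≤1 k k<n) (close-≤1 k j k<n j<m))
        ...     | inj₁ e = contradiction (≤-trans pos (≤-reflexive e)) λ ()
        ...     | inj₂ e = let (f , c) = *-bit≡1 (fired-≤1 k k<n) (close-≤1 k j k<n j<m) e in inj₂ (k , k<n , p , f , c)

      -- One universe element per index and one per set, with weight 0 where the index is not single
      -- or the set did not fire. `(j ∸ l) + (l ∸ j)` is the distance of `j` and `l`, so the first
      -- family carries Kronecker deltas.
      blockFamily : List (ℕ × (ℕ → ℕ))
      blockFamily = family m (λ l → single l * h l) (λ l j → 1 ∸ ((j ∸ l) + (l ∸ j))) ++ family n (λ k → fired k * F k) close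

      realize : ∀ i → i < n → value i ≡ weightHit blockFamily (t i)
      realize i i<n = sym (begin
        weightHit (family m w₁ χ₁ ++ family n w₂ close) (t i)
          ≡⟨ trans (weightHit-++ (family m w₁ χ₁) (family n w₂ close) (t i)) (cong₂ _+_ (weightHit-family m w₁ χ₁ (t i)) (weightHit-family n w₂ close (t i))) ⟩
        ∑ m (λ l → w₁ l * nz (∑ m λ j → t i j * χ₁ l j)) + ∑ n (λ k → w₂ k * nz (∑ m λ j → t i j * close k j))
          ≡⟨ cong₂ _+_ (∑-cong m first) (∑-cong n λ k _ → solve 3 (λ a b c → a :* b :* c := a :* c :* b) refl (fired k) (F k) (nz (∑ m λ j → t i j * close k j))) ⟩
        value i ∎)
        where
        open ≡-Reasoning
        open +-*-Solver using (solve; con; _:+_; _:*_; _:=_)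
        w₁ : ℕ → ℕ
        w₁ l = single l * h l
        χ₁ : ℕ → ℕ → ℕ
        χ₁ l j = 1 ∸ ((j ∸ l) + (l ∸ j))
        w₂ : ℕ → ℕ
        w₂ k = fired k * F k
        diagonal : ∀ l → χ₁ l l ≡ 1
        diagonal l = cong (λ z → 1 ∸ (z + z)) (n∸n≡0 l)
        off : ∀ l j → j ≢ l → χ₁ l j ≡ 0
        off l j j≢l with (j ∸ l) + (l ∸ j) in eq
        ... | suc z = 0∸n≡0 z
        ... | zero  = contradiction (≤-antisym (m∸n≡0⇒m≤n (m+n≡0⇒m≡0 (j ∸ l) eq)) (m∸n≡0⇒m≤n (m+n≡0⇒n≡0 (j ∸ l) eq))) j≢l
        first : ∀ l → l < m → w₁ l * nz (∑ m λ j → t i j * χ₁ l j) ≡ t i l * single l * h l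
        first l l<m = begin
          w₁ l * nz (∑ m λ j → t i j * χ₁ l j)
            ≡⟨ cong (λ z → w₁ l * nz z) (∑-at m _ l<m λ j _ j≢l → trans (cong (t i j *_) (off l j j≢l)) (*-zeroʳ (t i j))) ⟩
          w₁ l * nz (t i l * χ₁ l l)
            ≡⟨ cong (λ z → w₁ l * nz z) (trans (cong (t i l *_) (diagonal l)) (*-identityʳ (t i l))) ⟩
          w₁ l * nz (t i l)
            ≡⟨ cong (w₁ l *_) (nz-bit (t≤1 i l i<n l<m)) ⟩
          w₁ l * t i l
            ≡⟨ solve 3 (λ a b c → a :* b :* c := c :* a :* b) refl (single l) (h l) (t i l) ⟩
          t i l * single l * h l ∎

      row-≤ : ∀ i j → i < n → j < m → ∀ x → x ≤ 1 → t i j * x * h j ≤ t i j * F i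
      row-≤ i j i<n j<m x x≤1 with bit-cases (t≤1 i j i<n j<m)
      ... | inj₁ e = ≤-trans (≤-reflexive (cong (λ z → z * x * h j) e)) z≤n
      ... | inj₂ e = *-mono-≤ (≤-trans (*-monoʳ-≤ (t i j) x≤1) (≤-reflexive (*-identityʳ (t i j)))) (h-≤ i<n e)

      module _ (m≤τ : m ≤ τ) where

        -- Firing takes more than `τ` new elements and there are only `m` elements, so a threshold
        -- of at least `m` leaves every element single.
        fired≡0 : ∀ k → k < n → fired k ≡ 0
        fired≡0 k k<n = trans (fired≡ k k<n) (lt-false (≤-trans
          (∑-≤ m 1 λ j j<m → *-bit (close-≤1 k j k<n j<m) (m∸n≤m 1 (∑ n λ l → lt l k * fired l * close l j)))
          (≤-trans (≤-reflexive (*-identityʳ m)) m≤τ)))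

        value-≤-additive : ∀ i → i < n → value i ≤ ∑ m (t i) * F i
        value-≤-additive i i<n = begin
          value i                    ≤⟨ +-mono-≤ (∑-mono m λ j j<m → row-≤ i j i<n j<m (single j) (single-≤1 j))
                                          (≤-reflexive (∑-0 n λ k k<n → cong (λ z → z * nz (∑ m λ j → t i j * close k j) * F k) (fired≡0 k k<n))) ⟩
          ∑ m (λ j → t i j * F i) + 0  ≡⟨ trans (+-identityʳ _) (∑-*ʳ m (F i) (t i)) ⟩
          ∑ m (t i) * F i            ∎
          where open ≤-Reasoning

        additive : ∀ {d} → (∀ i → i < n → ∑ m (t i) ≤ d) → Approximant value d
        additive size≤d = record
          { universe = blockFamily
          ; realizes = realize
          ; lower    = cover-lower
          ; upper    = λ i i<n → ≤-trans (value-≤-additive i i<n) (*-monoˡ-≤ (F i) (size≤d i i<n))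
          }

      -- Every block claims more than τ new elements, so there are at most m / τ blocks.
      claimed : ℕ → ℕ → ℕ
      claimed i j = ∑ n λ k → lt k i * fired k * close k j

      -- Claimed elements stay claimed, and `new` vanishes on them; a new element of a fired set
      -- passes from unclaimed to claimed in round `i`.
      claimed-suc : ∀ i j → i < n → j < m → nz (claimed i j) + fired i * new i j ≤ nz (claimed (suc i) j)
      claimed-suc i j i<n j<m = go (claimed i j) refl
        where
        open ≤-Reasoning
        grow : claimed i j ≤ claimed (suc i) j
        grow = ∑-mono n λ k _ → *-monoˡ-≤ (close k j) (*-monoˡ-≤ (fired k) (lt-mono k))
          where
          lt-mono : ∀ k → lt k i ≤ lt k (suc i)
          lt-mono k with bit-cases (lt-≤1 k i)
          ... | inj₁ e = ≤-trans (≤-reflexive e) z≤n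
          ... | inj₂ e = ≤-trans (lt-≤1 k i) (≤-reflexive (sym (lt-true {k} {suc i} (m<n⇒m<1+n (lt⇒< {k} {i} e)))))
        own : fired i * close i j ≤ claimed (suc i) j
        own = ≤-trans (≤-reflexive (cong (_* close i j) (sym (trans (cong (_* fired i) (lt-true {i} {suc i} ≤-refl)) (*-identityˡ (fired i))))))
                (∑-≥ n (λ k → lt k (suc i) * fired k * close k j) i<n)
        go : ∀ A → claimed i j ≡ A → nz (claimed i j) + fired i * new i j ≤ nz (claimed (suc i) j)
        go (suc A) e = begin
          nz (claimed i j) + fired i * new i j
            ≡⟨ cong (λ z → nz (claimed i j) + fired i * (close i j * (1 ∸ z))) e ⟩
          nz (claimed i j) + fired i * (close i j * (0 ∸ A))
            ≡⟨ cong (λ z → nz (claimed i j) + fired i * (close i j * z)) (0∸n≡0 A) ⟩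
          nz (claimed i j) + fired i * (close i j * 0)
            ≡⟨ cong (nz (claimed i j) +_) (trans (cong (fired i *_) (*-zeroʳ (close i j))) (*-zeroʳ (fired i))) ⟩
          nz (claimed i j) + 0
            ≡⟨ +-identityʳ _ ⟩
          nz (claimed i j)
            ≤⟨ nz-≤1 (claimed i j) ⟩
          1
            ≡⟨ nz-pos (≤-trans (≤-trans (s≤s z≤n) (≤-reflexive (sym e))) grow) ⟨
          nz (claimed (suc i) j) ∎
        go zero e = begin
          nz (claimed i j) + fired i * new i j
            ≡⟨ cong (λ z → nz z + fired i * (close i j * (1 ∸ z))) e ⟩
          fired i * (close i j * 1)
            ≡⟨ cong (fired i *_) (*-identityʳ (close i j)) ⟩
          fired i * close i j
            ≤⟨ last ⟩
          nz (claimed (suc i) j) ∎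
          where
          last : fired i * close i j ≤ nz (claimed (suc i) j)
          last with bit-cases (*-bit (fired-≤1 i i<n) (close-≤1 i j i<n j<m))
          ... | inj₁ e′ = ≤-trans (≤-reflexive e′) z≤n
          ... | inj₂ e′ = ≤-reflexive (trans e′ (sym (nz-pos (≤-trans (≤-reflexive (sym e′)) own))))

      claims : ∀ i → i ≤ n → ∑ i fired * τ ≤ ∑ m (λ j → nz (claimed i j))
      claims zero    _   = z≤n
      claims (suc i) i<n = begin
        (∑ i fired + fired i) * τ
          ≡⟨ *-distribʳ-+ τ (∑ i fired) (fired i) ⟩
        ∑ i fired * τ + fired i * τ
          ≤⟨ +-mono-≤ (claims i (<⇒≤ i<n)) firing ⟩
        ∑ m (λ j → nz (claimed i j)) + fired i * ∑ m (new i)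
          ≡⟨ cong (∑ m (λ j → nz (claimed i j)) +_) (∑-*ˡ m (fired i) (new i)) ⟨
        ∑ m (λ j → nz (claimed i j)) + ∑ m (λ j → fired i * new i j)
          ≡⟨ ∑-+ m (λ j → nz (claimed i j)) (λ j → fired i * new i j) ⟨
        ∑ m (λ j → nz (claimed i j) + fired i * new i j)
          ≤⟨ ∑-mono m (λ j → claimed-suc i j i<n) ⟩
        ∑ m (λ j → nz (claimed (suc i) j)) ∎
        where
        open ≤-Reasoning
        firing : fired i * τ ≤ fired i * ∑ m (new i)
        firing with bit-cases (fired-≤1 i i<n)
        ... | inj₁ e = ≤-trans (≤-reflexive (cong (_* τ) e)) z≤n
        ... | inj₂ e = *-monoʳ-≤ (fired i) (<⇒≤ (lt⇒< (trans (sym (fired≡ i i<n)) e)))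

      blocks-≤ : ∑ n fired * τ ≤ m
      blocks-≤ = ≤-trans (claims n ≤-refl) (≤-trans (∑-≤ m 1 λ j _ → nz-≤1 (claimed n j)) (≤-reflexive (*-identityʳ m)))

      -- If set `i` meets block `k` in `j`, then `F k ≤ X * h j` as `j` is close to `k`, and
      -- `h j ≤ F i` as `j` belongs to set `i`.
      hits-≤ : ∀ i → i < n → ∑ n (λ k → fired k * nz (∑ m λ j → t i j * close k j) * F k) ≤ ∑ n fired * (X * F i)
      hits-≤ i i<n = ≤-trans (∑-mono n hit) (≤-reflexive (∑-*ʳ n (X * F i) fired))
        where
        hit : ∀ k → k < n → fired k * nz (∑ m λ j → t i j * close k j) * F k ≤ fired k * (X * F i)
        hit k k<n with bit-cases (nz-≤1 (∑ m λ j → t i j * close k j))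
        ... | inj₁ e = ≤-trans (≤-reflexive (cong (_* F k) (trans (cong (fired k *_) e) (*-zeroʳ (fired k))))) z≤n
        ... | inj₂ e with ∑-pos m _ (nz-pos⁻¹ {∑ m λ j → t i j * close k j} e)
        ...   | j , j<m , pos with bit-cases (*-bit (t≤1 i j i<n j<m) (close-≤1 k j k<n j<m))
        ...     | inj₁ z = contradiction (≤-trans pos (≤-reflexive z)) λ ()
        ...     | inj₂ o =
          let (p , c) = *-bit≡1 (t≤1 i j i<n j<m) (close-≤1 k j k<n j<m) o
          in *-mono-≤ (≤-reflexive (trans (cong (fired k *_) e) (*-identityʳ (fired k))))
               (≤-trans (proj₂ (close⇒ k j k<n j<m c)) (*-monoʳ-≤ X (h-≤ i<n p)))

      -- A fired set turns all its close elements into block elements, so none of them is single. A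
      -- set that did not fire had at most `τ` new elements, and its close singles are among these.
      near-singles-≤ : ∀ i → i < n → ∑ m (λ j → close i j * single j) ≤ τ
      near-singles-≤ i i<n with bit-cases (fired-≤1 i i<n)
      ... | inj₁ e = ≤-trans (∑-mono m λ j _ → *-monoʳ-≤ (close i j) (∸-monoʳ-≤ 1 (∑-mono n λ k _ → *-monoˡ-≤ (close k j)
                       (≤-trans (*-monoˡ-≤ (fired k) (lt-≤1 k i)) (≤-reflexive (*-identityˡ (fired k)))))))
                       (lt≡0⇒≥ (trans (sym (fired≡ i i<n)) e))
      ... | inj₂ e = ≤-trans (≤-reflexive (∑-0 m covered)) z≤n
        where
        covered : ∀ j → j < m → close i j * single j ≡ 0
        covered j j<m with bit-cases (close-≤1 i j i<n j<m)
        ... | inj₁ z = cong (_* single j) z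
        ... | inj₂ o = trans (cong (close i j *_) (m≤n⇒m∸n≡0 (≤-trans (≤-reflexive (sym (cong₂ _*_ e o)))
                         (∑-≥ n (λ k → fired k * close k j) i<n)))) (*-zeroʳ (close i j))

      -- Close singles number at most `τ` and have `h j ≤ F i`; each of the others has
      -- `X * h j < F i`. The factor `X` on the left avoids a division.
      singles-≤ : ∀ i → i < n → X * ∑ m (λ j → t i j * single j * h j) ≤ τ * (X * F i) + m * F i
      singles-≤ i i<n = begin
        X * ∑ m (λ j → t i j * single j * h j)
          ≡⟨ ∑-*ˡ m X (λ j → t i j * single j * h j) ⟨
        ∑ m (λ j → X * (t i j * single j * h j))
          ≤⟨ ∑-mono m pointwise ⟩
        ∑ m (λ j → close i j * single j * (X * F i) + 1 * F i)
          ≡⟨ ∑-+ m (λ j → close i j * single j * (X * F i)) (λ j → 1 * F i) ⟩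
        ∑ m (λ j → close i j * single j * (X * F i)) + ∑ m (λ j → 1 * F i)
          ≤⟨ +-mono-≤ (≤-trans (≤-reflexive (∑-*ʳ m (X * F i) (λ j → close i j * single j))) (*-monoˡ-≤ (X * F i) (near-singles-≤ i i<n)))
               (∑-≤ m (F i) λ j _ → ≤-reflexive (*-identityˡ (F i))) ⟩
        τ * (X * F i) + m * F i ∎
        where
        open ≤-Reasoning
        open +-*-Solver using (solve; con; _:+_; _:*_; _:=_)
        pointwise : ∀ j → j < m → X * (t i j * single j * h j) ≤ close i j * single j * (X * F i) + 1 * F i
        pointwise j j<m with bit-cases (t≤1 i j i<n j<m) | bit-cases (le-≤1 (F i) (X * h j))
        ... | inj₁ z | _ = ≤-trans (≤-reflexive (trans (cong (λ z → X * (z * single j * h j)) z) (*-zeroʳ X))) z≤n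
        ... | inj₂ o | inj₂ o′ = begin
          X * (t i j * single j * h j)
            ≤⟨ *-monoʳ-≤ X (*-monoʳ-≤ (t i j * single j) (h-≤ i<n o)) ⟩
          X * (t i j * single j * F i)
            ≡⟨ solve 4 (λ X t s f → X :* (t :* s :* f) := t :* con 1 :* s :* (X :* f)) refl X (t i j) (single j) (F i) ⟩
          t i j * 1 * single j * (X * F i)
            ≡⟨ cong (λ z → t i j * z * single j * (X * F i)) o′ ⟨
          close i j * single j * (X * F i)
            ≤⟨ m≤m+n _ (1 * F i) ⟩
          close i j * single j * (X * F i) + 1 * F i ∎
        ... | inj₂ o | inj₁ z′ = begin
          X * (t i j * single j * h j)
            ≤⟨ *-monoʳ-≤ X (*-monoˡ-≤ (h j) (*-bit (t≤1 i j i<n j<m) (single-≤1 j))) ⟩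
          X * (1 * h j)
            ≡⟨ cong (X *_) (*-identityˡ (h j)) ⟩
          X * h j
            ≤⟨ <⇒≤ (le≡0⇒> z′) ⟩
          F i
            ≡⟨ *-identityˡ (F i) ⟨
          1 * F i
            ≤⟨ m≤n+m (1 * F i) (close i j * single j * (X * F i)) ⟩
          close i j * single j * (X * F i) + 1 * F i ∎

      module _ (X>0 : 0 < X) (τ≡X² : τ ≡ X * X) (m≤X³ : m ≤ X * (X * X)) where

        -- After multiplication by `X`, close singles, other singles and blocks each contribute at
        -- most `X³ * F i`; this is the origin of the 3.
        value-≤-blocks : ∀ i → i < n → value i ≤ 3 * (X * X) * F i
        value-≤-blocks i i<n = *-cancelˡ-≤ X {{>-nonZero X>0}} (begin
          X * (S + B)
            ≡⟨ *-distribˡ-+ X S B ⟩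
          X * S + X * B
            ≤⟨ +-mono-≤ (singles-≤ i i<n) (*-monoʳ-≤ X (hits-≤ i i<n)) ⟩
          τ * (X * F i) + m * F i + X * (∑ n fired * (X * F i))
            ≡⟨ cong (λ z → z * (X * F i) + m * F i + X * (∑ n fired * (X * F i))) τ≡X² ⟩
          X * X * (X * F i) + m * F i + X * (∑ n fired * (X * F i))
            ≡⟨ solve 4 (λ X f m b → X :* X :* (X :* f) :+ m :* f :+ X :* (b :* (X :* f)) := X :* (X :* X) :* f :+ m :* f :+ b :* (X :* X) :* f) refl X (F i) m (∑ n fired) ⟩
          X * (X * X) * F i + m * F i + ∑ n fired * (X * X) * F i
            ≤⟨ +-mono-≤ (+-monoʳ-≤ (X * (X * X) * F i) (*-monoˡ-≤ (F i) m≤X³))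
                 (*-monoˡ-≤ (F i) (≤-trans (≤-reflexive (cong (∑ n fired *_) (sym τ≡X²))) (≤-trans blocks-≤ m≤X³))) ⟩
          X * (X * X) * F i + X * (X * X) * F i + X * (X * X) * F i
            ≡⟨ solve 2 (λ X f → X :* (X :* X) :* f :+ X :* (X :* X) :* f :+ X :* (X :* X) :* f := X :* (con 3 :* (X :* X) :* f)) refl X (F i) ⟩
          X * (3 * (X * X) * F i) ∎)
          where
          open ≤-Reasoning
          open +-*-Solver using (solve; con; _:+_; _:*_; _:=_)
          S = ∑ m (λ j → t i j * single j * h j)
          B = ∑ n (λ k → fired k * nz (∑ m λ j → t i j * close k j) * F k)

        blocks : Approximant value (3 * (X * X))
        blocks = record { universe = blockFamily ; realizes = realize ; lower = cover-lower ; upper = value-≤-blocks }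

  -- On two elements, h 0 + h 1 capped by the values of the sets {0 , 1} is itself
  -- a coverage function, so nothing is lost.
  module Pair (m n : ℕ) (t : ℕ → ℕ → ℕ) (F : ℕ → ℕ) where
    open Minima m n t F

    both : ℕ → ℕ
    both i = le 2 (∑ m (t i))

    value₂ : ℕ → ℕ
    value₂ i = ∑ m (λ j → t i j * h j) ∸ both i * ((h 0 + h 1) ∸ minOver both)

  -- a + c ⊓ b, in the form in which the program computes it
  capped : ℕ → ℕ → ℕ → ℕ
  capped a c b = (a + c) ∸ ((a + c) ∸ b)

  capped-cases : ∀ a c b → capped a c b ≡ a + c × a + c ≤ b ⊎ capped a c b ≡ b × b ≤ a + c
  capped-cases a c b with ≤-total (a + c) b
  ... | inj₁ h = inj₁ (cong ((a + c) ∸_) (m≤n⇒m∸n≡0 h) , h)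
  ... | inj₂ h = inj₂ (m∸[m∸n]≡n h , h)

  [n∸m]+[o∸n]≡o∸m : ∀ {m n o} → m ≤ n → n ≤ o → (n ∸ m) + (o ∸ n) ≡ o ∸ m
  [n∸m]+[o∸n]≡o∸m {m} {n} {o} m≤n n≤o = trans (+-comm (n ∸ m) (o ∸ n)) (trans (sym (+-∸-assoc (o ∸ n) m≤n)) (cong (_∸ m) (m∸n+n≡m n≤o)))

  module _ (n : ℕ) (t : ℕ → ℕ → ℕ) (F : ℕ → ℕ) (t≤1 : ∀ i j → i < n → j < 2 → t i j ≤ 1) where
    open Minima 2 n t F
    open Pair 2 n t F

    -- Inclusion and exclusion: with values `a`, `c` on the singletons and `v` on the pair, the
    -- elements in `A 0` only, in `A 1` only and in both weigh `v ∸ c`, `v ∸ a` and `(a + c) ∸ v`.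
    -- None of these is truncated, because `a` and `c` are at most `v` and `v ≤ a + c`. A set with
    -- both elements must exist, for otherwise `b` would not be the value of a set.
    pair : ∃[ i ] i < n × both i ≡ 1 → Approximant value₂ 1
    pair (f , f<n , full) = record
      { universe = (v ∸ c , (λ j → 1 ∸ j)) ∷ (v ∸ a , (λ j → j)) ∷ ((a + c) ∸ v , (λ _ → 1)) ∷ []
      ; realizes = λ i i<n → realizes i i<n (bit-cases (t≤1 i 0 i<n 0<2)) (bit-cases (t≤1 i 1 i<n ≤-refl))
      ; lower    = λ i i<n → lower i i<n (bit-cases (t≤1 i 0 i<n 0<2)) (bit-cases (t≤1 i 1 i<n ≤-refl))
      ; upper    = λ i i<n → ≤-trans (upper i i<n (bit-cases (t≤1 i 0 i<n 0<2)) (bit-cases (t≤1 i 1 i<n ≤-refl))) (≤-reflexive (sym (*-identityˡ (F i))))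
      }
      where
      0<2 : 0 < 2
      0<2 = s≤s z≤n
      a = h 0
      c = h 1
      b = minOver both
      v = capped a c b
      V : ℕ → ℕ → ℕ
      V x y = (0 + x * a + y * c) ∸ le 2 (0 + x + y) * ((a + c) ∸ b)
      value≡ : ∀ i x y → t i 0 ≡ x → t i 1 ≡ y → value₂ i ≡ V x y
      value≡ i _ _ refl refl = refl
      V10 : V 1 0 ≡ a
      V10 = trans (+-identityʳ (a + 0)) (+-identityʳ a)
      V01 : V 0 1 ≡ c
      V01 = +-identityʳ c
      V11 : V 1 1 ≡ v
      V11 = cong₂ _∸_ (cong₂ _+_ (+-identityʳ a) (+-identityʳ c)) (+-identityʳ ((a + c) ∸ b))
      both-split : ∀ i → i < n → both i ≡ 1 → t i 0 ≡ 1 × t i 1 ≡ 1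
      both-split i i<n e with bit-cases (t≤1 i 0 i<n 0<2) | bit-cases (t≤1 i 1 i<n ≤-refl)
      ... | inj₂ p | inj₂ q = p , q
      ... | inj₁ p | inj₁ q = contradiction (≤-trans (le⇒≤ {2} e) (≤-reflexive (cong₂ _+_ p q))) λ ()
      ... | inj₁ p | inj₂ q = contradiction (≤-trans (le⇒≤ {2} e) (≤-reflexive (cong₂ _+_ p q))) λ { (s≤s ()) }
      ... | inj₂ p | inj₁ q = contradiction (≤-trans (le⇒≤ {2} e) (≤-reflexive (cong₂ _+_ p q))) λ { (s≤s ()) }
      both-≤1 : ∀ i → i < n → both i ≤ 1
      both-≤1 i _ = le-≤1 2 (∑ 2 (t i))
      best = minOver-attained both both-≤1 f<n full
      k = proj₁ best
      k<n = proj₁ (proj₂ best)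
      tk = both-split k k<n (proj₁ (proj₂ (proj₂ best)))
      b≡Fk : b ≡ F k
      b≡Fk = proj₂ (proj₂ (proj₂ best))
      a≤b : a ≤ b
      a≤b = ≤-trans (h-≤ k<n (proj₁ tk)) (≤-reflexive (sym b≡Fk))
      c≤b : c ≤ b
      c≤b = ≤-trans (h-≤ k<n (proj₂ tk)) (≤-reflexive (sym b≡Fk))
      v≤a+c : v ≤ a + c
      v≤a+c = m∸n≤m (a + c) ((a + c) ∸ b)
      a≤v : a ≤ v
      a≤v with capped-cases a c b
      ... | inj₁ (e , _) = ≤-trans (m≤m+n a c) (≤-reflexive (sym e))
      ... | inj₂ (e , _) = ≤-trans a≤b (≤-reflexive (sym e))
      c≤v : c ≤ v
      c≤v with capped-cases a c b
      ... | inj₁ (e , _) = ≤-trans (m≤n+m c a) (≤-reflexive (sym e))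
      ... | inj₂ (e , _) = ≤-trans c≤b (≤-reflexive (sym e))
      v≤b : v ≤ b
      v≤b with capped-cases a c b
      ... | inj₁ (e , h) = ≤-trans (≤-reflexive e) h
      ... | inj₂ (e , _) = ≤-reflexive e
      U : List (ℕ × (ℕ → ℕ))
      U = (v ∸ c , (λ j → 1 ∸ j)) ∷ (v ∸ a , (λ j → j)) ∷ ((a + c) ∸ v , (λ _ → 1)) ∷ []
      hit : ℕ → ℕ → ℕ
      hit x y = (v ∸ c) * nz (0 + x * 1 + y * 0) + ((v ∸ a) * nz (0 + x * 0 + y * 1) + (((a + c) ∸ v) * nz (0 + x * 1 + y * 1) + 0))
      hit≡ : ∀ i x y → t i 0 ≡ x → t i 1 ≡ y → weightHit U (t i) ≡ hit x y
      hit≡ i _ _ refl refl = refl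
      open +-*-Solver using (solve; con; _:+_; _:*_; _:=_)
      realizes : ∀ i → i < n → t i 0 ≡ 0 ⊎ t i 0 ≡ 1 → t i 1 ≡ 0 ⊎ t i 1 ≡ 1 → value₂ i ≡ weightHit U (t i)
      realizes i i<n (inj₁ p) (inj₁ q) = trans (value≡ i 0 0 p q) (sym (trans (hit≡ i 0 0 p q)
        (solve 3 (λ x y z → x :* con 0 :+ (y :* con 0 :+ (z :* con 0 :+ con 0)) := con 0) refl (v ∸ c) (v ∸ a) ((a + c) ∸ v))))
      realizes i i<n (inj₂ p) (inj₁ q) = trans (trans (value≡ i 1 0 p q) V10) (sym (trans (hit≡ i 1 0 p q)
        (trans (solve 3 (λ x y z → x :* con 1 :+ (y :* con 0 :+ (z :* con 1 :+ con 0)) := x :+ z) refl (v ∸ c) (v ∸ a) ((a + c) ∸ v))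
        (trans ([n∸m]+[o∸n]≡o∸m c≤v v≤a+c) (m+n∸n≡m a c)))))
      realizes i i<n (inj₁ p) (inj₂ q) = trans (trans (value≡ i 0 1 p q) V01) (sym (trans (hit≡ i 0 1 p q)
        (trans (solve 3 (λ x y z → x :* con 0 :+ (y :* con 1 :+ (z :* con 1 :+ con 0)) := y :+ z) refl (v ∸ c) (v ∸ a) ((a + c) ∸ v))
        (trans ([n∸m]+[o∸n]≡o∸m a≤v v≤a+c) (m+n∸m≡n a c)))))
      realizes i i<n (inj₂ p) (inj₂ q) = trans (trans (value≡ i 1 1 p q) V11) (sym (trans (hit≡ i 1 1 p q)
        (trans (solve 3 (λ x y z → x :* con 1 :+ (y :* con 1 :+ (z :* con 1 :+ con 0)) := y :+ (x :+ z)) refl (v ∸ c) (v ∸ a) ((a + c) ∸ v))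
        (trans (cong ((v ∸ a) +_) (trans ([n∸m]+[o∸n]≡o∸m c≤v v≤a+c) (m+n∸n≡m a c))) (m∸n+n≡m a≤v)))))
      cover-single : ∀ j → j < 2 → ∀ i → i < n → t i j ≡ 1 → Covers (_≡ j) (h j)
      cover-single j j<2 i i<n e =
        let (l , l<n , tlj , h≡) = minOver-attained (λ i → t i j) (λ i i<n → t≤1 i j i<n j<2) i<n e
        in covers-set l l<n (≤-reflexive (sym h≡)) λ { _ _ refl → tlj }
      elements : ∀ {P : ℕ → Set} → P 0 → P 1 → ∀ j → j < 2 → P j
      elements p q 0 _ = p
      elements p q 1 _ = q
      elements p q (suc (suc j)) (s≤s (s≤s ()))
      lower : ∀ i → i < n → t i 0 ≡ 0 ⊎ t i 0 ≡ 1 → t i 1 ≡ 0 ⊎ t i 1 ≡ 1 → Covers (λ j → t i j ≡ 1) (value₂ i)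
      lower i i<n (inj₁ p) (inj₁ q) = covers-none λ j j<2 → elements {λ j → t i j ≡ 1 → 0 ≡ 1} (trans (sym p)) (trans (sym q)) j j<2
      lower i i<n (inj₂ p) (inj₁ q) = covers-⊆ (cover-single 0 0<2 i i<n p) (≤-reflexive (sym (trans (value≡ i 1 0 p q) V10)))
        (elements {λ j → t i j ≡ 1 → j ≡ 0} (λ _ → refl) (λ e → contradiction (trans (sym q) e) λ ()))
      lower i i<n (inj₁ p) (inj₂ q) = covers-⊆ (cover-single 1 ≤-refl i i<n q) (≤-reflexive (sym (trans (value≡ i 0 1 p q) V01)))
        (elements {λ j → t i j ≡ 1 → j ≡ 1} (λ e → contradiction (trans (sym p) e) λ ()) (λ _ → refl))
      lower i i<n (inj₂ p) (inj₂ q) with capped-cases a c b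
      ... | inj₁ (e , _) = covers-⊆ (covers-∪ (cover-single 0 0<2 i i<n p) (cover-single 1 ≤-refl i i<n q))
                             (≤-reflexive (sym (trans (trans (value≡ i 1 1 p q) V11) e)))
                             (elements {λ j → t i j ≡ 1 → j ≡ 0 ⊎ j ≡ 1} (λ _ → inj₁ refl) (λ _ → inj₂ refl))
      ... | inj₂ (e , _) = covers-set k k<n (≤-reflexive (trans (sym b≡Fk) (sym (trans (trans (value≡ i 1 1 p q) V11) e))))
                             (elements {λ j → t i j ≡ 1 → t k j ≡ 1} (λ _ → proj₁ tk) (λ _ → proj₂ tk))
      upper : ∀ i → i < n → t i 0 ≡ 0 ⊎ t i 0 ≡ 1 → t i 1 ≡ 0 ⊎ t i 1 ≡ 1 → value₂ i ≤ F i
      upper i i<n (inj₁ p) (inj₁ q) = ≤-trans (≤-reflexive (value≡ i 0 0 p q)) z≤n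
      upper i i<n (inj₂ p) (inj₁ q) = ≤-trans (≤-reflexive (trans (value≡ i 1 0 p q) V10)) (h-≤ i<n p)
      upper i i<n (inj₁ p) (inj₂ q) = ≤-trans (≤-reflexive (trans (value≡ i 0 1 p q) V01)) (h-≤ i<n q)
      upper i i<n (inj₂ p) (inj₂ q) = ≤-trans (≤-reflexive (trans (value≡ i 1 1 p q) V11))
        (≤-trans v≤b (minOver-≤ both i<n (cong (le 2) (cong₂ _+_ p q))))

-- Inequalities between Cauchy reals, and fractions of natural numbers.

module Reals where

  open import Defs
  open import Data.Integer.Base as ℤ using (+_)
  import Data.Integer.Properties as ℤ
  open import Data.Nat.Base as ℕ using (ℕ; zero; suc)
  import Data.Nat.Properties as ℕ
  open import Data.Product.Base using (∃-syntax; _×_; _,_; proj₁; proj₂)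
  open import Data.Rational.Base as ℚ using (ℚ; 0ℚ; 1ℚ; ½)
  import Data.Rational.Properties as ℚ
  open import Data.Rational.Solver using (module +-*-Solver)
  import Data.Rational.Unnormalised.Base as ℚᵘ
  import Data.Rational.Unnormalised.Properties as ℚᵘ
  open import Data.Sum.Base using (inj₁; inj₂)
  open import Relation.Binary.Definitions using (tri<; tri≈; tri>)
  open import Relation.Binary.PropositionalEquality
  open import Relation.Nullary using (contradiction)

  private
    variable
      x y z x′ y′ : ℝ
      a b c : ℚ

  ≤-trans : x ≤ y → y ≤ z → x ≤ z
  ≤-trans {x} {y} {z} h h′ ε ε>0 =
    let (M , f) = h (½ ℚ.* ε) (½ε>0 ε>0)
        (N , g) = h′ (½ ℚ.* ε) (½ε>0 ε>0)
    in M ℕ.⊔ N , λ i i≥ → ℚ.≤-trans (f i (ℕ.≤-trans (ℕ.m≤m⊔n M N) i≥))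
         (ℚ.≤-trans (ℚ.+-monoˡ-≤ (½ ℚ.* ε) (g i (ℕ.≤-trans (ℕ.m≤n⊔m M N) i≥)))
         (ℚ.≤-reflexive (trans (ℚ.+-assoc (approx z i) _ _) (cong (approx z i ℚ.+_) (½ε+½ε ε)))))

  pointwise-≤ : ∀ x y → (∀ i → approx x i ℚ.≤ approx y i) → x ≤ y
  pointwise-≤ x y h ε ε>0 = 0 , λ i _ → ℚ.≤-trans (h i)
    (ℚ.≤-trans (ℚ.≤-reflexive (sym (ℚ.+-identityʳ (approx y i)))) (ℚ.+-monoʳ-≤ (approx y i) (ℚ.<⇒≤ ε>0)))

  ≤-refl : x ≤ x
  ≤-refl {x} = pointwise-≤ x x λ _ → ℚ.≤-refl

  fromℚ-mono : a ℚ.≤ b → fromℚ a ≤ fromℚ b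
  fromℚ-mono {a} {b} h = pointwise-≤ (fromℚ a) (fromℚ b) λ _ → h

  +-mono-≤ : x ≤ y → x′ ≤ y′ → x + x′ ≤ y + y′
  +-mono-≤ {x} {y} {x′} {y′} h h′ ε ε>0 =
    let (M , f) = h (½ ℚ.* ε) (½ε>0 ε>0)
        (N , g) = h′ (½ ℚ.* ε) (½ε>0 ε>0)
    in M ℕ.⊔ N , λ i i≥ → ℚ.≤-trans
         (ℚ.+-mono-≤ (f i (ℕ.≤-trans (ℕ.m≤m⊔n M N) i≥)) (g i (ℕ.≤-trans (ℕ.m≤n⊔m M N) i≥)))
         (ℚ.≤-reflexive (trans (rearrange (approx y i) (approx y′ i) (½ ℚ.* ε)) (cong (approx y i ℚ.+ approx y′ i ℚ.+_) (½ε+½ε ε))))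
    where
    rearrange : ∀ p q e → (p ℚ.+ e) ℚ.+ (q ℚ.+ e) ≡ p ℚ.+ q ℚ.+ (e ℚ.+ e)
    rearrange = solve 3 (λ p q e → (p :+ e) :+ (q :+ e) := p :+ q :+ (e :+ e)) refl
      where open +-*-Solver using (solve; _:+_; _:=_)

  -- `C` may be 0, so `ε` is divided by `C + 1`.
  shrink : ∀ C ε → 0ℚ ℚ.≤ C → 0ℚ ℚ.< ε → ∃[ δ ] 0ℚ ℚ.< δ × C ℚ.* δ ℚ.≤ ε
  shrink C ε C≥0 ε>0 =
    let (δ , δ>0 , e) = divide {C ℚ.+ 1ℚ} (ℚ.+-mono-≤-< C≥0 (ℚ.positive⁻¹ 1ℚ)) ε>0
    in δ , δ>0 , ℚ.≤-trans (ℚ.*-monoʳ-≤-nonNeg δ {{ℚ.nonNegative (ℚ.<⇒≤ δ>0)}}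
         (ℚ.≤-trans (ℚ.≤-reflexive (sym (ℚ.+-identityʳ C))) (ℚ.+-monoʳ-≤ C (ℚ.<⇒≤ (ℚ.positive⁻¹ 1ℚ))))) (ℚ.≤-reflexive e)

  -- A non-negative real may have negative approximants throughout; `1ℝ ≤ z`, used with error 1,
  -- makes those of `z` eventually non-negative, so that they preserve rational inequalities.
  *-monoʳ-≤ : 1ℝ ≤ z → x ≤ y → x * z ≤ y * z
  *-monoʳ-≤ {z} {x} {y} 1≤z x≤y ε ε>0 =
    let (K , B , B>0 , z≤B) = bounded z
        (δ , δ>0 , Bδ≡) = divide B>0 ε>0
        (M , f) = x≤y δ δ>0
        (N , g) = 1≤z 1ℚ (ℚ.positive⁻¹ 1ℚ)
        K≤ = λ {i} (i≥ : K ℕ.⊔ (M ℕ.⊔ N) ℕ.≤ i) → ℕ.≤-trans (ℕ.m≤m⊔n K (M ℕ.⊔ N)) i≥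
        MN≤ = λ {i} (i≥ : K ℕ.⊔ (M ℕ.⊔ N) ℕ.≤ i) → ℕ.≤-trans (ℕ.m≤n⊔m K (M ℕ.⊔ N)) i≥
    in K ℕ.⊔ (M ℕ.⊔ N) , λ i i≥ →
         main (approx x i) (approx y i) (approx z i) δ (ℚ.<⇒≤ δ>0)
           (f i (ℕ.≤-trans (ℕ.m≤m⊔n M N) (MN≤ i≥))) (nonneg (g i (ℕ.≤-trans (ℕ.m≤n⊔m M N) (MN≤ i≥))))
           (ℚ.≤-trans (p≤∣p∣ (approx z i)) (z≤B i (K≤ i≥))) (ℚ.≤-reflexive Bδ≡)
    where
    nonneg : ∀ {q} → 1ℚ ℚ.≤ q ℚ.+ 1ℚ → 0ℚ ℚ.≤ q
    nonneg {q} h = ≤add⇒sub≤ {1ℚ} {1ℚ} (ℚ.≤-trans h (ℚ.≤-reflexive (ℚ.+-comm q 1ℚ)))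
    main : ∀ p q r δ {B} → 0ℚ ℚ.≤ δ → p ℚ.≤ q ℚ.+ δ → 0ℚ ℚ.≤ r → r ℚ.≤ B → B ℚ.* δ ℚ.≤ ε → p ℚ.* r ℚ.≤ q ℚ.* r ℚ.+ ε
    main p q r δ {B} δ≥0 h r≥0 r≤B Bδ≤ = begin
      p ℚ.* r                ≤⟨ ℚ.*-monoʳ-≤-nonNeg r {{ℚ.nonNegative r≥0}} h ⟩
      (q ℚ.+ δ) ℚ.* r        ≡⟨ trans (ℚ.*-distribʳ-+ r q δ) (cong (q ℚ.* r ℚ.+_) (ℚ.*-comm δ r)) ⟩
      q ℚ.* r ℚ.+ r ℚ.* δ    ≤⟨ ℚ.+-monoʳ-≤ (q ℚ.* r) (ℚ.≤-trans (ℚ.*-monoʳ-≤-nonNeg δ {{ℚ.nonNegative δ≥0}} r≤B) Bδ≤) ⟩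
      q ℚ.* r ℚ.+ ε          ∎
      where open ℚ.≤-Reasoning

  *-fromℚ-mono : 0ℚ ℚ.≤ c → x ≤ y → x * fromℚ c ≤ y * fromℚ c
  *-fromℚ-mono {c} {x} {y} c≥0 x≤y ε ε>0 =
    let (δ , δ>0 , cδ≤) = shrink c ε c≥0 ε>0
        (N , f) = x≤y δ δ>0
    in N , λ i i≥ → begin
      approx x i ℚ.* c                ≤⟨ ℚ.*-monoʳ-≤-nonNeg c {{ℚ.nonNegative c≥0}} (f i i≥) ⟩
      (approx y i ℚ.+ δ) ℚ.* c        ≡⟨ trans (ℚ.*-distribʳ-+ c (approx y i) δ) (cong (approx y i ℚ.* c ℚ.+_) (ℚ.*-comm δ c)) ⟩
      approx y i ℚ.* c ℚ.+ c ℚ.* δ    ≤⟨ ℚ.+-monoʳ-≤ (approx y i ℚ.* c) cδ≤ ⟩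
      approx y i ℚ.* c ℚ.+ ε          ∎
    where open ℚ.≤-Reasoning

  fromℚ-*-mono : 1ℝ ≤ z → a ℚ.≤ b → z * fromℚ a ≤ z * fromℚ b
  fromℚ-*-mono {z} {a} {b} 1≤z a≤b =
    ≤-trans {z * fromℚ a} {fromℚ a * z} {z * fromℚ b} (pointwise-≤ (z * fromℚ a) (fromℚ a * z) λ i → ℚ.≤-reflexive (ℚ.*-comm (approx z i) a))
    (≤-trans {fromℚ a * z} {fromℚ b * z} {z * fromℚ b} (*-monoʳ-≤ {z} {fromℚ a} {fromℚ b} 1≤z (fromℚ-mono a≤b))
      (pointwise-≤ (fromℚ b * z) (z * fromℚ b) λ i → ℚ.≤-reflexive (ℚ.*-comm b (approx z i))))

  scale-≤ : 0ℚ ℚ.≤ c → fromℚ a ≤ z * fromℚ b → fromℚ (a ℚ.* c) ≤ z * fromℚ (b ℚ.* c)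
  scale-≤ {c} {a} {z} {b} c≥0 h =
    ≤-trans {fromℚ (a ℚ.* c)} {z * fromℚ b * fromℚ c} {z * fromℚ (b ℚ.* c)}
      (*-fromℚ-mono {c} {fromℚ a} {z * fromℚ b} c≥0 h)
      (pointwise-≤ (z * fromℚ b * fromℚ c) (z * fromℚ (b ℚ.* c)) λ i → ℚ.≤-reflexive (ℚ.*-assoc (approx z i) b c))

  +-≤-*-fromℚ : x ≤ z * fromℚ a → y ≤ z * fromℚ b → x + y ≤ z * fromℚ (a ℚ.+ b)
  +-≤-*-fromℚ {x} {z} {a} {y} {b} h h′ =
    ≤-trans {x + y} {z * fromℚ a + z * fromℚ b} {z * fromℚ (a ℚ.+ b)}
      (+-mono-≤ {x} {z * fromℚ a} {y} {z * fromℚ b} h h′)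
      (pointwise-≤ (z * fromℚ a + z * fromℚ b) (z * fromℚ (a ℚ.+ b)) λ i → ℚ.≤-reflexive (sym (ℚ.*-distribˡ-+ (approx z i) a b)))

  ≤-*0⇒≤0 : fromℚ a ≤ z * fromℚ 0ℚ → a ℚ.≤ 0ℚ
  ≤-*0⇒≤0 {a} {z} h with ℚ.<-cmp 0ℚ a
  ... | tri≈ _ e _ = ℚ.≤-reflexive (sym e)
  ... | tri> _ _ a<0 = ℚ.<⇒≤ a<0
  ... | tri< 0<a _ _ = contradiction (ℚ.<-≤-trans less (bound a≤)) (ℚ.<-irrefl refl)
    where
    N = proj₁ (h (½ ℚ.* a) (½ε>0 0<a))
    a≤ : a ℚ.≤ approx z N ℚ.* 0ℚ ℚ.+ ½ ℚ.* a
    a≤ = proj₂ (h (½ ℚ.* a) (½ε>0 0<a)) N ℕ.≤-refl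
    bound : a ℚ.≤ approx z N ℚ.* 0ℚ ℚ.+ ½ ℚ.* a → a ℚ.≤ ½ ℚ.* a
    bound h = ℚ.≤-trans h (ℚ.≤-reflexive (trans (cong (ℚ._+ ½ ℚ.* a) (ℚ.*-zeroʳ (approx z N))) (ℚ.+-identityˡ (½ ℚ.* a))))
    less : ½ ℚ.* a ℚ.< a
    less = ℚ.<-≤-trans (ℚ.≤-<-trans (ℚ.≤-reflexive (sym (ℚ.+-identityʳ (½ ℚ.* a)))) (ℚ.+-monoʳ-< (½ ℚ.* a) (½ε>0 0<a))) (ℚ.≤-reflexive (½ε+½ε a))

  -- By `separate`, `p / suc q` is below `(floorAt C i + 1) / (i + 1)`, which exceeds the
  -- approximant by the vanishing `1 / (i + 1)`. Lower bounds of this kind are all that is used of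
  -- `m ^⅔` and `log₂`, as the achieved factor has to lie below the claimed one.
  cut-≤ : ∀ (C : Cut) p q → Cut._⊑_ C p (suc q) → fromℚ ((+ p) ℚ./ suc q) ≤ cutℝ C
  cut-≤ C p q p⊑q ε ε>0 =
    let (N , f) = small C ε ε>0
    in N , λ i i≥ → ℚ.≤-trans (frac-≤ C {p} {suc (floorAt C i)} q i (ℕ.<⇒≤ (separate p (suc q) (suc (floorAt C i)) (suc i) p⊑q
           (suc-largest-⋢ C (suc i) (bound ℕ.* suc i) (bounded⊑ (suc i))))))
         (ℚ.≤-trans (ℚ.≤-reflexive (frac-suc C (floorAt C i) i)) (ℚ.+-monoʳ-≤ (digits C i) (f i i≥)))
    where open Cut C

  fromℚ-≤-⊓ : fromℚ a ≤ x → fromℚ a ≤ y → fromℚ a ≤ x ⊓ y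
  fromℚ-≤-⊓ {a} {x} {y} h h′ ε ε>0 =
    let (M , f) = h ε ε>0
        (N , g) = h′ ε ε>0
    in M ℕ.⊔ N , λ i i≥ → both {approx x i} {approx y i} (f i (ℕ.≤-trans (ℕ.m≤m⊔n M N) i≥)) (g i (ℕ.≤-trans (ℕ.m≤n⊔m M N) i≥))
    where
    both : ∀ {p q} → a ℚ.≤ p ℚ.+ ε → a ℚ.≤ q ℚ.+ ε → a ℚ.≤ p ℚ.⊓ q ℚ.+ ε
    both {p} {q} hp hq with ℚ.⊓-sel p q
    ... | inj₁ e = subst (λ r → a ℚ.≤ r ℚ.+ ε) (sym e) hp
    ... | inj₂ e = subst (λ r → a ℚ.≤ r ℚ.+ ε) (sym e) hq

  ι : ℕ → ℚ
  ι a = (+ a) ℚ./ 1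

  toℚᵘ-/ : ∀ a k → ℚ.toℚᵘ ((+ a) ℚ./ suc k) ℚᵘ.≃ ℚᵘ.mkℚᵘ (+ a) k
  toℚᵘ-/ a k = ℚ.toℚᵘ-fromℚᵘ (ℚᵘ.mkℚᵘ (+ a) k)

  ι-+ : ∀ a b → ι (a ℕ.+ b) ≡ ι a ℚ.+ ι b
  ι-+ a b = ℚ.toℚᵘ-injective (ℚᵘ.≃-trans (toℚᵘ-/ (a ℕ.+ b) 0) (ℚᵘ.≃-trans
    (ℚᵘ.*≡* (cong (ℤ._* (+ 1)) (sym (cong₂ ℤ._+_ (ℤ.*-identityʳ (+ a)) (ℤ.*-identityʳ (+ b))))))
    (ℚᵘ.≃-sym (ℚᵘ.≃-trans (ℚ.toℚᵘ-homo-+ (ι a) (ι b)) (ℚᵘ.+-cong (toℚᵘ-/ a 0) (toℚᵘ-/ b 0))))))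

  ι-* : ∀ a b → ι (a ℕ.* b) ≡ ι a ℚ.* ι b
  ι-* a b = ℚ.toℚᵘ-injective (ℚᵘ.≃-trans (toℚᵘ-/ (a ℕ.* b) 0) (ℚᵘ.≃-trans
    (ℚᵘ.*≡* (cong (ℤ._* (+ 1)) (ℤ.pos-* a b)))
    (ℚᵘ.≃-sym (ℚᵘ.≃-trans (ℚ.toℚᵘ-homo-* (ι a) (ι b)) (ℚᵘ.*-cong (toℚᵘ-/ a 0) (toℚᵘ-/ b 0))))))

  /-≤ : ∀ {a b} k l → a ℕ.* suc l ℕ.≤ b ℕ.* suc k → (+ a) ℚ./ suc k ℚ.≤ (+ b) ℚ./ suc l
  /-≤ {a} {b} = frac-≤ (⅔-cut 0) {a} {b}

  ι-mono : ∀ {a b} → a ℕ.≤ b → ι a ℚ.≤ ι b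
  ι-mono {a} {b} h = /-≤ {a} {b} 0 0 (ℕ.*-monoˡ-≤ 1 h)

  ι-cancel : ∀ {a} → ι a ℚ.≤ 0ℚ → a ≡ 0
  ι-cancel {zero}  h = refl
  ι-cancel {suc a} h = contradiction (ℚ.≤-trans (ι-mono {1} {suc a} (ℕ.s≤s ℕ.z≤n)) h) λ h′ → ℚ.<-irrefl refl (ℚ.<-≤-trans (ℚ.positive⁻¹ 1ℚ) h′)

  ι-nonNeg : ∀ a → 0ℚ ℚ.≤ ι a
  ι-nonNeg a = ι-mono {0} {a} ℕ.z≤n

  -- 1 / 0 is a junk value
  inv : ℕ → ℚ
  inv zero    = 0ℚ
  inv (suc k) = (+ 1) ℚ./ suc k

  /-≡-*inv : ∀ a b .{{_ : ℕ.NonZero b}} → (+ a) ℚ./ b ≡ ι a ℚ.* inv b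
  /-≡-*inv a (suc k) = ℚ.toℚᵘ-injective (ℚᵘ.≃-trans (toℚᵘ-/ a k) (ℚᵘ.≃-trans
    (ℚᵘ.*≡* (cong₂ ℤ._*_ (sym (ℤ.*-identityʳ (+ a))) (cong (λ z → + suc z) (ℕ.+-identityʳ k))))
    (ℚᵘ.≃-sym (ℚᵘ.≃-trans (ℚ.toℚᵘ-homo-* (ι a) (inv (suc k))) (ℚᵘ.*-cong (toℚᵘ-/ a 0) (toℚᵘ-/ 1 k))))))

  ι*inv : ∀ {b} → 0 ℕ.< b → ι b ℚ.* inv b ≡ 1ℚ
  ι*inv {suc k} _ = trans (sym (/-≡-*inv (suc k) (suc k))) (ℚ.toℚᵘ-injective (ℚᵘ.≃-trans (toℚᵘ-/ (suc k) k) (ℚᵘ.*≡* (ℤ.*-comm (+ suc k) (+ 1)))))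

  inv-nonNeg : ∀ b → 0ℚ ℚ.≤ inv b
  inv-nonNeg zero    = ℚ.≤-refl
  inv-nonNeg (suc k) = ℚ.≤-trans (ℚ.≤-reflexive refl) (/-≤ {0} {1} 0 k ℕ.z≤n)

  *-nonNeg : 0ℚ ℚ.≤ a → 0ℚ ℚ.≤ b → 0ℚ ℚ.≤ a ℚ.* b
  *-nonNeg {a} {b} ha hb = ℚ.≤-trans (ℚ.≤-reflexive (sym (ℚ.*-zeroˡ b))) (ℚ.*-monoʳ-≤-nonNeg b {{ℚ.nonNegative hb}} ha)

-- Subadditivity of coverage functions, and coverage functions built from integer universes.

module Coverings where

  open import Defs hiding (m)
  open Reals
  open Ranges using (∑; nz; nz-pos; ∑-≥; ∑-pos)
  open Encoding using (bit)
  open Greedy using (module Minima)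
  open import Data.Bool.Base using (Bool; true; false; _∨_; if_then_else_)
  open import Data.Bool.Properties using (∨-zeroʳ)
  open import Data.Fin.Base using (Fin; zero; suc; toℕ; fromℕ<)
  open import Data.Fin.Properties using (toℕ<n; toℕ-fromℕ<)
  open import Data.Fin.Subset using (Subset; ⋃)
  open import Data.Fin.Subset.Properties using (_∈?_)
  open import Data.List.Base as List using (List; []; _∷_; length)
  open import Data.List.Membership.Propositional using () renaming (_∈_ to _∈ᴸ_)
  open import Data.List.Membership.Propositional.Properties using (∈-filter⁻; ∈-filter⁺; ∈-map⁻; ∈-map⁺; ∈-allFin)
  open import Data.List.Relation.Unary.Any using (here; there)
  open import Data.Nat.Base as ℕ using (ℕ; zero; suc)
  import Data.Nat.Properties as ℕ
  open import Data.Product.Base using (∃-syntax; _×_; _,_; proj₁; proj₂)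
  open import Data.Rational.Base as ℚ using (ℚ; 0ℚ)
  import Data.Rational.Properties as ℚ
  open import Data.Rational.Solver using (module +-*-Solver)
  open import Data.Sum.Base using (_⊎_; inj₁; inj₂; map)
  open import Data.Vec.Base as Vec using (Vec; lookup; tabulate)
  open import Data.Vec.Properties using (lookup-zipWith; lookup-replicate; lookup∘tabulate; []=⇒lookup; lookup⇒[]=)
  open import Relation.Binary.PropositionalEquality
  open import Relation.Nullary using (contradiction)

  Σ-≤-+ : ∀ n (a b c : Fin n → ℝ) → (∀ u → a u ≤ b u + c u) → Σℝ (tabulate a) ≤ Σℝ (tabulate b) + Σℝ (tabulate c)
  Σ-≤-+ zero    a b c h = pointwise-≤ 0ℝ (0ℝ + 0ℝ) λ _ → ℚ.≤-refl
  Σ-≤-+ (suc n) a b c h = ≤-trans {a zero + A} {(b zero + c zero) + (B + C)} {(b zero + B) + (c zero + C)}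
    (+-mono-≤ {a zero} {b zero + c zero} {A} {B + C} (h zero) (Σ-≤-+ n (λ u → a (suc u)) (λ u → b (suc u)) (λ u → c (suc u)) λ u → h (suc u)))
    (pointwise-≤ ((b zero + c zero) + (B + C)) ((b zero + B) + (c zero + C)) λ i → ℚ.≤-reflexive (interchange (approx (b zero) i) (approx (c zero) i) (approx B i) (approx C i)))
    where
    A = Σℝ (tabulate λ u → a (suc u))
    B = Σℝ (tabulate λ u → b (suc u))
    C = Σℝ (tabulate λ u → c (suc u))
    interchange : ∀ p q r s → (p ℚ.+ q) ℚ.+ (r ℚ.+ s) ≡ (p ℚ.+ r) ℚ.+ (q ℚ.+ s)
    interchange = solve 4 (λ p q r s → (p :+ q) :+ (r :+ s) := (p :+ r) :+ (q :+ s)) refl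
      where open +-*-Solver using (solve; _:+_; _:=_)

  Σ-≤0 : ∀ n (a : Fin n → ℝ) → (∀ u → a u ≤ 0ℝ) → Σℝ (tabulate a) ≤ 0ℝ
  Σ-≤0 zero    a h = ≤-refl {0ℝ}
  Σ-≤0 (suc n) a h = ≤-trans {a zero + Σℝ (tabulate λ u → a (suc u))} {0ℝ + 0ℝ} {0ℝ}
    (+-mono-≤ {a zero} {0ℝ} {Σℝ (tabulate λ u → a (suc u))} {0ℝ} (h zero) (Σ-≤0 n (λ u → a (suc u)) λ u → h (suc u)))
    (pointwise-≤ (0ℝ + 0ℝ) 0ℝ λ _ → ℚ.≤-refl)

  lookup-⋃⁻ : ∀ {k} (ps : List (Subset k)) u → lookup (⋃ ps) u ≡ true → ∃[ p ] p ∈ᴸ ps × lookup p u ≡ true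
  lookup-⋃⁻ []       u e = contradiction (trans (sym (lookup-replicate u false)) e) λ ()
  lookup-⋃⁻ (p ∷ ps) u e with lookup p u in eq
  ... | true  = p , here refl , eq
  ... | false = let (q , q∈ , e′) = lookup-⋃⁻ ps u (trans (sym (trans (lookup-zipWith _ u p (⋃ ps)) (cong (λ b → b ∨ lookup (⋃ ps) u) eq))) e)
                in q , there q∈ , e′

  lookup-⋃⁺ : ∀ {k} (ps : List (Subset k)) u {p} → p ∈ᴸ ps → lookup p u ≡ true → lookup (⋃ ps) u ≡ true
  lookup-⋃⁺ (p ∷ ps) u (here refl) e = trans (lookup-zipWith _ u p (⋃ ps)) (cong (λ b → b ∨ lookup (⋃ ps) u) e)
  lookup-⋃⁺ (p ∷ ps) u (there p∈) e = trans (lookup-zipWith _ u p (⋃ ps)) (trans (cong (lookup p u ∨_) (lookup-⋃⁺ ps u p∈ e)) (∨-zeroʳ (lookup p u)))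

  module _ {m} (C : Coverage m) where
    open Coverage C

    covered : Subset m → Fin ∣U∣ → Bool
    covered S u = lookup (⋃ (List.map A (List.filter (_∈? S) (List.allFin m)))) u

    covered⁻ : ∀ S u → covered S u ≡ true → ∃[ j ] lookup S j ≡ true × lookup (A j) u ≡ true
    covered⁻ S u e with lookup-⋃⁻ (List.map A (List.filter (_∈? S) (List.allFin m))) u e
    ... | p , p∈ , e′ with ∈-map⁻ A p∈
    ...   | j , j∈ , refl = j , []=⇒lookup (proj₂ (∈-filter⁻ (_∈? S) {xs = List.allFin m} j∈)) , e′

    covered⁺ : ∀ S u j → lookup S j ≡ true → lookup (A j) u ≡ true → covered S u ≡ true
    covered⁺ S u j j∈S u∈A = lookup-⋃⁺ _ u (∈-map⁺ A (∈-filter⁺ (_∈? S) (∈-allFin j) (lookup⇒[]= j S j∈S))) u∈A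

    contribution : Subset m → Fin ∣U∣ → ℝ
    contribution S u = if covered S u then weight u else 0ℝ

    -- Holds element by element: one covered by `S` lies in some `A j` with `j` in `S`, hence in
    -- `S₁` or `S₂`. Asking only for inclusion in the union includes monotonicity.
    value-subadditive : ∀ S S₁ S₂ → (∀ j → lookup S j ≡ true → lookup S₁ j ≡ true ⊎ lookup S₂ j ≡ true) →
                        value S ≤ value S₁ + value S₂
    value-subadditive S S₁ S₂ h = Σ-≤-+ ∣U∣ (contribution S) (contribution S₁) (contribution S₂) elementwise
      where
      covers : ∀ u → covered S u ≡ true → covered S₁ u ≡ true ⊎ covered S₂ u ≡ true
      covers u e = let (j , j∈S , u∈A) = covered⁻ S u e in
        map (λ j∈ → covered⁺ S₁ u j j∈ u∈A) (λ j∈ → covered⁺ S₂ u j j∈ u∈A) (h j j∈S)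
      choose : ∀ w → 0ℝ ≤ w → ∀ b b₁ b₂ → (b ≡ true → b₁ ≡ true ⊎ b₂ ≡ true) →
               (if b then w else 0ℝ) ≤ (if b₁ then w else 0ℝ) + (if b₂ then w else 0ℝ)
      choose w w≥0 false false false _ = pointwise-≤ 0ℝ (0ℝ + 0ℝ) λ _ → ℚ.≤-refl
      choose w w≥0 false false true  _ = ≤-trans {0ℝ} {w} {0ℝ + w} w≥0 (pointwise-≤ w (0ℝ + w) λ i → ℚ.≤-reflexive (sym (ℚ.+-identityˡ (approx w i))))
      choose w w≥0 false true  false _ = ≤-trans {0ℝ} {w} {w + 0ℝ} w≥0 (pointwise-≤ w (w + 0ℝ) λ i → ℚ.≤-reflexive (sym (ℚ.+-identityʳ (approx w i))))
      choose w w≥0 false true  true  _ = ≤-trans {0ℝ} {0ℝ + 0ℝ} {w + w} (pointwise-≤ 0ℝ (0ℝ + 0ℝ) λ _ → ℚ.≤-refl) (+-mono-≤ {0ℝ} {w} {0ℝ} {w} w≥0 w≥0)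
      choose w w≥0 true  false false f with f refl
      ... | inj₁ ()
      ... | inj₂ ()
      choose w w≥0 true  false true  _ = pointwise-≤ w (0ℝ + w) λ i → ℚ.≤-reflexive (sym (ℚ.+-identityˡ (approx w i)))
      choose w w≥0 true  true  false _ = pointwise-≤ w (w + 0ℝ) λ i → ℚ.≤-reflexive (sym (ℚ.+-identityʳ (approx w i)))
      choose w w≥0 true  true  true  _ = ≤-trans {w} {w + 0ℝ} {w + w} (pointwise-≤ w (w + 0ℝ) λ i → ℚ.≤-reflexive (sym (ℚ.+-identityʳ (approx w i))))
                                           (+-mono-≤ {w} {w} {0ℝ} {w} (≤-refl {w}) w≥0)
      elementwise : ∀ u → contribution S u ≤ contribution S₁ u + contribution S₂ u
      elementwise u = choose (weight u) (weight≥0 u) (covered S u) (covered S₁ u) (covered S₂ u) (covers u)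

    value-empty : ∀ S → (∀ j → lookup S j ≢ true) → value S ≤ 0ℝ
    value-empty S empty = Σ-≤0 ∣U∣ (contribution S) λ u → choose (covered S u) λ e → let (j , j∈S , _) = covered⁻ S u e in empty j j∈S
      where
      choose : ∀ {w} b → b ≢ true → (if b then w else 0ℝ) ≤ 0ℝ
      choose true  h = contradiction refl h
      choose false h = ≤-refl {0ℝ}

  module _ (m n : ℕ) (t : ℕ → ℕ → ℕ) (F : ℕ → ℕ) (σ : ℚ) (σ≥0 : 0ℚ ℚ.≤ σ) where
    open Minima m n t F using (weightHit)

    positive : ℕ → Bool
    positive zero    = false
    positive (suc _) = true

    positive⁺ : ∀ {a} → 0 ℕ.< a → positive a ≡ true
    positive⁺ (ℕ.s≤s _) = refl

    positive⁻ : ∀ {a} → positive a ≡ true → 0 ℕ.< a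
    positive⁻ {suc a} _ = ℕ.s≤s ℕ.z≤n

    familyCoverage : List (ℕ × (ℕ → ℕ)) → Coverage m
    familyCoverage us = record
      { ∣U∣      = length us
      ; weight   = λ u → fromℚ (ι (proj₁ (List.lookup us u)) ℚ.* σ)
      ; weight≥0 = λ u → fromℚ-mono (*-nonNeg (ι-nonNeg (proj₁ (List.lookup us u))) σ≥0)
      ; A        = λ j → tabulate λ u → positive (proj₂ (List.lookup us u) (toℕ j))
      }

    module _ (S : Subset m) (row : ℕ → ℕ) (row≡ : ∀ j → row (toℕ j) ≡ bit (lookup S j)) where

      meets : (ℕ → ℕ) → ℕ
      meets χ = ∑ m λ j → row j ℕ.* χ j

      covered≡ : ∀ us u → covered (familyCoverage us) S u ≡ positive (meets (proj₂ (List.lookup us u)))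
      covered≡ us u with covered (familyCoverage us) S u in e | positive (meets (proj₂ (List.lookup us u))) in e′
      ... | true  | true  = refl
      ... | false | false = refl
      ... | true  | false =
        let (j , j∈S , u∈A) = covered⁻ (familyCoverage us) S u e
            χ = proj₂ (List.lookup us u)
            1≤ : 1 ℕ.≤ row (toℕ j) ℕ.* χ (toℕ j)
            1≤ = ℕ.*-mono-≤ (ℕ.≤-reflexive (sym (trans (row≡ j) (cong bit j∈S))))
                   (positive⁻ (trans (sym (lookup∘tabulate (λ u → positive (proj₂ (List.lookup us u) (toℕ j))) u)) u∈A))
        in trans (sym (positive⁺ (ℕ.≤-trans 1≤ (∑-≥ m (λ j → row j ℕ.* χ j) (toℕ<n j))))) e′
      ... | false | true =
        let χ = proj₂ (List.lookup us u)
            (j , j<m , pos) = ∑-pos m (λ j → row j ℕ.* χ j) (positive⁻ e′)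
            i = fromℕ< j<m
            i≡j = toℕ-fromℕ< j<m
        in trans (sym e) (covered⁺ (familyCoverage us) S u i
             (member (lookup S i) (left (row j) (χ j) pos) (trans (cong row (sym i≡j)) (row≡ i)))
             (trans (lookup∘tabulate (λ u → positive (proj₂ (List.lookup us u) (toℕ i))) u)
               (positive⁺ (ℕ.≤-trans (right (row j) (χ j) pos) (ℕ.≤-reflexive (cong χ (sym i≡j)))))))
        where
        left : ∀ a b → 0 ℕ.< a ℕ.* b → 0 ℕ.< a
        left (suc a) b _ = ℕ.s≤s ℕ.z≤n
        right : ∀ a b → 0 ℕ.< a ℕ.* b → 0 ℕ.< b
        right a (suc b) _ = ℕ.s≤s ℕ.z≤n
        right a zero h = contradiction (ℕ.≤-trans h (ℕ.≤-reflexive (ℕ.*-zeroʳ a))) λ ()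
        member : ∀ b {r} → 0 ℕ.< r → r ≡ bit b → b ≡ true
        member true  _ _ = refl
        member false h e = contradiction (ℕ.≤-trans h (ℕ.≤-reflexive e)) λ ()

      Σ-family : ∀ us (g : Fin (length us) → ℝ) →
                 (∀ u → ∀ i → approx (g u) i ≡ ι (proj₁ (List.lookup us u) ℕ.* nz (meets (proj₂ (List.lookup us u)))) ℚ.* σ) →
                 ∀ i → approx (Σℝ (tabulate g)) i ≡ ι (weightHit us row) ℚ.* σ
      Σ-family []             g h i = sym (ℚ.*-zeroˡ σ)
      Σ-family ((w , χ) ∷ us) g h i = trans (cong₂ ℚ._+_ (h zero i) (Σ-family us (λ u → g (suc u)) (λ u → h (suc u)) i))
        (trans (sym (ℚ.*-distribʳ-+ σ (ι (w ℕ.* nz (meets χ))) (ι (weightHit us row)))) (cong (ℚ._* σ) (sym (ι-+ (w ℕ.* nz (meets χ)) (weightHit us row)))))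

      familyCoverage-value : ∀ us i → approx (Coverage.value (familyCoverage us) S) i ≡ ι (weightHit us row) ℚ.* σ
      familyCoverage-value us = Σ-family us (contribution (familyCoverage us) S) λ u i →
        trans (cong (λ b → approx (if b then Coverage.weight (familyCoverage us) u else 0ℝ) i) (covered≡ us u)) (entry u i (meets (proj₂ (List.lookup us u))))
        where
        entry : ∀ u i a → approx (if positive a then Coverage.weight (familyCoverage us) u else 0ℝ) i ≡ ι (proj₁ (List.lookup us u) ℕ.* nz a) ℚ.* σ
        entry u i zero    = trans (sym (ℚ.*-zeroˡ σ)) (cong (λ z → ι z ℚ.* σ) (sym (ℕ.*-zeroʳ (proj₁ (List.lookup us u)))))
        entry u i (suc a) = cong (λ z → ι z ℚ.* σ) (sym (trans (cong (proj₁ (List.lookup us u) ℕ.*_) (nz-pos {suc a} (ℕ.s≤s ℕ.z≤n))) (ℕ.*-identityʳ (proj₁ (List.lookup us u)))))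

-- From an approximant to a bracket around the optimal factor.

module Approximation where

  open import Defs
  open Reals
  open Coverings
  open Encoding using (bit; module Words)
  open Greedy using (module Minima)
  open import Data.Bool.Base using (true; false; _∧_; not)
  open import Data.Fin.Base using (Fin; toℕ; fromℕ<)
  open import Data.Fin.Properties using (toℕ<n; toℕ-fromℕ<)
  open import Data.Fin.Subset using (Subset)
  open import Data.List.Base as List using (List; []; _∷_)
  open import Data.List.Membership.Propositional using (_∈_)
  open import Data.List.Membership.Propositional.Properties using (∈-lookup)
  open import Data.List.Relation.Unary.All as All using (All; []; _∷_)
  open import Data.List.Relation.Unary.Any as Any using (here; there)
  open import Data.List.Relation.Unary.Any.Properties using (lookup-index)
  open import Data.Nat.Base as ℕ using (ℕ; zero; suc; _∸_)
  open import Data.Nat.ListAction using (sum)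
  import Data.Nat.Properties as ℕ
  open import Data.Nat.Solver using () renaming (module +-*-Solver to ℕ-Solver)
  open import Data.Product.Base using (∃-syntax; _×_; _,_; proj₁; proj₂)
  open import Data.Rational.Base as ℚ using (ℚ; 0ℚ; 1ℚ)
  import Data.Rational.Properties as ℚ
  open import Data.Rational.Solver using (module +-*-Solver)
  open import Data.Sum.Base using (_⊎_; inj₁; inj₂)
  open import Data.Vec.Base using (lookup; tabulate)
  open import Data.Vec.Properties using (lookup∘tabulate)
  open import Relation.Binary.PropositionalEquality
  open import Relation.Nullary using (contradiction)

  -- The maximum of `a` and 1, used as a denominator in place of `g i`. Nothing is lost where
  -- `g i = 0`, since `F i` is then 0 as well whenever any extension exists.
  positivePart : ℕ → ℕ
  positivePart a = a ℕ.+ (1 ∸ a)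

  positivePart>0 : ∀ a → 0 ℕ.< positivePart a
  positivePart>0 zero    = ℕ.≤-refl
  positivePart>0 (suc a) = ℕ.s≤s ℕ.z≤n

  positivePart-≥ : ∀ a → a ℕ.≤ positivePart a
  positivePart-≥ a = ℕ.m≤m+n a (1 ∸ a)

  positivePart-suc : ∀ a → positivePart (suc a) ≡ suc a
  positivePart-suc a = trans (cong (suc a ℕ.+_) (ℕ.0∸n≡0 a)) (ℕ.+-identityʳ (suc a))

  module _ (H : PartialFunction) where
    open Words H using (n)

    -- The last two hypotheses say that Γ / D is the larger of 1 and max F i / g i.
    module _
      (t : ℕ → ℕ → ℕ) (F : ℕ → ℕ) (Q : ℕ) (Q>0 : 0 ℕ.< Q)
      (t≡ : ∀ (i : Fin n) (j : Fin (m H)) → t (toℕ i) (toℕ j) ≡ bit (lookup (Point.T (List.lookup (points H) i)) j))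
      (f≡ : ∀ (i : Fin n) → Point.f (List.lookup (points H) i) ≡ ι (F (toℕ i)) ℚ.* inv Q)
      (g : ℕ → ℕ) (R : ℕ) (1≤R : 1 ℕ.≤ R) (A : Minima.Approximant (m H) n t F g R)
      (D Γ : ℕ) (D>0 : 0 ℕ.< D) (D≤Γ : D ℕ.≤ Γ)
      (dominates : ∀ i → i ℕ.< n → F i ℕ.* D ℕ.≤ positivePart (g i) ℕ.* Γ)
      (attained : Γ ≡ D ⊎ ∃[ i ] i ℕ.< n × Γ ℕ.* positivePart (g i) ≡ F i ℕ.* D)
      where

      open Minima (m H) n t F
      open Approximant A

      private
        T : Fin n → Subset (m H)
        T i = Point.T (List.lookup (points H) i)

        f : Fin n → ℚ
        f i = Point.f (List.lookup (points H) i)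

        u v : ℚ
        u = inv Q
        v = inv D

        u≥0 : 0ℚ ℚ.≤ u
        u≥0 = inv-nonNeg Q

        v≥0 : 0ℚ ℚ.≤ v
        v≥0 = inv-nonNeg D

      β : ℚ
      β = ι (R ℕ.* Γ) ℚ.* v

      private
        module Lower {α : ℝ} (1≤α : 1ℝ ≤ α) (C : Coverage (m H))
          (f≤ : ∀ i → fromℚ (f i) ≤ Coverage.value C (T i)) (≤αf : ∀ i → Coverage.value C (T i) ≤ α * fromℚ (f i)) where
          open Coverage C

          -- Splits off the first set of the cover: the remaining sets cover what it leaves of `S`,
          -- and subadditivity adds the two bounds.
          cover-bound : ∀ L → All (ℕ._< n) L → ∀ S → (∀ j → lookup S j ≡ true → ∃[ i ] i ∈ L × t i (toℕ j) ≡ 1) →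
                        value S ≤ α * fromℚ (ι (sum (List.map F L)) ℚ.* u)
          cover-bound [] [] S covers = ≤-trans {value S} {0ℝ} {α * fromℚ (ι 0 ℚ.* u)}
            (value-empty C S λ j j∈S → contradiction (proj₁ (proj₂ (covers j j∈S))) λ ())
            (pointwise-≤ 0ℝ (α * fromℚ (ι 0 ℚ.* u)) λ i → ℚ.≤-reflexive (sym (trans (cong (approx α i ℚ.*_) (ℚ.*-zeroˡ u)) (ℚ.*-zeroʳ (approx α i)))))
          cover-bound (i ∷ L) (i<n ∷ L<n) S covers =
            ≤-trans {value S} {value (T k) + value S′} {α * fromℚ (ι (F i ℕ.+ sum (List.map F L)) ℚ.* u)}
              (value-subadditive C S (T k) S′ split)
              (subst (λ q → value (T k) + value S′ ≤ α * fromℚ q) sum≡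
                (+-≤-*-fromℚ {value (T k)} {α} {f k} {value S′} {ι (sum (List.map F L)) ℚ.* u} (≤αf k) (cover-bound L L<n S′ covers′)))
            where
            k = fromℕ< i<n
            k≡i = toℕ-fromℕ< i<n
            S′ = tabulate λ j → lookup S j ∧ not (lookup (T k) j)
            split : ∀ j → lookup S j ≡ true → lookup (T k) j ≡ true ⊎ lookup S′ j ≡ true
            split j j∈S with lookup (T k) j in e
            ... | true  = inj₁ refl
            ... | false = inj₂ (trans (lookup∘tabulate (λ j → lookup S j ∧ not (lookup (T k) j)) j) (cong₂ (λ a b → a ∧ not b) j∈S e))
            split′ : ∀ a b → a ∧ not b ≡ true → a ≡ true × b ≡ false
            split′ true false _ = refl , refl
            covers′ : ∀ j → lookup S′ j ≡ true → ∃[ i ] i ∈ L × t i (toℕ j) ≡ 1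
            covers′ j j∈S′ with split′ (lookup S j) (lookup (T k) j) (trans (sym (lookup∘tabulate (λ j → lookup S j ∧ not (lookup (T k) j)) j)) j∈S′)
            ... | j∈S , j∉T with covers j j∈S
            ...   | l , there l∈L , e = l , l∈L , e
            ...   | l , here refl , e = contradiction (trans (sym e) (trans (cong (λ l → t l (toℕ j)) (sym k≡i)) (trans (t≡ k j) (cong bit j∉T)))) λ ()
            sum≡ : f k ℚ.+ ι (sum (List.map F L)) ℚ.* u ≡ ι (F i ℕ.+ sum (List.map F L)) ℚ.* u
            sum≡ = trans (cong (ℚ._+ ι (sum (List.map F L)) ℚ.* u) (trans (f≡ k) (cong (λ l → ι (F l) ℚ.* u) k≡i)))
              (trans (sym (ℚ.*-distribʳ-+ u (ι (F i)) (ι (sum (List.map F L))))) (cong (ℚ._* u) (sym (ι-+ (F i) (sum (List.map F L))))))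

          F≤αg : ∀ i → fromℚ (ι (F (toℕ i)) ℚ.* u) ≤ α * fromℚ (ι (g (toℕ i)) ℚ.* u)
          F≤αg i = subst (λ q → fromℚ q ≤ α * fromℚ (ι (g (toℕ i)) ℚ.* u)) (f≡ i)
            (≤-trans {fromℚ (f i)} {value (T i)} {α * fromℚ (ι (g (toℕ i)) ℚ.* u)} (f≤ i)
            (≤-trans {value (T i)} {α * fromℚ (ι (sum (List.map F sets)) ℚ.* u)} {α * fromℚ (ι (g (toℕ i)) ℚ.* u)}
              (cover-bound sets sets<n (T i) λ j j∈T → covers (toℕ j) (toℕ<n j) (trans (t≡ i j) (cong bit j∈T)))
              (fromℚ-*-mono {α} 1≤α (ℚ.*-monoʳ-≤-nonNeg u {{ℚ.nonNegative u≥0}} (ι-mono cost)))))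
            where open Covers (lower (toℕ i) (toℕ<n i))

          -- A finite factor forces this: the cover bound reads `F i ≤ α * 0`.
          F≡0 : ∀ i → g (toℕ i) ≡ 0 → F (toℕ i) ≡ 0
          F≡0 i g≡0 = ι-cancel (begin
            ι (F (toℕ i))                       ≡⟨ trans (cong (ι (F (toℕ i)) ℚ.*_) (trans (ℚ.*-comm u (ι Q)) (ι*inv Q>0))) (ℚ.*-identityʳ _) ⟨
            ι (F (toℕ i)) ℚ.* (u ℚ.* ι Q)       ≡⟨ ℚ.*-assoc (ι (F (toℕ i))) u (ι Q) ⟨
            ι (F (toℕ i)) ℚ.* u ℚ.* ι Q         ≤⟨ ℚ.*-monoʳ-≤-nonNeg (ι Q) {{ℚ.nonNegative (ι-nonNeg Q)}} (≤-*0⇒≤0 {z = α} (subst (λ q → fromℚ (ι (F (toℕ i)) ℚ.* u) ≤ α * fromℚ q) zero≡ (F≤αg i))) ⟩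
            0ℚ ℚ.* ι Q                          ≡⟨ ℚ.*-zeroˡ (ι Q) ⟩
            0ℚ                                  ∎)
            where
            open ℚ.≤-Reasoning
            zero≡ : ι (g (toℕ i)) ℚ.* u ≡ 0ℚ
            zero≡ = trans (cong (λ z → ι z ℚ.* u) g≡0) (ℚ.*-zeroˡ u)

          Γ≤αD : fromℚ (ι Γ) ≤ α * fromℚ (ι D)
          Γ≤αD = Γ≤αD′ attained
            where
            Γ≤αD′ : Γ ≡ D ⊎ ∃[ i ] i ℕ.< n × Γ ℕ.* positivePart (g i) ≡ F i ℕ.* D → fromℚ (ι Γ) ≤ α * fromℚ (ι D)
            Γ≤αD′ (inj₁ Γ≡D) = subst (λ γ → fromℚ (ι γ) ≤ α * fromℚ (ι D)) (sym Γ≡D) (≤-trans {fromℚ (ι D)} {1ℝ * fromℚ (ι D)} {α * fromℚ (ι D)}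
                  (pointwise-≤ (fromℚ (ι D)) (1ℝ * fromℚ (ι D)) λ _ → ℚ.≤-reflexive (sym (ℚ.*-identityˡ (ι D))))
                  (*-fromℚ-mono {ι D} {1ℝ} {α} (ι-nonNeg D) 1≤α))
            Γ≤αD′ (inj₂ (i , i<n , e)) = subst (λ q → fromℚ q ≤ α * fromℚ (ι D)) left≡
                    (≤-trans {fromℚ (ι (F i) ℚ.* u ℚ.* c)} {α * fromℚ (ι (g i) ℚ.* u ℚ.* c)} {α * fromℚ (ι D)}
                      (scale-≤ {c} {ι (F i) ℚ.* u} {α} {ι (g i) ℚ.* u} c≥0 (subst (λ l → fromℚ (ι (F l) ℚ.* u) ≤ α * fromℚ (ι (g l) ℚ.* u)) (toℕ-fromℕ< i<n) (F≤αg (fromℕ< i<n))))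
                      (fromℚ-*-mono {α} 1≤α right≤))
              where
              p = positivePart (g i)
              w = inv p
              -- Scaling by `Q D / p` takes `F i / Q` to `F i D / p = Γ`, by the choice of `i`, and
              -- takes `g i / Q` to at most `D`, since `g i ≤ p`.
              c = ι Q ℚ.* (ι D ℚ.* w)
              c≥0 : 0ℚ ℚ.≤ c
              c≥0 = *-nonNeg (ι-nonNeg Q) (*-nonNeg (ι-nonNeg D) (inv-nonNeg p))
              cancel : ∀ a → ι a ℚ.* u ℚ.* c ≡ ι (a ℕ.* D) ℚ.* w
              cancel a = begin
                ι a ℚ.* u ℚ.* (ι Q ℚ.* (ι D ℚ.* w))    ≡⟨ solve 5 (λ a u q d w → a :* u :* (q :* (d :* w)) := (q :* u) :* ((a :* d) :* w)) refl (ι a) u (ι Q) (ι D) w ⟩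
                ι Q ℚ.* u ℚ.* (ι a ℚ.* ι D ℚ.* w)      ≡⟨ cong (ℚ._* (ι a ℚ.* ι D ℚ.* w)) (ι*inv Q>0) ⟩
                1ℚ ℚ.* (ι a ℚ.* ι D ℚ.* w)             ≡⟨ ℚ.*-identityˡ _ ⟩
                ι a ℚ.* ι D ℚ.* w                      ≡⟨ cong (ℚ._* w) (ι-* a D) ⟨
                ι (a ℕ.* D) ℚ.* w                      ∎
                where open ≡-Reasoning
                      open +-*-Solver using (solve; _:*_; _:=_)
              undo : ∀ a → ι (a ℕ.* p) ℚ.* w ≡ ι a
              undo a = trans (cong (ℚ._* w) (ι-* a p)) (trans (ℚ.*-assoc (ι a) (ι p) w) (trans (cong (ι a ℚ.*_) (ι*inv (positivePart>0 (g i)))) (ℚ.*-identityʳ (ι a))))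
              left≡ : ι (F i) ℚ.* u ℚ.* c ≡ ι Γ
              left≡ = trans (cancel (F i)) (trans (cong (λ z → ι z ℚ.* w) (sym e)) (undo Γ))
              right≤ : ι (g i) ℚ.* u ℚ.* c ℚ.≤ ι D
              right≤ = ℚ.≤-trans (ℚ.≤-reflexive (cancel (g i))) (ℚ.≤-trans
                (ℚ.*-monoʳ-≤-nonNeg w {{ℚ.nonNegative (inv-nonNeg p)}} (ι-mono (ℕ.≤-trans (ℕ.*-monoˡ-≤ D (positivePart-≥ (g i))) (ℕ.≤-reflexive (ℕ.*-comm p D)))))
                (ℚ.≤-reflexive (undo D)))

        1≤β : 1ℚ ℚ.≤ β
        1≤β = ℚ.≤-trans (ℚ.≤-reflexive (sym (ι*inv D>0)))
          (ℚ.*-monoʳ-≤-nonNeg v {{ℚ.nonNegative v≥0}} (ι-mono (ℕ.≤-trans D≤Γ (ℕ.m≤n*m Γ R {{ℕ.>-nonZero 1≤R}}))))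

        module Upper (F≡0 : ∀ (i : Fin n) → g (toℕ i) ≡ 0 → F (toℕ i) ≡ 0) where

          -- The factor `γ = Γ / D`, divided by `Q` to return from integers to the scale of the
          -- given values.
          σ : ℚ
          σ = ι Γ ℚ.* (v ℚ.* u)

          σ≥0 : 0ℚ ℚ.≤ σ
          σ≥0 = *-nonNeg (ι-nonNeg Γ) (*-nonNeg v≥0 u≥0)

          C : Coverage (m H)
          C = familyCoverage (m H) n t F σ σ≥0 universe

          value≡ : ∀ i k → approx (Coverage.value C (T i)) k ≡ ι (g (toℕ i)) ℚ.* σ
          value≡ i k = trans (familyCoverage-value (m H) n t F σ σ≥0 (T i) (t (toℕ i)) (t≡ i) universe k)
            (cong (λ z → ι z ℚ.* σ) (sym (realizes (toℕ i) (toℕ<n i))))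

          vu≥0 : 0ℚ ℚ.≤ v ℚ.* u
          vu≥0 = *-nonNeg v≥0 u≥0

          ΓFg : ∀ i → F (toℕ i) ℕ.* D ℕ.≤ g (toℕ i) ℕ.* Γ
          ΓFg i with g (toℕ i) in e
          ... | zero  = ℕ.≤-trans (ℕ.≤-reflexive (cong (ℕ._* D) (F≡0 i e))) ℕ.z≤n
          ... | suc k = ℕ.≤-trans (dominates (toℕ i) (toℕ<n i)) (ℕ.≤-reflexive (cong (ℕ._* Γ) (trans (cong positivePart e) (positivePart-suc k))))

          f-≤ : ∀ i → fromℚ (f i) ≤ Coverage.value C (T i)
          f-≤ i = pointwise-≤ (fromℚ (f i)) (Coverage.value C (T i)) λ k → begin
            f i                                          ≡⟨ f≡ i ⟩
            ι (F (toℕ i)) ℚ.* u                          ≡⟨ cong (ℚ._* u) (trans (cong (ι (F (toℕ i)) ℚ.*_) (ι*inv D>0)) (ℚ.*-identityʳ (ι (F (toℕ i))))) ⟨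
            ι (F (toℕ i)) ℚ.* (ι D ℚ.* v) ℚ.* u          ≡⟨ solve 4 (λ a d v u → a :* (d :* v) :* u := a :* d :* (v :* u)) refl (ι (F (toℕ i))) (ι D) v u ⟩
            ι (F (toℕ i)) ℚ.* ι D ℚ.* (v ℚ.* u)          ≡⟨ cong (ℚ._* (v ℚ.* u)) (ι-* (F (toℕ i)) D) ⟨
            ι (F (toℕ i) ℕ.* D) ℚ.* (v ℚ.* u)            ≤⟨ ℚ.*-monoʳ-≤-nonNeg (v ℚ.* u) {{ℚ.nonNegative vu≥0}} (ι-mono (ΓFg i)) ⟩
            ι (g (toℕ i) ℕ.* Γ) ℚ.* (v ℚ.* u)            ≡⟨ trans (cong (ℚ._* (v ℚ.* u)) (ι-* (g (toℕ i)) Γ)) (ℚ.*-assoc (ι (g (toℕ i))) (ι Γ) (v ℚ.* u)) ⟩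
            ι (g (toℕ i)) ℚ.* σ                          ≡⟨ value≡ i k ⟨
            approx (Coverage.value C (T i)) k            ∎
            where open ℚ.≤-Reasoning
                  open +-*-Solver using (solve; _:*_; _:=_)

          ≤-βf : ∀ i → Coverage.value C (T i) ≤ fromℚ β * fromℚ (f i)
          ≤-βf i = pointwise-≤ (Coverage.value C (T i)) (fromℚ β * fromℚ (f i)) λ k → begin
            approx (Coverage.value C (T i)) k            ≡⟨ value≡ i k ⟩
            ι (g (toℕ i)) ℚ.* σ                          ≡⟨ trans (cong (ℚ._* (v ℚ.* u)) (ι-* (g (toℕ i)) Γ)) (ℚ.*-assoc (ι (g (toℕ i))) (ι Γ) (v ℚ.* u)) ⟨
            ι (g (toℕ i) ℕ.* Γ) ℚ.* (v ℚ.* u)            ≤⟨ ℚ.*-monoʳ-≤-nonNeg (v ℚ.* u) {{ℚ.nonNegative vu≥0}} (ι-mono gΓ≤) ⟩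
            ι (R ℕ.* Γ ℕ.* F (toℕ i)) ℚ.* (v ℚ.* u)      ≡⟨ cong (ℚ._* (v ℚ.* u)) (ι-* (R ℕ.* Γ) (F (toℕ i))) ⟩
            ι (R ℕ.* Γ) ℚ.* ι (F (toℕ i)) ℚ.* (v ℚ.* u)  ≡⟨ solve 4 (λ r a v u → r :* a :* (v :* u) := r :* v :* (a :* u)) refl (ι (R ℕ.* Γ)) (ι (F (toℕ i))) v u ⟩
            β ℚ.* (ι (F (toℕ i)) ℚ.* u)                  ≡⟨ cong (β ℚ.*_) (f≡ i) ⟨
            β ℚ.* f i                                    ∎
            where
            open ℚ.≤-Reasoning
            open +-*-Solver using (solve; _:*_; _:=_)
            gΓ≤ : g (toℕ i) ℕ.* Γ ℕ.≤ R ℕ.* Γ ℕ.* F (toℕ i)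
            gΓ≤ = ℕ.≤-trans (ℕ.*-monoˡ-≤ Γ (upper (toℕ i) (toℕ<n i)))
              (ℕ.≤-reflexive (ℕ-Solver.solve 3 (λ r f γ → r ℕ-Solver.:* f ℕ-Solver.:* γ ℕ-Solver.:= r ℕ-Solver.:* γ ℕ-Solver.:* f) refl R (F (toℕ i)) Γ))

          extension : Extendable H (fromℚ β)
          extension = Coverage.value C , (C , λ S → ≤-refl {Coverage.value C S} , ≤-refl {Coverage.value C S}) , All.tabulate λ {P} P∈ →
            subst (λ P → fromℚ (Point.f P) ≤ Coverage.value C (Point.T P) × Coverage.value C (Point.T P) ≤ fromℚ β * fromℚ (Point.f P))
              (sym (lookup-index P∈)) (f-≤ (Any.index P∈) , ≤-βf (Any.index P∈))

      approximates : ∀ ρ → fromℚ (ι R) ≤ ρ → Approximates β ρ H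
      approximates ρ R≤ρ α (1≤α , (h , (C , h≃) , all) , least) =
        -- The extension of factor `β` depends on the optimal one: it is the latter that excludes
        -- `g i = 0` with `F i` positive.
        least (fromℚ β) (fromℚ-mono 1≤β) (Upper.extension F≡0) , β≤ρα
        where
        at : ∀ i → fromℚ (f i) ≤ h (T i) × h (T i) ≤ α * fromℚ (f i)
        at i = All.lookup all (∈-lookup {xs = points H} i)
        open Lower {α} 1≤α C
          (λ i → ≤-trans {fromℚ (f i)} {h (T i)} {Coverage.value C (T i)} (proj₁ (at i)) (proj₁ (h≃ (T i))))
          (λ i → ≤-trans {Coverage.value C (T i)} {h (T i)} {α * fromℚ (f i)} (proj₂ (h≃ (T i))) (proj₂ (at i)))
        c : ℚ
        c = ι R ℚ.* v
        left≡ : ι Γ ℚ.* c ≡ β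
        left≡ = trans (sym (ℚ.*-assoc (ι Γ) (ι R) v)) (cong (ℚ._* v) (trans (ℚ.*-comm (ι Γ) (ι R)) (sym (ι-* R Γ))))
        right≡ : ι D ℚ.* c ≡ ι R
        right≡ = trans (cong (ι D ℚ.*_) (ℚ.*-comm (ι R) v)) (trans (sym (ℚ.*-assoc (ι D) v (ι R))) (trans (cong (ℚ._* ι R) (ι*inv D>0)) (ℚ.*-identityˡ (ι R))))
        β≤αR : fromℚ β ≤ α * fromℚ (ι R)
        β≤αR = subst₂ (λ a b → fromℚ a ≤ α * fromℚ b) left≡ right≡
          (scale-≤ {c} {ι Γ} {α} {ι D} (*-nonNeg (ι-nonNeg R) v≥0) Γ≤αD)
        β≤ρα : fromℚ β ≤ ρ * α
        β≤ρα = ≤-trans {fromℚ β} {α * fromℚ (ι R)} {ρ * α} β≤αR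
          (≤-trans {α * fromℚ (ι R)} {fromℚ (ι R) * α} {ρ * α}
            (pointwise-≤ (α * fromℚ (ι R)) (fromℚ (ι R) * α) λ i → ℚ.≤-reflexive (ℚ.*-comm (approx α i) (ι R)))
            (*-monoʳ-≤ {α} {fromℚ (ι R)} {ρ} 1≤α R≤ρ))

-- The achieved ratio against the claimed factor.

module Bounds where

  open import Defs
  open Reals
  open Ranges
  open import Data.Integer.Base using (+_)
  open import Data.Nat.Base as ℕ using (ℕ; zero; suc; _∸_; _^_; s≤s; z≤n)
  import Data.Nat.Properties as ℕ
  open import Data.Nat.Solver using (module +-*-Solver)
  open import Data.Product.Base using (∃-syntax; _×_; _,_)
  open import Data.Rational.Base as ℚ using (ℚ; 0ℚ; 1ℚ)
  import Data.Rational.Properties as ℚ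
  import Data.Rational.Solver as ℚ-Solver
  open import Data.Sum.Base using (_⊎_; inj₁; inj₂)
  open import Relation.Binary.PropositionalEquality
  open import Relation.Nullary using (yes; no; contradiction)

  -- the least q with q³ ≥ m
  root : ℕ → ℕ
  root m = Max m λ k → (1 ℕ.+ k) ℕ.* lt (k ℕ.* (k ℕ.* k)) m

  useBlocks : ℕ → ℕ → ℕ
  useBlocks m d = lt 511 d ℕ.* lt (root m ℕ.* root m) d

  usePair : ℕ → ℕ
  usePair m = le m 2

  -- For m = d = 2 the claimed factor is 2^⅔ < d, so m = 2 is solved exactly.
  ratio threshold : ℕ → ℕ → ℕ
  ratio m d = usePair m ℕ.+ (1 ∸ usePair m) ℕ.* (useBlocks m d ℕ.* (3 ℕ.* (root m ℕ.* root m)) ℕ.+ (1 ∸ useBlocks m d) ℕ.* d)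
  threshold m d = useBlocks m d ℕ.* (root m ℕ.* root m) ℕ.+ (1 ∸ useBlocks m d) ℕ.* m

  root>0 : ∀ m → 0 ℕ.< m → 0 ℕ.< root m
  root>0 m 0<m = ℕ.≤-trans (ℕ.≤-reflexive (cong (ℕ._+ 0) (sym (lt-true 0<m))))
    (Max-≥ m (λ k → (1 ℕ.+ k) ℕ.* lt (k ℕ.* (k ℕ.* k)) m) {0} 0<m)

  -- The maximum is taken at the last `k` with `k³ < m`: if the next cube were also below `m`, index
  -- `suc k` would be in range and give a larger value.
  root-spec : ∀ m → 0 ℕ.< m → ∃[ k ] root m ≡ suc k × k ℕ.* (k ℕ.* k) ℕ.< m × m ℕ.≤ suc k ℕ.* (suc k ℕ.* suc k)
  root-spec m 0<m with Max-attained m (λ k → (1 ℕ.+ k) ℕ.* lt (k ℕ.* (k ℕ.* k)) m)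
  ... | inj₁ e = contradiction (ℕ.≤-trans (root>0 m 0<m) (ℕ.≤-reflexive e)) λ ()
  ... | inj₂ (k , k<m , e) with bit-cases (lt-≤1 (k ℕ.* (k ℕ.* k)) m)
  ...   | inj₁ z = contradiction (ℕ.≤-trans (root>0 m 0<m) (ℕ.≤-reflexive (trans e (trans (cong (suc k ℕ.*_) z) (ℕ.*-zeroʳ (suc k)))))) λ ()
  ...   | inj₂ o = k , root≡ , lt⇒< o , ℕ.≮⇒≥ λ q³<m →
      ℕ.1+n≰n (ℕ.≤-trans (ℕ.≤-reflexive (sym (trans (cong (suc (suc k) ℕ.*_) (lt-true q³<m)) (ℕ.*-identityʳ _))))
        (ℕ.≤-trans (Max-≥ m (λ k → (1 ℕ.+ k) ℕ.* lt (k ℕ.* (k ℕ.* k)) m) {suc k} (ℕ.≤-<-trans (cube-≥ (suc k)) q³<m)) (ℕ.≤-reflexive root≡)))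
      where
      root≡ : root m ≡ suc k
      root≡ = trans e (trans (cong (suc k ℕ.*_) o) (ℕ.*-identityʳ (suc k)))
      cube-≥ : ∀ q → q ℕ.≤ q ℕ.* (q ℕ.* q)
      cube-≥ zero    = z≤n
      cube-≥ (suc q) = ℕ.m≤m*n (suc q) (suc q ℕ.* suc q)

  ρ₁ : ℕ → ℕ → ℝ
  ρ₁ m d = (fromℕ d ⊓ (m ^⅔)) * log₂ d

  -- Reduces the comparison with a real factor to integer inequalities: `p / suc q` is a rational
  -- lower bound of the minimum of `d` and `m^⅔`, and `p′ / suc q′` one of `log₂ d`.
  ≤-ρ₁′ : ∀ m d R p q p′ q′ → 1 ℕ.≤ m → 1 ℕ.≤ d → p ℕ.≤ d ℕ.* suc q → p ^ 3 ℕ.≤ m ^ 2 ℕ.* suc q ^ 3 → 2 ^ p′ ℕ.≤ d ^ suc q′ →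
         R ℕ.* (suc q ℕ.* suc q′) ℕ.≤ p ℕ.* p′ → fromℚ (ι R) ≤ ρ₁ m d
  ≤-ρ₁′ m d@(suc _) R p q p′ q′ 1≤m _ p≤ p³≤ 2^≤ R≤ =
    ≤-trans {fromℚ (ι R)} {fromℚ a * fromℚ b} {X * L} (pointwise-≤ (fromℚ (ι R)) (fromℚ a * fromℚ b) λ _ → ιR≤ab)
    (≤-trans {fromℚ a * fromℚ b} {X * fromℚ b} {X * L} (*-fromℚ-mono {b} {fromℚ a} {X} b≥0 a≤X)
    (≤-trans {X * fromℚ b} {fromℚ b * X} {X * L} (pointwise-≤ (X * fromℚ b) (fromℚ b * X) λ i → ℚ.≤-reflexive (ℚ.*-comm (approx X i) b))
    (≤-trans {fromℚ b * X} {L * X} {X * L} (*-monoʳ-≤ {X} {fromℚ b} {L} 1≤X (cut-≤ (log₂-cut d) p′ q′ 2^≤))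
      (pointwise-≤ (L * X) (X * L) λ i → ℚ.≤-reflexive (ℚ.*-comm (approx L i) (approx X i))))))
    where
    X = fromℕ d ⊓ (m ^⅔)
    L = log₂ d
    a = (+ p) ℚ./ suc q
    b = (+ p′) ℚ./ suc q′
    b≥0 : 0ℚ ℚ.≤ b
    b≥0 = /-≤ {0} {p′} 0 q′ z≤n
    a≤X : fromℚ a ≤ X
    a≤X = fromℚ-≤-⊓ {a} {fromℕ d} {m ^⅔} (fromℚ-mono (/-≤ {p} {d} q 0 (ℕ.≤-trans (ℕ.≤-reflexive (ℕ.*-identityʳ p)) p≤))) (cut-≤ (⅔-cut m) p q p³≤)
    1≤X : 1ℝ ≤ X
    1≤X = fromℚ-≤-⊓ {1ℚ} {fromℕ d} {m ^⅔} (fromℚ-mono (ι-mono {1} {d} (s≤s z≤n)))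
      (cut-≤ (⅔-cut m) 1 0 (ℕ.*-mono-≤ (ℕ.^-monoˡ-≤ 2 1≤m) (ℕ.≤-refl {1})))
    u = inv (suc q)
    v = inv (suc q′)
    ιR≤ab : ι R ℚ.≤ a ℚ.* b
    ιR≤ab = begin
      ι R
        ≡⟨ trans (cong₂ (λ s t → ι R ℚ.* (s ℚ.* t)) (ι*inv {suc q} (s≤s z≤n)) (ι*inv {suc q′} (s≤s z≤n))) (ℚ.*-identityʳ (ι R)) ⟨
      ι R ℚ.* ((ι (suc q) ℚ.* u) ℚ.* (ι (suc q′) ℚ.* v))
        ≡⟨ solve 5 (λ r s t u v → r :* ((s :* u) :* (t :* v)) := (r :* (s :* t)) :* (u :* v)) refl (ι R) (ι (suc q)) (ι (suc q′)) u v ⟩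
      (ι R ℚ.* (ι (suc q) ℚ.* ι (suc q′))) ℚ.* (u ℚ.* v)
        ≡⟨ cong (ℚ._* (u ℚ.* v)) (trans (ι-* R (suc q ℕ.* suc q′)) (cong (ι R ℚ.*_) (ι-* (suc q) (suc q′)))) ⟨
      ι (R ℕ.* (suc q ℕ.* suc q′)) ℚ.* (u ℚ.* v)
        ≤⟨ ℚ.*-monoʳ-≤-nonNeg (u ℚ.* v) {{ℚ.nonNegative (*-nonNeg (inv-nonNeg (suc q)) (inv-nonNeg (suc q′)))}} (ι-mono R≤) ⟩
      ι (p ℕ.* p′) ℚ.* (u ℚ.* v)
        ≡⟨ cong (ℚ._* (u ℚ.* v)) (ι-* p p′) ⟩
      ι p ℚ.* ι p′ ℚ.* (u ℚ.* v)
        ≡⟨ solve 4 (λ p p′ u v → p :* p′ :* (u :* v) := (p :* u) :* (p′ :* v)) refl (ι p) (ι p′) u v ⟩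
      (ι p ℚ.* u) ℚ.* (ι p′ ℚ.* v)
        ≡⟨ cong₂ ℚ._*_ (/-≡-*inv p (suc q)) (/-≡-*inv p′ (suc q′)) ⟨
      a ℚ.* b ∎
      where open ℚ.≤-Reasoning
            open ℚ-Solver.+-*-Solver using (solve; _:*_; _:=_)

  -- Opaque, since otherwise every case distinction below unfolds the real numbers.
  opaque
    Within : ℕ → ℕ → ℕ → Set
    Within R m d = fromℚ (ι R) ≤ ρ₁ m d

    within⇒≤ : ∀ {R m d} → Within R m d → fromℚ (ι R) ≤ ρ₁ m d
    within⇒≤ h = h

    ≤-ρ₁ : ∀ m d R p q p′ q′ → 1 ℕ.≤ m → 1 ℕ.≤ d → p ℕ.≤ d ℕ.* suc q → p ^ 3 ℕ.≤ m ^ 2 ℕ.* suc q ^ 3 → 2 ^ p′ ℕ.≤ d ^ suc q′ →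
           R ℕ.* (suc q ℕ.* suc q′) ℕ.≤ p ℕ.* p′ → Within R m d
    ≤-ρ₁ = ≤-ρ₁′

  -- This is `q² ≤ 3 m^⅔`, cubed, for `q = suc k`: from `k = 2` on, `(suc k)² ≤ 3 k²`, and
  -- `k² < m^⅔`.
  square-root-≤ : ∀ m k → k ℕ.* (k ℕ.* k) ℕ.< m → 2 ℕ.≤ k → (suc k ℕ.* suc k) ^ 3 ℕ.≤ m ^ 2 ℕ.* 27
  square-root-≤ m 1 _ (s≤s ())
  square-root-≤ m k@(suc (suc k′)) k³<m _ = begin
    (suc k ℕ.* suc k) ^ 3                          ≤⟨ ℕ.^-monoˡ-≤ 3 sq≤ ⟩
    (3 ℕ.* (k ℕ.* k)) ^ 3                          ≡⟨ solve 1 (λ k → (con 3 :* (k :* k)) :^ 3 := (k :* (k :* k)) :^ 2 :* con 27) refl k ⟩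
    (k ℕ.* (k ℕ.* k)) ^ 2 ℕ.* 27                   ≤⟨ ℕ.*-monoˡ-≤ 27 (ℕ.^-monoˡ-≤ 2 (ℕ.<⇒≤ k³<m)) ⟩
    m ^ 2 ℕ.* 27                                   ∎
    where
    open ℕ.≤-Reasoning
    open +-*-Solver using (solve; con; _:+_; _:*_; _:=_; _:^_)
    sq≤ : suc k ℕ.* suc k ℕ.≤ 3 ℕ.* (k ℕ.* k)
    sq≤ = ℕ.≤-trans (ℕ.m≤m+n _ (2 ℕ.* (k′ ℕ.* k′) ℕ.+ 6 ℕ.* k′ ℕ.+ 3)) (ℕ.≤-reflexive
      (solve 1 (λ k → (con 3 :+ k) :* (con 3 :+ k) :+ (con 2 :* (k :* k) :+ con 6 :* k :+ con 3) := con 3 :* ((con 2 :+ k) :* (con 2 :+ k))) refl k′))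

  root-large : ∀ m k → 512 ℕ.≤ m → m ℕ.≤ suc k ℕ.* (suc k ℕ.* suc k) → 2 ℕ.≤ k
  root-large m 0 512≤m m≤ = contradiction (ℕ.≤-trans 512≤m m≤) (ℕ.<⇒≱ (s≤s (s≤s z≤n)))
  root-large m 1 512≤m m≤ = contradiction (ℕ.≤-trans 512≤m m≤) (ℕ.<⇒≱ (ℕ.m≤m+n 9 503))
  root-large m (suc (suc k)) _ _ = s≤s (s≤s z≤n)

  pair-≤ : ∀ m d → 1 ℕ.≤ m → 2 ℕ.≤ d → Within 1 m d
  pair-≤ m d 1≤m 2≤d = ≤-ρ₁ m d 1 1 0 1 0 1≤m 1≤d (ℕ.≤-trans 1≤d (ℕ.≤-reflexive (sym (ℕ.*-identityʳ d))))
    (ℕ.*-mono-≤ (ℕ.^-monoˡ-≤ 2 1≤m) (ℕ.≤-refl {1})) (ℕ.≤-trans 2≤d (ℕ.≤-reflexive (sym (ℕ.*-identityʳ d)))) ℕ.≤-refl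
    where 1≤d = ℕ.≤-trans (s≤s z≤n) 2≤d

  2^9≤ : ∀ {d} → 511 ℕ.< d → 2 ^ 9 ℕ.≤ d ^ 1
  2^9≤ {d} h = ℕ.≤-trans h (ℕ.≤-reflexive (sym (ℕ.*-identityʳ d)))

  -- The lower bounds `q² / 3` and `9` have exactly the product `3 q²`.
  blocks-≤ρ₁ : ∀ m d → d ℕ.≤ m → 511 ℕ.< d → root m ℕ.* root m ℕ.< d → Within (3 ℕ.* (root m ℕ.* root m)) m d
  blocks-≤ρ₁ m d d≤m 511<d q²<d with root-spec m (ℕ.≤-trans (ℕ.≤-trans (s≤s z≤n) 511<d) d≤m)
  ... | k , root≡ , k³<m , m≤q³ rewrite root≡ =
    ≤-ρ₁ m d (3 ℕ.* Q) Q 2 9 0 (ℕ.≤-trans 1≤d d≤m) 1≤d (ℕ.≤-trans (ℕ.<⇒≤ q²<d) (ℕ.m≤m*n d 3))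
      (square-root-≤ m k k³<m (root-large m k (ℕ.≤-trans 511<d d≤m) m≤q³)) (2^9≤ 511<d)
      (ℕ.≤-reflexive (solve 1 (λ Q → con 3 :* Q :* con 3 := Q :* con 9) refl Q))
    where
    open +-*-Solver using (solve; con; _:*_; _:=_)
    Q = suc k ℕ.* suc k
    1≤d : 1 ℕ.≤ d
    1≤d = ℕ.≤-trans (s≤s z≤n) 511<d

  -- With `log₂ d ≥ suc l` it remains to see `d / suc l ≤ m^⅔`, that is `d³ ≤ m² (suc l)³`; this is
  -- the product of `d² ≤ m²` and `d ≤ (suc l)³`.
  dyadic-≤ρ₁ : ∀ m d l → d ℕ.≤ m → 2 ^ suc l ℕ.≤ d → d ℕ.≤ suc l ^ 3 → Within d m d
  dyadic-≤ρ₁ m d l d≤m 2^≤d d≤l³ = ≤-ρ₁ m d d d l (suc l) 0 (ℕ.≤-trans 1≤d d≤m) 1≤d (ℕ.m≤m*n d (suc l))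
    (ℕ.≤-trans (ℕ.≤-reflexive (solve 1 (λ d → d :^ 3 := d :^ 2 :* d) refl d)) (ℕ.*-mono-≤ (ℕ.^-monoˡ-≤ 2 d≤m) d≤l³))
    (ℕ.≤-trans 2^≤d (ℕ.≤-reflexive (sym (ℕ.*-identityʳ d)))) (ℕ.≤-reflexive (cong (d ℕ.*_) (ℕ.*-identityʳ (suc l))))
    where
    open +-*-Solver using (solve; _:*_; _:=_; _:^_)
    1≤d : 1 ℕ.≤ d
    1≤d = ℕ.≤-trans (ℕ.m^n>0 2 (suc l)) 2^≤d

  -- d ≤ (log₂ d)³ for 4 ≤ d < 2⁹, which is enough because d ≤ m
  additive-≤ρ₁ : ∀ m d → 2 ℕ.< m → 2 ℕ.≤ d → d ℕ.≤ m → d ℕ.≤ 511 ⊎ d ℕ.≤ root m ℕ.* root m → Within d m d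
  additive-≤ρ₁ m d 2<m 2≤d d≤m h with d ℕ.≤? 2
  ... | yes d≤2 with ℕ.≤-antisym d≤2 2≤d
  -- `2 ≤ m^⅔` by `2³ ≤ 3² ≤ m²`, which would fail for `m = 2`.
  ...   | refl = ≤-ρ₁ m 2 2 2 0 1 0 (ℕ.≤-trans (s≤s z≤n) 2<m) (s≤s z≤n) ℕ.≤-refl
                   (ℕ.≤-trans (ℕ.≤-trans (ℕ.m≤m+n 8 1) (ℕ.^-monoˡ-≤ 2 2<m)) (ℕ.≤-reflexive (sym (ℕ.*-identityʳ (m ^ 2))))) ℕ.≤-refl ℕ.≤-refl
  additive-≤ρ₁ m d 2<m 2≤d d≤m h | no d≰2 with d ℕ.≤? 3
  ... | yes d≤3 with ℕ.≤-antisym d≤3 (ℕ.≰⇒> d≰2)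
  -- Again `2 ≤ m^⅔`, and `log₂ 3 ≥ 3 / 2` by `2³ ≤ 3²`; the product is 3.
  ...   | refl = ≤-ρ₁ m 3 3 2 0 3 1 (ℕ.≤-trans (s≤s z≤n) 2<m) (s≤s z≤n) (ℕ.m≤m+n 2 1)
                   (ℕ.≤-trans (ℕ.≤-trans (ℕ.m≤m+n 8 1) (ℕ.^-monoˡ-≤ 2 2<m)) (ℕ.≤-reflexive (sym (ℕ.*-identityʳ (m ^ 2))))) (ℕ.m≤m+n 8 1) ℕ.≤-refl
  additive-≤ρ₁ m d 2<m 2≤d d≤m h | no _ | no d≰3 with d ℕ.≤? 7
  ... | yes d≤ = dyadic-≤ρ₁ m d 1 d≤m (ℕ.≰⇒> d≰3) (ℕ.≤-trans d≤ (ℕ.m≤m+n 7 1))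
  ... | no d≰7 with d ℕ.≤? 15
  ... | yes d≤ = dyadic-≤ρ₁ m d 2 d≤m (ℕ.≰⇒> d≰7) (ℕ.≤-trans d≤ (ℕ.m≤m+n 15 12))
  ... | no d≰15 with d ℕ.≤? 31
  ... | yes d≤ = dyadic-≤ρ₁ m d 3 d≤m (ℕ.≰⇒> d≰15) (ℕ.≤-trans d≤ (ℕ.m≤m+n 31 33))
  ... | no d≰31 with d ℕ.≤? 63
  ... | yes d≤ = dyadic-≤ρ₁ m d 4 d≤m (ℕ.≰⇒> d≰31) (ℕ.≤-trans d≤ (ℕ.m≤m+n 63 62))
  ... | no d≰63 with d ℕ.≤? 127
  ... | yes d≤ = dyadic-≤ρ₁ m d 5 d≤m (ℕ.≰⇒> d≰63) (ℕ.≤-trans d≤ (ℕ.m≤m+n 127 89))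
  ... | no d≰127 with d ℕ.≤? 255
  ... | yes d≤ = dyadic-≤ρ₁ m d 6 d≤m (ℕ.≰⇒> d≰127) (ℕ.≤-trans d≤ (ℕ.m≤m+n 255 88))
  ... | no d≰255 with d ℕ.≤? 511
  ... | yes d≤ = dyadic-≤ρ₁ m d 7 d≤m (ℕ.≰⇒> d≰255) (ℕ.≤-trans d≤ (ℕ.m≤m+n 511 1))
  ... | no d≰511 with h
  ...   | inj₁ d≤511 = contradiction d≤511 d≰511
  ...   | inj₂ d≤q² with root-spec m (ℕ.≤-trans (ℕ.≤-trans (s≤s z≤n) 2≤d) d≤m)
  ...     | k , root≡ , k³<m , m≤q³ =
    -- `d / 9` times 9: from `d ≤ q² ≤ 3 m^⅔` one has `d³ ≤ 27 m²`, well below `9³ m²`, where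
    -- `9³ = 27 + 702`.
    ≤-ρ₁ m d d d 8 9 0 (ℕ.≤-trans 1≤d d≤m) 1≤d (ℕ.m≤m*n d 9)
      (ℕ.≤-trans (ℕ.^-monoˡ-≤ 3 (ℕ.≤-trans d≤q² (ℕ.≤-reflexive (cong₂ ℕ._*_ root≡ root≡))))
        (ℕ.≤-trans (square-root-≤ m k k³<m (root-large m k (ℕ.≤-trans (ℕ.≰⇒> d≰511) d≤m) m≤q³)) (ℕ.*-monoʳ-≤ (m ^ 2) (ℕ.m≤m+n 27 702))))
      (2^9≤ (ℕ.≰⇒> d≰511)) ℕ.≤-refl
    where
    1≤d : 1 ℕ.≤ d
    1≤d = ℕ.≤-trans (s≤s z≤n) 2≤d

  data Choice (m d : ℕ) : Set where
    pair     : m ℕ.≤ 2 → usePair m ≡ 1 → ratio m d ≡ 1 → Choice m d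
    blocks   : usePair m ≡ 0 → threshold m d ≡ root m ℕ.* root m → ratio m d ≡ 3 ℕ.* (root m ℕ.* root m) → Choice m d
    additive : usePair m ≡ 0 → threshold m d ≡ m → ratio m d ≡ d → Choice m d

  choice : ∀ m d → 2 ℕ.≤ d → d ℕ.≤ m → Choice m d × Within (ratio m d) m d
  choice m d 2≤d d≤m = choose (bit-cases (le-≤1 m 2)) (bit-cases large≤1) (bit-cases beyond≤1)
    where
    q² = root m ℕ.* root m
    large beyond : ℕ
    large  = lt 511 d
    beyond = lt q² d
    large≤1 : large ℕ.≤ 1
    large≤1 = lt-≤1 511 d
    beyond≤1 : beyond ℕ.≤ 1
    beyond≤1 = lt-≤1 q² d
    within : ∀ {r} → ratio m d ≡ r → Within r m d → Within (ratio m d) m d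
    within e = subst (λ r → Within r m d) (sym e)
    select₁ : useBlocks m d ≡ 1 → ∀ x y → useBlocks m d ℕ.* x ℕ.+ (1 ∸ useBlocks m d) ℕ.* y ≡ x
    select₁ e x y = trans (cong (λ z → z ℕ.* x ℕ.+ (1 ∸ z) ℕ.* y) e) (trans (ℕ.+-identityʳ (x ℕ.+ 0)) (ℕ.+-identityʳ x))
    select₀ : useBlocks m d ≡ 0 → ∀ x y → useBlocks m d ℕ.* x ℕ.+ (1 ∸ useBlocks m d) ℕ.* y ≡ y
    select₀ e x y = trans (cong (λ z → z ℕ.* x ℕ.+ (1 ∸ z) ℕ.* y) e) (ℕ.+-identityʳ y)
    ratio₀ : usePair m ≡ 0 → ∀ {r} → useBlocks m d ℕ.* (3 ℕ.* q²) ℕ.+ (1 ∸ useBlocks m d) ℕ.* d ≡ r → ratio m d ≡ r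
    ratio₀ z {r} e = trans (cong₂ (λ z x → z ℕ.+ (1 ∸ z) ℕ.* x) z e) (ℕ.+-identityʳ r)
    additive′ : usePair m ≡ 0 → useBlocks m d ≡ 0 → d ℕ.≤ 511 ⊎ d ℕ.≤ q² → Choice m d × Within (ratio m d) m d
    additive′ z o h = additive z (select₀ o q² m) e , within e (additive-≤ρ₁ m d (le≡0⇒> z) 2≤d d≤m h)
      where e = ratio₀ z (select₀ o (3 ℕ.* q²) d)
    choose : usePair m ≡ 0 ⊎ usePair m ≡ 1 → large ≡ 0 ⊎ large ≡ 1 → beyond ≡ 0 ⊎ beyond ≡ 1 → Choice m d × Within (ratio m d) m d
    choose (inj₂ o) _ _ = pair (le⇒≤ o) o e , within e (pair-≤ m d (ℕ.≤-trans (ℕ.≤-trans (s≤s z≤n) 2≤d) d≤m) 2≤d)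
      where e = cong (λ z → z ℕ.+ (1 ∸ z) ℕ.* (useBlocks m d ℕ.* (3 ℕ.* q²) ℕ.+ (1 ∸ useBlocks m d) ℕ.* d)) o
    choose (inj₁ z) (inj₁ p) _        = additive′ z (cong (ℕ._* beyond) p) (inj₁ (lt≡0⇒≥ {511} {d} p))
    choose (inj₁ z) (inj₂ _) (inj₁ q) = additive′ z (trans (cong (large ℕ.*_) q) (ℕ.*-zeroʳ large)) (inj₂ (lt≡0⇒≥ q))
    choose (inj₁ z) (inj₂ p) (inj₂ q) = blocks z (select₁ o q² m) e , within e (blocks-≤ρ₁ m d d≤m (lt⇒< {511} {d} p) (lt⇒< q))
      where
      o : useBlocks m d ≡ 1
      o = cong₂ ℕ._*_ p q
      e = ratio₀ z (select₁ o (3 ℕ.* q²) d)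

-- The algorithm, as functions of the input words and as expressions.

module Algorithm where

  open import Defs
  open Machine using (Exp; num; var; inp; bin; loop; sum; prod; max; hist; #m; #n; eval)
  open Polynomial using (module Poly)
  open Encoding using (bit; tableIndex; module Words)
  open Execution using (module Quotient)
  open Ranges
  open Greedy
  open Reals using (ι; inv; /-≡-*inv; ι-*; ι*inv; ≤-refl)
  open Approximation using (positivePart; positivePart>0; β; approximates)
  open Bounds using (root; root-spec; ratio; threshold; usePair; Choice; choice; within⇒≤)
  open import Data.Bool.Base using (Bool; true; false)
  open import Data.Fin.Base using (Fin; zero; suc; toℕ; fromℕ<)
  open import Data.Fin.Properties using (toℕ-fromℕ<)
  open import Data.Fin.Subset using () renaming (∣_∣ to card)
  import Data.Integer.Base as ℤ
  import Data.Integer.Properties as ℤ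
  open import Data.List.Base as List using (List; []; _∷_; length)
  open import Data.Nat.Base as ℕ using (ℕ; zero; suc; _∸_; s≤s; z≤n)
  open import Data.Nat.Divisibility using (_∣_)
  import Data.Nat.Properties as ℕ
  open import Data.Product.Base using (∃-syntax; _×_; _,_; proj₁; proj₂)
  open import Data.Rational.Base as ℚ using (ℚ; 0ℚ)
  import Data.Rational.Properties as ℚ
  open import Data.Sum.Base using (_⊎_; inj₁; inj₂)
  open import Data.Vec.Base as Vec using (Vec; []; _∷_)
  open import Relation.Binary.PropositionalEquality
  open import Relation.Nullary using (contradiction)

  module Pure (w : ℕ → ℕ) where

    t : ℕ → ℕ → ℕ
    t i j = w (tableIndex w i j)

    -- A common denominator of all the values; with it every `F i` is an integer, its division being
    -- exact.
    Q : ℕ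
    Q = ∏ (w 1) λ i → w (tableIndex w i (w 0 ℕ.+ 1))

    F : ℕ → ℕ
    F i = w (tableIndex w i (w 0 ℕ.+ 0)) ℕ.* ⟦ div ⟧ᵇ Q (w (tableIndex w i (w 0 ℕ.+ 1)))

    d : ℕ
    d = Max (w 1) λ i → ∑ (w 0) (t i)

    module _ (τ sel : ℕ) where

      open Blocks (w 0) (w 1) t F τ (root (w 0)) using (value)
      open Pair (w 0) (w 1) t F using (value₂)

      g : ℕ → ℕ
      g i = sel ℕ.* value₂ i ℕ.+ (1 ∸ sel) ℕ.* value i

      -- A common multiple of all denominators, so that the quotients `F i / g i` are compared as
      -- integers over `D`.
      D : ℕ
      D = ∏ (w 1) λ i → positivePart (g i)

      best : ℕ
      best = Max (w 1) λ i → F i ℕ.* ⟦ div ⟧ᵇ D (positivePart (g i))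

      Γ : ℕ
      Γ = D ℕ.+ (best ∸ D)

  infixl 6 _⊹_ _⊖_
  infixl 7 _⊛_

  _⊹_ _⊖_ _⊛_ _⊘_ : Exp → Exp → Exp
  a ⊹ b = bin add a b
  a ⊖ b = bin sub a b
  a ⊛ b = bin mul a b
  a ⊘ b = bin div a b

  nzᴱ : Exp → Exp
  nzᴱ a = num 1 ⊖ (num 1 ⊖ a)

  ltᴱ leᴱ : Exp → Exp → Exp
  ltᴱ a b = nzᴱ (b ⊖ a)
  leᴱ a b = num 1 ⊖ (a ⊖ b)

  M N : Exp
  M = inp (num 0)
  N = inp (num 1)

  entry : Exp → Exp → Exp
  entry i j = inp ((num 2 ⊹ i ⊛ (M ⊹ num 2)) ⊹ j)

  -- Arguments are substituted under loops, so each loop written below has a variable number of its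
  -- own and captures nothing. The second number, here 0, is a placeholder except for `hist`, where
  -- it names the history.
  Qᴱ : Exp
  Qᴱ = loop prod 0 0 #n (entry (var 0) (M ⊹ num 1))

  Fᴱ : Exp → Exp
  Fᴱ i = entry i (M ⊹ num 0) ⊛ (Qᴱ ⊘ entry i (M ⊹ num 1))

  Wᴱ : Exp
  Wᴱ = loop sum 1 0 #n (Fᴱ (var 1))

  hᴱ : Exp → Exp
  hᴱ j = Wᴱ ⊖ loop max 2 0 #n (entry (var 2) j ⊛ (Wᴱ ⊖ Fᴱ (var 2)))

  rootᴱ : Exp
  rootᴱ = loop max 3 0 #m ((num 1 ⊹ var 3) ⊛ ltᴱ (var 3 ⊛ (var 3 ⊛ var 3)) M)

  closeᴱ : Exp → Exp → Exp
  closeᴱ i j = entry i j ⊛ leᴱ (Fᴱ i) (rootᴱ ⊛ hᴱ j)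

  pow2ᴱ : Exp → Exp
  pow2ᴱ k = loop prod 4 0 #n (num 1 ⊹ ltᴱ (var 4) k)

  digitᴱ : Exp → Exp → Exp
  digitᴱ H k = (H ⊘ pow2ᴱ k) ⊖ num 2 ⊛ ((H ⊘ pow2ᴱ k) ⊘ num 2)

  dᴱ : Exp
  dᴱ = loop max 5 0 #n (loop sum 6 0 #m (entry (var 5) (var 6)))

  bothᴱ : Exp → Exp
  bothᴱ i = leᴱ (num 2) (loop sum 7 0 #m (entry i (var 7)))

  value₂ᴱ : Exp → Exp
  value₂ᴱ i = loop sum 8 0 #m (entry i (var 8) ⊛ hᴱ (var 8)) ⊖
    bothᴱ i ⊛ ((hᴱ (num 0) ⊹ hᴱ (num 1)) ⊖ (Wᴱ ⊖ loop max 9 0 #n (bothᴱ (var 9) ⊛ (Wᴱ ⊖ Fᴱ (var 9)))))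

  module Expressions (τᴱ selᴱ Rᴱ : Exp) where

    fireᴱ : Exp → Exp → Exp
    fireᴱ i H = ltᴱ τᴱ (loop sum 10 0 #m (closeᴱ i (var 10) ⊛
      (num 1 ⊖ loop sum 11 0 #n (ltᴱ (var 11) i ⊛ digitᴱ H (i ⊖ (num 1 ⊹ var 11)) ⊛ closeᴱ (var 11) (var 10)))))

    firedᴱ : Exp → Exp
    firedᴱ i = digitᴱ (loop hist 12 13 #n (fireᴱ (var 12) (var 13))) (N ⊖ (num 1 ⊹ i))

    singleᴱ : Exp → Exp
    singleᴱ j = num 1 ⊖ loop sum 14 0 #n (firedᴱ (var 14) ⊛ closeᴱ (var 14) j)

    valueᴱ : Exp → Exp
    valueᴱ i = loop sum 15 0 #m (entry i (var 15) ⊛ singleᴱ (var 15) ⊛ hᴱ (var 15)) ⊹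
      loop sum 16 0 #n (firedᴱ (var 16) ⊛ nzᴱ (loop sum 17 0 #m (entry i (var 17) ⊛ closeᴱ (var 16) (var 17))) ⊛ Fᴱ (var 16))

    gᴱ : Exp → Exp
    gᴱ i = selᴱ ⊛ value₂ᴱ i ⊹ (num 1 ⊖ selᴱ) ⊛ valueᴱ i

    positiveᴱ : Exp → Exp
    positiveᴱ a = a ⊹ (num 1 ⊖ a)

    Dᴱ : Exp
    Dᴱ = loop prod 18 0 #n (positiveᴱ (gᴱ (var 18)))

    bestᴱ : Exp
    bestᴱ = loop max 19 0 #n (Fᴱ (var 19) ⊛ (Dᴱ ⊘ positiveᴱ (gᴱ (var 19))))

    numᴱ denᴱ : Exp
    numᴱ = Rᴱ ⊛ (Dᴱ ⊹ (bestᴱ ⊖ Dᴱ))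
    denᴱ = Dᴱ

  useBlocksᴱ : Exp
  useBlocksᴱ = ltᴱ (num 511) dᴱ ⊛ ltᴱ (rootᴱ ⊛ rootᴱ) dᴱ

  usePairᴱ : Exp
  usePairᴱ = leᴱ M (num 2)

  ratioᴱ thresholdᴱ : Exp
  ratioᴱ = usePairᴱ ⊹ (num 1 ⊖ usePairᴱ) ⊛ (useBlocksᴱ ⊛ (num 3 ⊛ (rootᴱ ⊛ rootᴱ)) ⊹ (num 1 ⊖ useBlocksᴱ) ⊛ dᴱ)
  thresholdᴱ = useBlocksᴱ ⊛ (rootᴱ ⊛ rootᴱ) ⊹ (num 1 ⊖ useBlocksᴱ) ⊛ M

  module Generic = Expressions thresholdᴱ usePairᴱ ratioᴱ
  module Additive = Expressions M (num 0) dᴱ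


  -- `∑` peels off the last index, while vectors and lists are taken apart at the first.
  ∑-shift : ∀ k f → ∑ (suc k) f ≡ f 0 ℕ.+ ∑ k (λ j → f (suc j))
  ∑-shift zero    f = sym (ℕ.+-identityʳ (f 0))
  ∑-shift (suc k) f = trans (cong (ℕ._+ f (suc k)) (∑-shift k f)) (ℕ.+-assoc (f 0) (∑ k (λ j → f (suc j))) (f (suc k)))

  Max-shift : ∀ k f → Max (suc k) f ≡ f 0 ℕ.⊔ Max k (λ j → f (suc j))
  Max-shift zero    f = sym (ℕ.⊔-identityʳ (f 0))
  Max-shift (suc k) f = trans (step-max (Max (suc k) f) (f (suc k))) (trans (cong (ℕ._⊔ f (suc k)) (Max-shift k f))
    (trans (ℕ.⊔-assoc (f 0) (Max k (λ j → f (suc j))) (f (suc k))) (cong (f 0 ℕ.⊔_) (sym (step-max (Max k (λ j → f (suc j))) (f (suc k)))))))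

  ∑-card : ∀ {k} (v : Vec Bool k) row → (∀ j → row (toℕ j) ≡ bit (Vec.lookup v j)) → ∑ k row ≡ card v
  ∑-card []       row h = refl
  ∑-card {suc k} (b ∷ v) row h = trans (∑-shift k row) (trans (cong₂ ℕ._+_ (h zero) (∑-card v (λ j → row (suc j)) λ j → h (suc j))) (count b))
    where
    count : ∀ b → bit b ℕ.+ card v ≡ card (b ∷ v)
    count true  = refl
    count false = refl

  Max-foldr : ∀ {A : Set} (c : A → ℕ) (xs : List A) f → (∀ i → f (toℕ i) ≡ c (List.lookup xs i)) →
              Max (length xs) f ≡ List.foldr ℕ._⊔_ 0 (List.map c xs)
  Max-foldr c []       f h = refl
  Max-foldr c (x ∷ xs) f h = trans (Max-shift (length xs) f) (cong₂ ℕ._⊔_ (h zero) (Max-foldr c xs (λ i → f (suc i)) λ i → h (suc i)))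

  Max-≤ : ∀ k f {c} → (∀ i → i ℕ.< k → f i ℕ.≤ c) → Max k f ℕ.≤ c
  Max-≤ k f h with Max-attained k f
  ... | inj₁ e = ℕ.≤-trans (ℕ.≤-reflexive e) z≤n
  ... | inj₂ (i , i<k , e) = ℕ.≤-trans (ℕ.≤-reflexive e) (h i i<k)

  module _ (m n : ℕ) (t : ℕ → ℕ → ℕ) (F : ℕ → ℕ) where
    open Minima m n t F

    approximant-cong : ∀ {g g′ R} → (∀ i → g i ≡ g′ i) → Approximant g′ R → Approximant g R
    approximant-cong g≡ A = record
      { universe = universe
      ; realizes = λ i i<n → trans (g≡ i) (realizes i i<n)
      ; lower    = λ i i<n → subst (Covers (λ j → t i j ≡ 1)) (sym (g≡ i)) (lower i i<n)
      ; upper    = λ i i<n → ℕ.≤-trans (ℕ.≤-reflexive (g≡ i)) (upper i i<n)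
      }
      where open Approximant A

  -- Stated for a variable `m`, so that the equation `m ≡ 2` can be matched; for the `m` of an
  -- instance it could not.
  pair-approximant : ∀ m n t F → m ≡ 2 → (∀ i j → i ℕ.< n → j ℕ.< m → t i j ℕ.≤ 1) → ∃[ i ] i ℕ.< n × 2 ℕ.≤ ∑ m (t i) →
                     Minima.Approximant m n t F (Pair.value₂ m n t F) 1
  pair-approximant m n t F refl t≤1 (i , i<n , 2≤) = pair n t F t≤1 (i , i<n , le-true 2≤)

  module Instance (H : PartialFunction) where
    open Words H using (n; input; indicator; numerator; denominator)
    open Pure input public

    t≡ : ∀ (i : Fin n) (j : Fin (m H)) → t (toℕ i) (toℕ j) ≡ bit (Vec.lookup (Point.T (List.lookup (points H) i)) j)
    t≡ = indicator

    t≤1 : ∀ i j → i ℕ.< n → j ℕ.< m H → t i j ℕ.≤ 1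
    t≤1 i j i<n j<m = subst₂ (λ i j → t i j ℕ.≤ 1) (toℕ-fromℕ< i<n) (toℕ-fromℕ< j<m)
      (ℕ.≤-trans (ℕ.≤-reflexive (t≡ (fromℕ< i<n) (fromℕ< j<m))) (bit≤1 (Vec.lookup (Point.T (List.lookup (points H) (fromℕ< i<n))) (fromℕ< j<m))))
      where
      bit≤1 : ∀ b → bit b ℕ.≤ 1
      bit≤1 true  = ℕ.≤-refl
      bit≤1 false = z≤n

    d≡dim : d ≡ dim H
    d≡dim = Max-foldr (λ P → card (Point.T P)) (points H) (λ i → ∑ (m H) (t i)) λ i → ∑-card (Point.T (List.lookup (points H) i)) (t (toℕ i)) (t≡ i)

    d≤m : d ℕ.≤ m H
    d≤m = Max-≤ n (λ i → ∑ (m H) (t i)) λ i i<n → ℕ.≤-trans (∑-≤ (m H) 1 λ j j<m → t≤1 i j i<n j<m) (ℕ.≤-reflexive (ℕ.*-identityʳ (m H)))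

    size≤d : ∀ i → i ℕ.< n → ∑ (m H) (t i) ℕ.≤ d
    size≤d i = Max-≥ n (λ i → ∑ (m H) (t i))

    denominator>0 : ∀ i → i ℕ.< n → 0 ℕ.< input (tableIndex input i (m H ℕ.+ 1))
    denominator>0 i i<n = subst (λ i → 0 ℕ.< input (tableIndex input i (m H ℕ.+ 1))) (toℕ-fromℕ< i<n)
      (ℕ.≤-trans (s≤s z≤n) (ℕ.≤-reflexive (sym (denominator (fromℕ< i<n)))))

    Q>0 : 0 ℕ.< Q
    Q>0 = ∏-pos′ n denominator>0

    f≡ : ∀ (i : Fin n) → Point.f (List.lookup (points H) i) ≡ ι (F (toℕ i)) ℚ.* inv Q
    f≡ i = begin
      f                                              ≡⟨ ℚ.↥p/↧p≡p f ⟨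
      ℚ.↥ f ℚ./ ℚ.↧ₙ f                               ≡⟨ cong (ℚ._/ ℚ.↧ₙ f) (sym (ℤ.0≤i⇒+∣i∣≡i (numerator≥0 f f≥0))) ⟩
      (ℤ.+ p) ℚ./ ℚ.↧ₙ f                             ≡⟨ /-≡-*inv p (ℚ.↧ₙ f) ⟩
      ι p ℚ.* inv q                                  ≡⟨ cong (ι p ℚ.*_) inv≡ ⟩
      ι p ℚ.* (ι Q/q ℚ.* inv Q)                      ≡⟨ ℚ.*-assoc (ι p) (ι Q/q) (inv Q) ⟨
      ι p ℚ.* ι Q/q ℚ.* inv Q                        ≡⟨ cong (ℚ._* inv Q) (ι-* p Q/q) ⟨
      ι (p ℕ.* Q/q) ℚ.* inv Q                        ≡⟨ cong₂ (λ p q → ι (p ℕ.* ⟦ div ⟧ᵇ Q q) ℚ.* inv Q) (numerator i) (denominator i) ⟨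
      ι (F (toℕ i)) ℚ.* inv Q                        ∎
      where
      open ≡-Reasoning
      f = Point.f (List.lookup (points H) i)
      f≥0 = Point.f≥0 (List.lookup (points H) i)
      p = ℤ.∣ ℚ.↥ f ∣
      q = ℚ.↧ₙ f
      Q/q = ⟦ div ⟧ᵇ Q q
      numerator≥0 : ∀ f → 0ℚ ℚ.≤ f → ℤ.0ℤ ℤ.≤ ℚ.↥ f
      numerator≥0 f@record{} h = ℤ.nonNegative⁻¹ (ℚ.↥ f) {{ℚ.nonNegative h}}
      q∣Q : q ∣ Q
      q∣Q = subst (_∣ Q) (denominator i) (∏-∣ n (λ i → input (tableIndex input i (m H ℕ.+ 1))) (toℕ<n i))
        where open import Data.Fin.Properties using (toℕ<n)
      q>0 : 0 ℕ.< q
      q>0 = s≤s z≤n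
      inv≡ : inv q ≡ ι Q/q ℚ.* inv Q
      inv≡ = begin
        inv q                                        ≡⟨ trans (cong (inv q ℚ.*_) (ι*inv Q>0)) (ℚ.*-identityʳ (inv q)) ⟨
        inv q ℚ.* (ι Q ℚ.* inv Q)                    ≡⟨ cong (λ z → inv q ℚ.* (z ℚ.* inv Q)) (trans (cong ι (sym (div-exact q>0 q∣Q))) (ι-* Q/q q)) ⟩
        inv q ℚ.* (ι Q/q ℚ.* ι q ℚ.* inv Q)          ≡⟨ solve 4 (λ i a b c → i :* (a :* b :* c) := (b :* i) :* (a :* c)) refl (inv q) (ι Q/q) (ι q) (inv Q) ⟩
        (ι q ℚ.* inv q) ℚ.* (ι Q/q ℚ.* inv Q)        ≡⟨ trans (cong (ℚ._* (ι Q/q ℚ.* inv Q)) (ι*inv q>0)) (ℚ.*-identityˡ _) ⟩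
        ι Q/q ℚ.* inv Q                              ∎
        where open import Data.Rational.Solver
              open +-*-Solver using (solve; _:*_; _:=_)

    module _ (τ sel : ℕ) where

      D>0 : 0 ℕ.< D τ sel
      D>0 = ∏-pos n λ i → positivePart>0 (g τ sel i)

      private
        G = D τ sel
        Y = best τ sel
        p : ℕ → ℕ
        p i = positivePart (g τ sel i)
        N′ : ℕ → ℕ
        N′ i = F i ℕ.* ⟦ div ⟧ᵇ G (p i)

        Γ≡⊔ : Γ τ sel ≡ G ℕ.⊔ Y
        Γ≡⊔ = step-max G Y

        exact : ∀ i → i ℕ.< n → N′ i ℕ.* p i ≡ F i ℕ.* G
        exact i i<n = trans (ℕ.*-assoc (F i) (⟦ div ⟧ᵇ G (p i)) (p i))
          (cong (F i ℕ.*_) (div-exact (positivePart>0 (g τ sel i)) (∏-∣ n p i<n)))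

      D≤Γ : D τ sel ℕ.≤ Γ τ sel
      D≤Γ = ℕ.m≤m+n G (Y ∸ G)

      dominates : ∀ i → i ℕ.< n → F i ℕ.* D τ sel ℕ.≤ positivePart (g τ sel i) ℕ.* Γ τ sel
      dominates i i<n = ℕ.≤-trans (ℕ.≤-reflexive (trans (sym (exact i i<n)) (ℕ.*-comm (N′ i) (p i))))
        (ℕ.*-monoʳ-≤ (p i) (ℕ.≤-trans (Max-≥ n N′ i<n) (ℕ.≤-trans (ℕ.m≤n⊔m G Y) (ℕ.≤-reflexive (sym Γ≡⊔)))))

      attained : Γ τ sel ≡ D τ sel ⊎ ∃[ i ] i ℕ.< n × Γ τ sel ℕ.* positivePart (g τ sel i) ≡ F i ℕ.* D τ sel
      attained = go (ℕ.⊔-sel G Y) (Max-attained n N′)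
        where
        go : G ℕ.⊔ Y ≡ G ⊎ G ℕ.⊔ Y ≡ Y → Y ≡ 0 ⊎ ∃[ i ] i ℕ.< n × Y ≡ N′ i →
             Γ τ sel ≡ G ⊎ ∃[ i ] i ℕ.< n × Γ τ sel ℕ.* p i ≡ F i ℕ.* G
        go (inj₁ e) _ = inj₁ (trans Γ≡⊔ e)
        go (inj₂ e) (inj₁ z) = contradiction (ℕ.≤-trans D>0 (ℕ.≤-trans (ℕ.m≤m⊔n G Y) (ℕ.≤-reflexive (trans e z)))) λ ()
        go (inj₂ e) (inj₂ (i , i<n , e′)) = inj₂ (i , i<n , trans (cong (ℕ._* p i) (trans Γ≡⊔ (trans e e′))) (exact i i<n))

      approximates-ratio : ∀ R → 1 ℕ.≤ R → Minima.Approximant (m H) n t F (g τ sel) R → ∀ ρ → fromℚ (ι R) ≤ ρ →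
                           Approximates (ι (R ℕ.* Γ τ sel) ℚ.* inv (D τ sel)) ρ H
      approximates-ratio R 1≤R A = approximates H t F Q Q>0 t≡ f≡ (g τ sel) R 1≤R A (D τ sel) (Γ τ sel) D>0 D≤Γ dominates attained

    select₀ : ∀ τ {sel} → sel ≡ 0 → ∀ i → g τ sel i ≡ Blocks.value (m H) n t F τ (root (m H)) i
    select₀ τ refl i = ℕ.+-identityʳ (Blocks.value (m H) n t F τ (root (m H)) i)

    select₁ : ∀ τ {sel} → sel ≡ 1 → ∀ i → g τ sel i ≡ Pair.value₂ (m H) n t F i
    select₁ τ refl i = trans (ℕ.+-identityʳ _) (ℕ.+-identityʳ (Pair.value₂ (m H) n t F i))

    approximates-dim : 1 ℕ.≤ dim H → Approximates (ι (d ℕ.* Γ (m H) 0) ℚ.* inv (D (m H) 0)) (fromℕ (dim H)) H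
    approximates-dim 1≤dim = approximates-ratio (m H) 0 d (subst (1 ℕ.≤_) (sym d≡dim) 1≤dim)
      (approximant-cong (m H) n t F (select₀ (m H) refl) (Blocks.additive (m H) n t F (m H) (root (m H)) t≤1 ℕ.≤-refl size≤d))
      (fromℕ (dim H)) (subst (λ k → fromℚ (ι d) ≤ fromℕ k) d≡dim (≤-refl {fromℕ d}))

    approximates-min : 2 ℕ.≤ dim H →
      Approximates (ι (ratio (m H) d ℕ.* Γ (threshold (m H) d) (usePair (m H))) ℚ.* inv (D (threshold (m H) d) (usePair (m H))))
        ((fromℕ (dim H) ⊓ (m H ^⅔)) * log₂ (dim H)) H
    approximates-min 2≤dim = approximates-ratio τ s R (proj₁ A) (proj₂ A) ((fromℕ (dim H) ⊓ (m H ^⅔)) * log₂ (dim H))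
      (subst (λ k → fromℚ (ι R) ≤ (fromℕ k ⊓ (m H ^⅔)) * log₂ k) d≡dim (within⇒≤ {R} {m H} {d} (proj₂ c)))
      where
      τ = threshold (m H) d
      s = usePair (m H)
      R = ratio (m H) d
      2≤d : 2 ℕ.≤ d
      2≤d = subst (2 ℕ.≤_) (sym d≡dim) 2≤dim
      c = choice (m H) d 2≤d d≤m
      0<m : 0 ℕ.< m H
      0<m = ℕ.≤-trans (s≤s z≤n) (ℕ.≤-trans 2≤d d≤m)
      pairOf : ∃[ i ] i ℕ.< n × 2 ℕ.≤ ∑ (m H) (t i)
      pairOf = go (Max-attained n λ i → ∑ (m H) (t i))
        where
        go : d ≡ 0 ⊎ ∃[ i ] i ℕ.< n × d ≡ ∑ (m H) (t i) → ∃[ i ] i ℕ.< n × 2 ℕ.≤ ∑ (m H) (t i)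
        go (inj₁ z) = contradiction (ℕ.≤-trans 2≤d (ℕ.≤-reflexive z)) λ ()
        go (inj₂ (i , i<n , e)) = i , i<n , ℕ.≤-trans 2≤d (ℕ.≤-reflexive e)
      with-ratio : ∀ {r} → R ≡ r → 1 ℕ.≤ r → Minima.Approximant (m H) n t F (g τ s) r → 1 ℕ.≤ R × Minima.Approximant (m H) n t F (g τ s) R
      with-ratio e 1≤r A = subst (λ r → 1 ℕ.≤ r × Minima.Approximant (m H) n t F (g τ s) r) (sym e) (1≤r , A)
      root-facts : ∃[ k ] root (m H) ≡ suc k × k ℕ.* (k ℕ.* k) ℕ.< m H × m H ℕ.≤ suc k ℕ.* (suc k ℕ.* suc k)
      root-facts = root-spec (m H) 0<m
      A : 1 ℕ.≤ R × Minima.Approximant (m H) n t F (g τ s) R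
      A = go (proj₁ c)
        where
        go : Choice (m H) d → 1 ℕ.≤ R × Minima.Approximant (m H) n t F (g τ s) R
        go (Choice.pair m≤2 s≡1 R≡1) = with-ratio R≡1 ℕ.≤-refl (approximant-cong (m H) n t F (select₁ τ s≡1)
          (pair-approximant (m H) n t F (ℕ.≤-antisym m≤2 (ℕ.≤-trans 2≤d d≤m)) t≤1 pairOf))
        go (Choice.additive s≡0 τ≡m R≡d) = with-ratio R≡d (ℕ.≤-trans (s≤s z≤n) 2≤d) (approximant-cong (m H) n t F (select₀ τ s≡0)
          (Blocks.additive (m H) n t F τ (root (m H)) t≤1 (ℕ.≤-reflexive (sym τ≡m)) size≤d))
        go (Choice.blocks s≡0 τ≡q² R≡) =
          let (k , q≡ , _ , m≤) = root-facts
              q>0 = ℕ.≤-trans (s≤s (z≤n {k})) (ℕ.≤-reflexive (sym q≡))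
          in with-ratio R≡ (ℕ.*-mono-≤ (s≤s (z≤n {2})) (ℕ.*-mono-≤ q>0 q>0)) (approximant-cong (m H) n t F (select₀ τ s≡0)
               (Blocks.blocks (m H) n t F τ (root (m H)) t≤1 q>0 τ≡q² (subst (λ q → m H ℕ.≤ q ℕ.* (q ℕ.* q)) (sym q≡) m≤)))

  points>0 : ∀ H → 1 ℕ.≤ dim H → 1 ℕ.≤ length (points H)
  points>0 (mkPartial m [])      ()
  points>0 (mkPartial m (_ ∷ _)) _ = s≤s z≤n

  size>0 : ∀ H → 1 ℕ.≤ length (points H) → 1 ℕ.≤ size H
  size>0 H _ = ℕ.≤-trans (s≤s z≤n) (Words.length≤size H)

  -- The values are required in every constant environment, because the content of register 0 is an
  -- address that changes with the instance.
  module _ (e₁ e₂ : Exp) (Admissible : PartialFunction → Set) (ρ : PartialFunction → ℝ)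
    (nonempty : ∀ H → Admissible H → 1 ℕ.≤ length (points H))
    (v₁ v₂ : PartialFunction → ℕ)
    (v₁≡ : ∀ H a → eval (Words.input H) (λ _ → a) e₁ ≡ v₁ H)
    (v₂≡ : ∀ H a → eval (Words.input H) (λ _ → a) e₂ ≡ v₂ H)
    (v₂>0 : ∀ H → 0 ℕ.< v₂ H)
    (correct : ∀ H → Admissible H → Approximates (ι (v₁ H) ℚ.* inv (v₂ H)) (ρ H) H)
    where
    open Quotient e₁ e₂ using (program; totalTime-poly; outcome; base; module Outcome)
    open Poly totalTime-poly

    algorithm : ApproximationAlgorithm Admissible ρ
    algorithm = record
      { program  = program
      ; coeff    = coeff
      ; exponent = exponent
      ; run      = λ H h → let open Outcome (outcome H (nonempty H h)) in record
          { final  = memory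
          ; time   = time
          ; run    = run
          ; answer = answer H h
          ; output = nonZero H h , refl
          }
      ; polytime = λ H h → ℕ.≤-trans (Outcome.time≤ (outcome H (nonempty H h))) (bound (size H) (size>0 H (nonempty H h)))
      ; correct  = λ H h → subst (λ β → Approximates β (ρ H) H) (sym (answer≡ H h)) (correct H h)
      }
      where
      final : ∀ H → Admissible H → ℕ → ℕ
      final H h = Outcome.memory (outcome H (nonempty H h))
      out₁ : ∀ H h → final H h 0 ≡ v₁ H
      out₁ H h = trans (Outcome.output₁ (outcome H (nonempty H h))) (v₁≡ H (base H (nonempty H h)))
      out₂ : ∀ H h → final H h 1 ≡ v₂ H
      out₂ H h = trans (Outcome.output₂ (outcome H (nonempty H h))) (v₂≡ H (base H (nonempty H h)))
      nonZero : ∀ H h → ℕ.NonZero (final H h 1)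
      nonZero H h = ℕ.>-nonZero (subst (0 ℕ.<_) (sym (out₂ H h)) (v₂>0 H))
      answer : ∀ H → Admissible H → ℚ
      answer H h = ((ℤ.+ final H h 0) ℚ./ final H h 1) {{nonZero H h}}
      answer≡ : ∀ H h → answer H h ≡ ι (v₁ H) ℚ.* inv (v₂ H)
      answer≡ H h = trans (/-≡-*inv (final H h 0) (final H h 1) {{nonZero H h}}) (cong₂ (λ a b → ι a ℚ.* inv b) (out₁ H h) (out₂ H h))

open import Defs
open import Data.Nat.Base using (ℕ) renaming (_≤_ to _≤ℕ_)
open import Data.Product.Base using (_×_)

theorem3 : ApproximationAlgorithm
    (λ H → 2 ≤ℕ dim H)
    (λ H → (fromℕ (dim H) ⊓ (m H ^⅔)) * log₂ (dim H))
    ×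
    ((k : ℕ) → ApproximationAlgorithm
    (λ H → 1 ≤ℕ dim H × dim H ≤ℕ k)
    (λ H → fromℕ (dim H)))
theorem3 = minAlgorithm , dimAlgorithm
  where
  open import Data.Nat.Base using (s≤s; z≤n)
  open import Data.Nat.Properties using () renaming (≤-trans to ≤ℕ-trans)
  open import Data.Product.Base using (_,_)
  open import Relation.Binary.PropositionalEquality using (refl)
  open Algorithm
  open Bounds using (ratio; threshold; usePair)
  open import Data.Nat.Base using () renaming (_*_ to _*ℕ_)

  minAlgorithm : ApproximationAlgorithm (λ H → 2 ≤ℕ dim H) (λ H → (fromℕ (dim H) ⊓ (m H ^⅔)) * log₂ (dim H))
  minAlgorithm = algorithm Generic.numᴱ Generic.denᴱ (λ H → 2 ≤ℕ dim H) (λ H → (fromℕ (dim H) ⊓ (m H ^⅔)) * log₂ (dim H))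
    (λ H h → points>0 H (≤ℕ-trans (s≤s z≤n) h))
    (λ H → let open Instance H in ratio (m H) d *ℕ Γ (threshold (m H) d) (usePair (m H)))
    (λ H → let open Instance H in D (threshold (m H) d) (usePair (m H)))
    -- Expressions and functions unfold to the same iterations, so that their agreement is pure
    -- computation.
    (λ H a → refl) (λ H a → refl)
    (λ H → let open Instance H in D>0 (threshold (m H) d) (usePair (m H)))
    (λ H → Instance.approximates-min H)

  dimAlgorithm : ∀ k → ApproximationAlgorithm (λ H → 1 ≤ℕ dim H × dim H ≤ℕ k) (λ H → fromℕ (dim H))
  dimAlgorithm k = algorithm Additive.numᴱ Additive.denᴱ (λ H → 1 ≤ℕ dim H × dim H ≤ℕ k) (λ H → fromℕ (dim H))
    (λ { H (h , _) → points>0 H h })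
    (λ H → let open Instance H in d *ℕ Γ (m H) 0)
    (λ H → let open Instance H in D (m H) 0)
    (λ H a → refl) (λ H a → refl)
    (λ H → Instance.D>0 H (m H) 0)
    (λ { H (h , _) → Instance.approximates-dim H h })
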